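{- $(G_0(\mathbf{\Pi},\wedge),\odot,\Delta)$ is a bialgebra.
   Context: $\Bbbk$ is a field of characteristic zero. $\Pi_n$ is the set of set partitions of $[n]=\{1,\dots,n\}$ ($\Pi_0$ consists only of the empty set partition), ordered by $A\le B$ iff every part of $A$ is contained in a part of $B$. It is a lattice with meet $\wedge$, join $\vee$, maximal element $\mathbf{1}_n=\{[n]\}$, and Möbius function $\mu$. For $A\in\Pi_n$, $B\in\Pi_m$, the set partition $A|B\in\Pi_{n+m}$ consists of the parts of $A$ together with the parts of $B$ with every element shifted by $n$. $(\Bbbk\Pi_n,\wedge)$ is the $\Bbbk$-algebra with basis $\Pi_n$ and product extending $\wedge$ bilinearly (unit $\mathbf{1}_n$); it is commutative and semisimple, with primitive orthogonal idempotents $e_A=\sum_{B\le A}\mu(B,A)B$, and simple modules the one-dimensional spaces $V_A=\Bbbk\Pi_n\wedge e_A$, $A\in\Pi_n$. $G_0(\Bbbk\Pi_n,\wedge)$ is the Grothendieck group of the category of finite dimensional modules, regarded as the vector space spanned by the isomorphism classes of the simple modules $V_A$, $A\in\Pi_n$; $G_0(\mathbf{\Pi},\wedge)=\bigoplus_{n\ge0}G_0(\Bbbk\Pi_n,\wedge)$. The product $\odot$: for two finite dimensional $(\Bbbk\Pi_n,\wedge)$-modules $V,W$, $V\odot W$ is $V\otimes W$ with the diagonal action $C\cdot(v\otimes w)=Cv\otimes Cw$ for $C\in\Pi_n$; it is extended to $G_0(\mathbf{\Pi},\wedge)$ by setting $V_A\odot V_B=0$ if $V_A$ and $V_B$ are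 not of the same degree. The coproduct $\Delta$: let $\rho_{k,n-k}\colon\Bbbk\Pi_k\otimes\Bbbk\Pi_{n-k}\to\Bbbk\Pi_n$ be the injective multiplicative (non-unital) linear map $\rho_{k,n-k}(C\otimes D)=C|D$. For a finite dimensional $(\Bbbk\Pi_n,\wedge)$-module $V$, $\mathrm{Res}_{\rho_{k,n-k}}V=\{v\in V:\rho_{k,n-k}(\mathbf{1}_k\otimes\mathbf{1}_{n-k})v=v\}$, a $\Bbbk\Pi_k\otimes\Bbbk\Pi_{n-k}$-module via $\rho_{k,n-k}$, whose class lies in $G_0(\Bbbk\Pi_k,\wedge)\otimes G_0(\Bbbk\Pi_{n-k},\wedge)$. Then $\Delta(V)=\sum_{k=0}^n\mathrm{Res}_{\rho_{k,n-k}}V$ for $V\in G_0(\Bbbk\Pi_n,\wedge)$; on simple modules, $\Delta(V_A)=\sum_{A=B|C}V_B\otimes V_C$. The product $\odot$ on $G_0(\mathbf{\Pi},\wedge)\otimes G_0(\mathbf{\Pi},\wedge)$ is taken componentwise.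
   Formalization: "Bialgebra" is taken without a unit: since the product vanishes between different degrees, no element of the direct sum can be a unit (it has finitely many nonzero degrees), so the unital reading is false; all other axioms, including a multiplicative counit, are kept. -}

module Defs where

open import Algebra.Bundles using (CommutativeRing; Monoid; Ring)
open import Algebra.Construct.DirectProduct using () renaming (monoid to _×-monoid_)
open import Algebra.Core using (Op₂)
import Algebra.Definitions.RawMonoid as RawMonoidDefinitions
open import Algebra.Module.Bundles using (LeftModule)
import Algebra.Module.Construct.TensorUnit as TensorUnit
open import Algebra.Module.Morphism.Structures using (IsLeftModuleHomomorphism; IsLeftModuleMonomorphism)
import Algebra.Module.Properties.LeftModule as LeftModuleProperties
import Algebra.Morphism.Construct.DirectProduct as DirectProduct
import Algebra.Morphism.Construct.Identity as Identity
open import Algebra.Morphism.Structures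
  using (IsMagmaHomomorphism; IsMonoidHomomorphism; IsRingHomomorphism; IsRingWithoutOneHomomorphism)
import Algebra.Properties.Ring as RingProperties
open import Algebra.Module.Structures using (IsLeftModule)
open import Algebra.Structures using (IsCommutativeMonoid; IsMonoid; IsRing)
open import Data.Bool.Properties using () renaming (_≟_ to _≟ᵇ_)
open import Data.Empty using (⊥-elim)
open import Data.Fin.Base using (Fin; zero; suc; toℕ; splitAt; join; _↑ˡ_; _↑ʳ_)
import Data.Fin.Properties as Fin
open import Data.Fin.Subset using (Subset; Nonempty; _∈_; _⊆_; _∩_; ⊤; ⊥; inside; outside)
open import Data.Fin.Subset.Properties
  using (_∈?_; _⊆?_; nonempty?; ⊆-trans; ⊆-antisym; x∈p∩q⁺; x∈p∩q⁻; ∈⊤; ⊆⊤; ∉⊥)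
open import Data.List.Base
  using (List; []; _∷_; [_]; _++_; map; concatMap; filter; mapMaybe; cartesianProductWith; foldr; length)
import Data.List.Properties as List
open import Data.List.Membership.Propositional using () renaming (_∈_ to _∈ˡ_; find to findᵐ; lose to loseᵐ)
open import Data.List.Membership.Propositional.Properties
  using (∈-filter⁺; ∈-filter⁻; ∈-cartesianProductWith⁺; ∈-cartesianProductWith⁻;
         ∈-map⁺; ∈-map⁻; ∈-++⁺ˡ; ∈-++⁺ʳ; ∈-++⁻)
open import Data.List.Relation.Binary.BagAndSetEquality using (_∼[_]_; set)
open import Data.List.Relation.Unary.All as All using (All)
open import Data.List.Relation.Unary.Any as Any using (Any; here; there)
open import Data.Maybe.Base using (Maybe; just; nothing)
open import Data.Nat.Base using (ℕ; zero; suc; _∸_; _≤_; _<_; z≤n; s≤s) renaming (_+_ to _+ℕ_)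
open import Data.Nat.Induction using (<-wellFounded)
import Data.Nat.Properties as ℕ
open import Data.Product.Base using (Σ; ∃; _×_; _,_; proj₁; proj₂; uncurry)
open import Data.Sum.Base using (inj₁; inj₂)
import Data.Vec.Base as Vec
import Data.Vec.Properties as Vec
open import Function.Base using (_∘_; id)
open import Function.Bundles using (_⇔_; mk⇔; Equivalence)
open import Function.Definitions using (Surjective)
open import Induction.WellFounded using (Acc; acc; WellFounded; module Subrelation)
open import Level using (Level; 0ℓ; _⊔_) renaming (suc to lsuc)
open import Relation.Binary.Bundles using (Setoid)
import Relation.Binary.Construct.On as On
open import Relation.Binary.Core using (Rel)
open import Relation.Binary.Definitions using (Decidable)
open import Relation.Binary.Lattice.Bundles using (BoundedMeetSemilattice)
import Relation.Binary.Lattice.Properties.BoundedMeetSemilattice as BoundedMeetProperties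
import Relation.Binary.Lattice.Properties.MeetSemilattice as MeetProperties
open import Relation.Binary.PropositionalEquality as ≡ using (_≡_; _≢_; refl; subst)
import Relation.Binary.Reasoning.Setoid as SetoidReasoning
open import Relation.Nullary using (¬_; Dec; yes; no; map′; _×-dec_; _→-dec_)

private
  variable
    n k l : ℕ
    a b c ℓ x y r s m ℓm : Level

record IsPartition {n} (ps : List (Subset n)) : Set where
  field
    nonempty : All Nonempty ps
    covering : ∀ i → Any (i ∈_) ps
    disjoint : All (λ p → All (λ q → Nonempty (p ∩ q) → p ≡ q) ps) ps

record SetPartition (n : ℕ) : Set where
  field
    parts       : List (Subset n)
    isPartition : IsPartition parts
  open IsPartition isPartition public

  part-nonempty : ∀ {p} → p ∈ˡ parts → Nonempty p
  part-nonempty = All.lookup nonempty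

  part-of : ∀ i → ∃ λ p → p ∈ˡ parts × i ∈ p
  part-of i = findᵐ (covering i)

  part-unique : ∀ {p q i} → p ∈ˡ parts → q ∈ˡ parts → i ∈ p → i ∈ q → p ≡ q
  part-unique p∈ q∈ i∈p i∈q = All.lookup (All.lookup disjoint p∈) q∈ (_ , x∈p∩q⁺ (i∈p , i∈q))

open SetPartition using (parts; part-nonempty; part-of; part-unique)

mkIsPartition : {ps : List (Subset n)} →
  (∀ {p} → p ∈ˡ ps → Nonempty p) →
  (∀ i → ∃ λ p → p ∈ˡ ps × i ∈ p) →
  (∀ {p q i} → p ∈ˡ ps → q ∈ˡ ps → i ∈ p → i ∈ q → p ≡ q) →
  IsPartition ps
mkIsPartition ne cov dis = record
  { nonempty = All.tabulate ne
  ; covering = λ i → let p , p∈ , i∈p = cov i in loseᵐ p∈ i∈p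
  ; disjoint = All.tabulate λ {p} p∈ → All.tabulate λ {q} q∈ (i , i∈) →
      let i∈p , i∈q = x∈p∩q⁻ p q i∈ in dis p∈ q∈ i∈p i∈q
  }

-- Partitions are compared as sets of parts: the order and multiplicity of
-- the entries of the list are irrelevant.
infix 4 _≈Π_ _≤Π_ _<Π_ _≤Π?_ _≈Π?_ _<Π?_

record _≈Π_ (A B : SetPartition n) : Set where
  constructor mk≈Π
  field
    same-parts : parts A ∼[ set ] parts B

record _≤Π_ (A B : SetPartition n) : Set where
  constructor parts-≤
  field
    parts-contained : All (λ p → Any (p ⊆_) (parts B)) (parts A)

open _≈Π_
open _≤Π_

_<Π_ : Rel (SetPartition n) 0ℓ
A <Π B = A ≤Π B × ¬ B ≤Π A

_≤Π?_ : Decidable (_≤Π_ {n})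
A ≤Π? B = map′ parts-≤ parts-contained (All.all? (λ p → Any.any? (p ⊆?_) (parts B)) (parts A))

_<Π?_ : Decidable (_<Π_ {n})
A <Π? B with A ≤Π? B | B ≤Π? A
... | yes A≤B | no B≰A  = yes (A≤B , B≰A)
... | yes _   | yes B≤A = no λ (_ , B≰A) → B≰A B≤A
... | no A≰B  | _       = no λ (A≤B , _) → A≰B A≤B

container : (A B : SetPartition n) → A ≤Π B → ∀ {p} → p ∈ˡ parts A → ∃ λ q → q ∈ˡ parts B × p ⊆ q
container A B A≤B p∈ = findᵐ (All.lookup (parts-contained A≤B) p∈)

mk≤Π : (A B : SetPartition n) → (∀ {p} → p ∈ˡ parts A → ∃ λ q → q ∈ˡ parts B × p ⊆ q) → A ≤Π B
mk≤Π A B f = parts-≤ (All.tabulate λ p∈ → let q , q∈ , p⊆q = f p∈ in loseᵐ {P = _ ⊆_} q∈ p⊆q)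

≈Π⇒≤Π : (A B : SetPartition n) → A ≈Π B → A ≤Π B
≈Π⇒≤Π A B A≈B = mk≤Π A B λ p∈ → _ , Equivalence.to (same-parts A≈B) p∈ , id

≈Π-sym : (A B : SetPartition n) → A ≈Π B → B ≈Π A
≈Π-sym A B (mk≈Π A≈B) = mk≈Π (mk⇔ (Equivalence.from A≈B) (Equivalence.to A≈B))

≤Π-trans : (A B C : SetPartition n) → A ≤Π B → B ≤Π C → A ≤Π C
≤Π-trans A B C A≤B B≤C = mk≤Π A C λ p∈ →
  let q , q∈ , p⊆q = container A B A≤B p∈
      r , r∈ , q⊆r = container B C B≤C q∈
  in r , r∈ , ⊆-trans p⊆q q⊆r

≤Π-antisym : (A B : SetPartition n) → A ≤Π B → B ≤Π A → A ≈Π B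
≤Π-antisym A B A≤B B≤A = mk≈Π (mk⇔ (incl A B A≤B B≤A) (incl B A B≤A A≤B))
  where
  incl : (A B : SetPartition _) → A ≤Π B → B ≤Π A → ∀ {p} → p ∈ˡ parts A → p ∈ˡ parts B
  incl A B A≤B B≤A {p} p∈ =
    let q , q∈ , p⊆q = container A B A≤B p∈
        r , r∈ , q⊆r = container B A B≤A q∈
        i , i∈p      = part-nonempty A p∈
        p≡r          = part-unique A p∈ r∈ i∈p (q⊆r (p⊆q i∈p))
        q⊆p          = subst (q ⊆_) (≡.sym p≡r) q⊆r
    in subst (_∈ˡ parts B) (⊆-antisym q⊆p p⊆q) q∈

_≈Π?_ : Decidable (_≈Π_ {n})
A ≈Π? B = map′ (uncurry (≤Π-antisym A B))
               (λ A≈B → ≈Π⇒≤Π A B A≈B , ≈Π⇒≤Π B A (≈Π-sym A B A≈B))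
               (A ≤Π? B ×-dec B ≤Π? A)

∧-parts : (A B : SetPartition n) → List (Subset n)
∧-parts A B = filter nonempty? (cartesianProductWith _∩_ (parts A) (parts B))

∈-∧⁻ : (A B : SetPartition n) → ∀ {r} → r ∈ˡ ∧-parts A B →
       ∃ λ p → ∃ λ q → p ∈ˡ parts A × q ∈ˡ parts B × r ≡ p ∩ q × Nonempty r
∈-∧⁻ A B r∈ =
  let r∈′ , ne = ∈-filter⁻ nonempty? {xs = cartesianProductWith _∩_ (parts A) (parts B)} r∈
      p , q , p∈ , q∈ , eq = ∈-cartesianProductWith⁻ _∩_ (parts A) (parts B) r∈′
  in p , q , p∈ , q∈ , eq , ne

∈-∧⁺ : (A B : SetPartition n) → ∀ {p q} → p ∈ˡ parts A → q ∈ˡ parts B →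
       Nonempty (p ∩ q) → p ∩ q ∈ˡ ∧-parts A B
∈-∧⁺ A B p∈ q∈ ne = ∈-filter⁺ nonempty? (∈-cartesianProductWith⁺ _∩_ p∈ q∈) ne

abstract
  ∧-isPartition : (A B : SetPartition n) → IsPartition (∧-parts A B)
  ∧-isPartition A B = mkIsPartition ne cov dis
    where
    ne : ∀ {r} → r ∈ˡ ∧-parts A B → Nonempty r
    ne r∈ = let _ , _ , _ , _ , _ , r≠∅ = ∈-∧⁻ A B r∈ in r≠∅

    cov : ∀ i → ∃ λ r → r ∈ˡ ∧-parts A B × i ∈ r
    cov i =
      let p , p∈ , i∈p = part-of A i
          q , q∈ , i∈q = part-of B i
          i∈           = x∈p∩q⁺ (i∈p , i∈q)
      in p ∩ q , ∈-∧⁺ A B p∈ q∈ (i , i∈) , i∈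

    dis : ∀ {r s i} → r ∈ˡ ∧-parts A B → s ∈ˡ ∧-parts A B → i ∈ r → i ∈ s → r ≡ s
    dis r∈ s∈ i∈r i∈s with ∈-∧⁻ A B r∈ | ∈-∧⁻ A B s∈
    ... | p , q , p∈ , q∈ , refl , _ | p′ , q′ , p′∈ , q′∈ , refl , _ =
      let i∈p , i∈q   = x∈p∩q⁻ p q i∈r
          i∈p′ , i∈q′ = x∈p∩q⁻ p′ q′ i∈s
      in ≡.cong₂ _∩_ (part-unique A p∈ p′∈ i∈p i∈p′) (part-unique B q∈ q′∈ i∈q i∈q′)

infixr 7 _∧Π_

_∧Π_ : SetPartition n → SetPartition n → SetPartition n
A ∧Π B = record { parts = ∧-parts A B ; isPartition = ∧-isPartition A B }

-- {[n]}, except that 𝟏 0 has no parts because parts are nonempty.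
𝟏-parts : ∀ n → List (Subset n)
𝟏-parts n = filter nonempty? (⊤ ∷ [])

abstract
  𝟏-isPartition : ∀ n → IsPartition (𝟏-parts n)
  𝟏-isPartition n = mkIsPartition
    (λ p∈ → proj₂ (∈-filter⁻ nonempty? {xs = ⊤ ∷ []} p∈))
    (λ i → ⊤ , ∈-filter⁺ nonempty? (here refl) (i , ∈⊤) , ∈⊤)
    (λ p∈ q∈ _ _ → ≡.trans (≡⊤ p∈) (≡.sym (≡⊤ q∈)))
    where
    ≡⊤ : ∀ {p} → p ∈ˡ 𝟏-parts n → p ≡ ⊤
    ≡⊤ p∈ with proj₁ (∈-filter⁻ nonempty? {xs = ⊤ ∷ []} p∈)
    ... | here p≡⊤ = p≡⊤

𝟏 : ∀ n → SetPartition n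
𝟏 n = record { parts = 𝟏-parts n ; isPartition = 𝟏-isPartition n }

≤Π-maximum : (A : SetPartition n) → A ≤Π 𝟏 n
≤Π-maximum A = mk≤Π A (𝟏 _) λ p∈ → let i , _ = part-nonempty A p∈ in
  ⊤ , ∈-filter⁺ nonempty? (here refl) (i , ∈⊤) , ⊆⊤

∧Π-infimum : (A B : SetPartition n) →
  (A ∧Π B) ≤Π A × (A ∧Π B) ≤Π B × (∀ C → C ≤Π A → C ≤Π B → C ≤Π (A ∧Π B))
∧Π-infimum A B = mk≤Π (A ∧Π B) A lowerˡ , mk≤Π (A ∧Π B) B lowerʳ , λ C C≤A C≤B → mk≤Π C (A ∧Π B) λ p∈ →
  let a , a∈ , p⊆a = container C A C≤A p∈
      b , b∈ , p⊆b = container C B C≤B p∈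
      i , i∈p      = part-nonempty C p∈
      p⊆a∩b : _ ⊆ _
      p⊆a∩b i∈     = x∈p∩q⁺ (p⊆a i∈ , p⊆b i∈)
  in a ∩ b , ∈-∧⁺ A B a∈ b∈ (i , p⊆a∩b i∈p) , p⊆a∩b
  where
  lowerˡ : ∀ {r} → r ∈ˡ ∧-parts A B → ∃ λ q → q ∈ˡ parts A × r ⊆ q
  lowerˡ r∈ with ∈-∧⁻ A B r∈
  ... | p , q , p∈ , q∈ , refl , _ = p , p∈ , λ i∈ → proj₁ (x∈p∩q⁻ p q i∈)
  lowerʳ : ∀ {r} → r ∈ˡ ∧-parts A B → ∃ λ q → q ∈ˡ parts B × r ⊆ q
  lowerʳ r∈ with ∈-∧⁻ A B r∈
  ... | p , q , p∈ , q∈ , refl , _ = q , q∈ , λ i∈ → proj₂ (x∈p∩q⁻ p q i∈)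

Π-boundedMeetSemilattice : ℕ → BoundedMeetSemilattice 0ℓ 0ℓ 0ℓ
Π-boundedMeetSemilattice n = record
  { Carrier = SetPartition n
  ; _≈_     = _≈Π_
  ; _≤_     = _≤Π_
  ; _∧_     = _∧Π_
  ; ⊤       = 𝟏 n
  ; isBoundedMeetSemilattice = record
    { isMeetSemilattice = record
      { isPartialOrder = record
        { isPreorder = record
          { isEquivalence = record
            { refl  = mk≈Π (mk⇔ id id)
            ; sym   = λ {A} {B} → ≈Π-sym A B
            ; trans = λ (mk≈Π f) (mk≈Π g) → mk≈Π (mk⇔ (Equivalence.to g ∘ Equivalence.to f)
                                                      (Equivalence.from f ∘ Equivalence.from g))
            }
          ; reflexive = λ {A} {B} → ≈Π⇒≤Π A B
          ; trans     = λ {A} {B} {C} → ≤Π-trans A B C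
          }
        ; antisym = λ {A} {B} → ≤Π-antisym A B
        }
      ; infimum = ∧Π-infimum
      }
    ; maximum = ≤Π-maximum
    }
  }

abstract
  Π-isMonoid : ∀ n → IsMonoid (_≈Π_ {n}) _∧Π_ (𝟏 n)
  Π-isMonoid n = record
    { isSemigroup = record
      { isMagma = record { isEquivalence = isEquivalence ; ∙-cong = ∧-cong }
      ; assoc   = ∧-assoc
      }
    ; identity = identity
    }
    where
    open BoundedMeetSemilattice (Π-boundedMeetSemilattice n) using (isEquivalence; meetSemilattice)
    open MeetProperties meetSemilattice using (∧-cong; ∧-assoc)
    open BoundedMeetProperties (Π-boundedMeetSemilattice n) using (identity)

Π-monoid : ℕ → Monoid 0ℓ 0ℓ
Π-monoid n = record
  { Carrier  = SetPartition n
  ; _≈_      = _≈Π_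
  ; _∙_      = _∧Π_
  ; ε        = 𝟏 n
  ; isMonoid = Π-isMonoid n
  }

padʳ : ∀ l → Subset k → Subset (k +ℕ l)
padʳ l p = p Vec.++ ⊥

padˡ : ∀ k → Subset l → Subset (k +ℕ l)
padˡ k q = ⊥ {k} Vec.++ q

∈-padʳ⁺ : ∀ l {p : Subset k} {i} → i ∈ p → i ↑ˡ l ∈ padʳ l p
∈-padʳ⁺ l Vec.here       = Vec.here
∈-padʳ⁺ l (Vec.there i∈) = Vec.there (∈-padʳ⁺ l i∈)

∈-padˡ⁺ : ∀ k {q : Subset l} {j} → j ∈ q → k ↑ʳ j ∈ padˡ k q
∈-padˡ⁺ zero    j∈ = j∈
∈-padˡ⁺ (suc k) j∈ = Vec.there (∈-padˡ⁺ k j∈)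

∈-padʳ⁻ : ∀ l (p : Subset k) {x} → x ∈ padʳ l p → ∃ λ i → x ≡ i ↑ˡ l × i ∈ p
∈-padʳ⁻ l Vec.[]      x∈ = ⊥-elim (∉⊥ x∈)
∈-padʳ⁻ l (s Vec.∷ p) Vec.here = zero , refl , Vec.here
∈-padʳ⁻ l (s Vec.∷ p) (Vec.there x∈) =
  let i , eq , i∈ = ∈-padʳ⁻ l p x∈ in suc i , ≡.cong suc eq , Vec.there i∈

∈-padˡ⁻ : ∀ k (q : Subset l) {x} → x ∈ padˡ k q → ∃ λ j → x ≡ k ↑ʳ j × j ∈ q
∈-padˡ⁻ zero    q x∈ = _ , refl , x∈
∈-padˡ⁻ (suc k) q (Vec.there x∈) =
  let j , eq , j∈ = ∈-padˡ⁻ k q x∈ in j , ≡.cong suc eq , j∈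

↑ˡ≢↑ʳ : ∀ {i : Fin k} {j : Fin l} → ¬ (i ↑ˡ l ≡ k ↑ʳ j)
↑ˡ≢↑ʳ {k} {l} {i} {j} eq
  with () ← ≡.trans (≡.sym (Fin.splitAt-↑ˡ k i l)) (≡.trans (≡.cong (splitAt k) eq) (Fin.splitAt-↑ʳ k l j))

pad-disjoint : ∀ {p : Subset k} {q : Subset l} {x} → x ∈ padʳ l p → ¬ (x ∈ padˡ k q)
pad-disjoint {k} {l} {p} {q} x∈p x∈q =
  let i , x≡i , _ = ∈-padʳ⁻ l p x∈p
      j , x≡j , _ = ∈-padˡ⁻ k q x∈q
  in ↑ˡ≢↑ʳ {i = i} {j} (≡.trans (≡.sym x≡i) x≡j)

∣-parts : SetPartition k → SetPartition l → List (Subset (k +ℕ l))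
∣-parts {k} {l} A B = map (padʳ l) (parts A) ++ map (padˡ k) (parts B)

data ∣-Part (A : SetPartition k) (B : SetPartition l) : Subset (k +ℕ l) → Set where
  left  : ∀ {p} → p ∈ˡ parts A → ∣-Part A B (padʳ l p)
  right : ∀ {q} → q ∈ˡ parts B → ∣-Part A B (padˡ k q)

∈-∣⁻ : (A : SetPartition k) (B : SetPartition l) → ∀ {r} → r ∈ˡ ∣-parts A B → ∣-Part A B r
∈-∣⁻ {k} {l} A B r∈ with ∈-++⁻ (map (padʳ l) (parts A)) r∈
... | inj₁ r∈ˡ with _ , p∈ , refl ← ∈-map⁻ (padʳ l) r∈ˡ = left p∈
... | inj₂ r∈ʳ with _ , q∈ , refl ← ∈-map⁻ (padˡ k) r∈ʳ = right q∈

∈-∣⁺ : (A : SetPartition k) (B : SetPartition l) → ∀ {r} → ∣-Part A B r → r ∈ˡ ∣-parts A B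
∈-∣⁺ {k} {l} A B (left p∈)  = ∈-++⁺ˡ (∈-map⁺ (padʳ l) p∈)
∈-∣⁺ {k} {l} A B (right q∈) = ∈-++⁺ʳ (map (padʳ l) (parts A)) (∈-map⁺ (padˡ k) q∈)

abstract
  ∣-isPartition : (A : SetPartition k) (B : SetPartition l) → IsPartition (∣-parts A B)
  ∣-isPartition {k} {l} A B = mkIsPartition ne cov dis
    where
    ne : ∀ {r} → r ∈ˡ ∣-parts A B → Nonempty r
    ne r∈ with ∈-∣⁻ A B r∈
    ... | left p∈  = let i , i∈ = part-nonempty A p∈ in i ↑ˡ l , ∈-padʳ⁺ l i∈
    ... | right q∈ = let j , j∈ = part-nonempty B q∈ in k ↑ʳ j , ∈-padˡ⁺ k j∈

    cov : ∀ x → ∃ λ r → r ∈ˡ ∣-parts A B × x ∈ r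
    cov x with splitAt k x in eq
    ... | inj₁ i with refl ← ≡.trans (≡.sym (Fin.join-splitAt k l x)) (≡.cong (join k l) eq) =
      let p , p∈ , i∈ = part-of A i in padʳ l p , ∈-∣⁺ A B (left p∈) , ∈-padʳ⁺ l i∈
    ... | inj₂ j with refl ← ≡.trans (≡.sym (Fin.join-splitAt k l x)) (≡.cong (join k l) eq) =
      let q , q∈ , j∈ = part-of B j in padˡ k q , ∈-∣⁺ A B (right q∈) , ∈-padˡ⁺ k j∈

    dis : ∀ {r s x} → r ∈ˡ ∣-parts A B → s ∈ˡ ∣-parts A B → x ∈ r → x ∈ s → r ≡ s
    dis r∈ s∈ x∈r x∈s with ∈-∣⁻ A B r∈ | ∈-∣⁻ A B s∈
    ... | left {p} p∈ | right {q} q∈ = ⊥-elim (pad-disjoint {p = p} {q} x∈r x∈s)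
    ... | right {q} q∈ | left {p} p∈ = ⊥-elim (pad-disjoint {p = p} {q} x∈s x∈r)
    ... | left {p} p∈ | left {p′} p′∈ =
      let i , x≡i , i∈ = ∈-padʳ⁻ l p x∈r
          i′ , x≡i′ , i′∈ = ∈-padʳ⁻ l p′ x∈s
          i≡i′ = Fin.↑ˡ-injective l i i′ (≡.trans (≡.sym x≡i) x≡i′)
      in ≡.cong (padʳ l) (part-unique A p∈ p′∈ (subst (_∈ p) i≡i′ i∈) i′∈)
    ... | right {q} q∈ | right {q′} q′∈ =
      let j , x≡j , j∈ = ∈-padˡ⁻ k q x∈r
          j′ , x≡j′ , j′∈ = ∈-padˡ⁻ k q′ x∈s
          j≡j′ = Fin.↑ʳ-injective k j j′ (≡.trans (≡.sym x≡j) x≡j′)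
      in ≡.cong (padˡ k) (part-unique B q∈ q′∈ (subst (_∈ q) j≡j′ j∈) j′∈)

infixr 6 _∣Π_

_∣Π_ : SetPartition k → SetPartition l → SetPartition (k +ℕ l)
A ∣Π B = record { parts = ∣-parts A B ; isPartition = ∣-isPartition A B }

∣Π-mono : (A A′ : SetPartition k) (B B′ : SetPartition l) → A ≤Π A′ → B ≤Π B′ → (A ∣Π B) ≤Π (A′ ∣Π B′)
∣Π-mono {k} {l} A A′ B B′ A≤A′ B≤B′ = mk≤Π (A ∣Π B) (A′ ∣Π B′) go
  where
  go : ∀ {r} → r ∈ˡ ∣-parts A B → ∃ λ s → s ∈ˡ ∣-parts A′ B′ × r ⊆ s
  go r∈ with ∈-∣⁻ A B r∈
  ... | left {p} p∈ =
    let p′ , p′∈ , p⊆p′ = container A A′ A≤A′ p∈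
    in padʳ l p′ , ∈-∣⁺ A′ B′ (left p′∈) , λ x∈ →
       let i , x≡i , i∈ = ∈-padʳ⁻ l p x∈ in subst (_∈ _) (≡.sym x≡i) (∈-padʳ⁺ l (p⊆p′ i∈))
  ... | right {q} q∈ =
    let q′ , q′∈ , q⊆q′ = container B B′ B≤B′ q∈
    in padˡ k q′ , ∈-∣⁺ A′ B′ (right q′∈) , λ x∈ →
       let j , x≡j , j∈ = ∈-padˡ⁻ k q x∈ in subst (_∈ _) (≡.sym x≡j) (∈-padˡ⁺ k (q⊆q′ j∈))

abstract
  ∣Π-cong : (A A′ : SetPartition k) (B B′ : SetPartition l) → A ≈Π A′ → B ≈Π B′ → (A ∣Π B) ≈Π (A′ ∣Π B′)
  ∣Π-cong A A′ B B′ A≈A′ B≈B′ = ≤Π-antisym (A ∣Π B) (A′ ∣Π B′)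
    (∣Π-mono A A′ B B′ (≈Π⇒≤Π A A′ A≈A′) (≈Π⇒≤Π B B′ B≈B′))
    (∣Π-mono A′ A B′ B (≈Π⇒≤Π A′ A (≈Π-sym A A′ A≈A′)) (≈Π⇒≤Π B′ B (≈Π-sym B B′ B≈B′)))

abstract
  ∣Π-∧Π : (A A′ : SetPartition k) (B B′ : SetPartition l) →
          ((A ∧Π A′) ∣Π (B ∧Π B′)) ≈Π ((A ∣Π B) ∧Π (A′ ∣Π B′))
  ∣Π-∧Π {k} {l} A A′ B B′ = ≤Π-antisym L R
    (proj₂ (proj₂ (∧Π-infimum (A ∣Π B) (A′ ∣Π B′))) L
      (∣Π-mono (A ∧Π A′) A (B ∧Π B′) B (proj₁ (∧Π-infimum A A′)) (proj₁ (∧Π-infimum B B′)))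
      (∣Π-mono (A ∧Π A′) A′ (B ∧Π B′) B′ (proj₁ (proj₂ (∧Π-infimum A A′))) (proj₁ (proj₂ (∧Π-infimum B B′)))))
    (mk≤Π R L go)
    where
    L R : SetPartition (k +ℕ l)
    L = (A ∧Π A′) ∣Π (B ∧Π B′)
    R = (A ∣Π B) ∧Π (A′ ∣Π B′)

    go : ∀ {r} → r ∈ˡ parts R → ∃ λ s → s ∈ˡ parts L × r ⊆ s
    go r∈ with ∈-∧⁻ (A ∣Π B) (A′ ∣Π B′) r∈
    ... | u , v , u∈ , v∈ , refl , x , x∈ with ∈-∣⁻ A B u∈ | ∈-∣⁻ A′ B′ v∈
    ...   | left {p} _ | right {q} _ =
      let x∈p , x∈q = x∈p∩q⁻ (padʳ l p) (padˡ k q) x∈ in ⊥-elim (pad-disjoint {p = p} {q} x∈p x∈q)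
    ...   | right {q} _ | left {p} _ =
      let x∈q , x∈p = x∈p∩q⁻ (padˡ k q) (padʳ l p) x∈ in ⊥-elim (pad-disjoint {p = p} {q} x∈p x∈q)
    ...   | left {p} p∈ | left {p′} p′∈ =
      let incl : padʳ l p ∩ padʳ l p′ ⊆ padʳ l (p ∩ p′)
          incl y∈ =
            let y∈p , y∈p′ = x∈p∩q⁻ (padʳ l p) (padʳ l p′) y∈
                i , y≡i , i∈ = ∈-padʳ⁻ l p y∈p
                i′ , y≡i′ , i′∈ = ∈-padʳ⁻ l p′ y∈p′
                i≡i′ = Fin.↑ˡ-injective l i i′ (≡.trans (≡.sym y≡i) y≡i′)
            in subst (_∈ _) (≡.sym y≡i) (∈-padʳ⁺ l (x∈p∩q⁺ (i∈ , subst (_∈ p′) (≡.sym i≡i′) i′∈)))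
          j , _ , j∈ = ∈-padʳ⁻ l (p ∩ p′) (incl x∈)
      in _ , ∈-∣⁺ (A ∧Π A′) (B ∧Π B′) (left (∈-∧⁺ A A′ p∈ p′∈ (j , j∈))) , incl
    ...   | right {q} q∈ | right {q′} q′∈ =
      let incl : padˡ k q ∩ padˡ k q′ ⊆ padˡ k (q ∩ q′)
          incl y∈ =
            let y∈q , y∈q′ = x∈p∩q⁻ (padˡ k q) (padˡ k q′) y∈
                i , y≡i , i∈ = ∈-padˡ⁻ k q y∈q
                i′ , y≡i′ , i′∈ = ∈-padˡ⁻ k q′ y∈q′
                i≡i′ = Fin.↑ʳ-injective k i i′ (≡.trans (≡.sym y≡i) y≡i′)
            in subst (_∈ _) (≡.sym y≡i) (∈-padˡ⁺ k (x∈p∩q⁺ (i∈ , subst (_∈ q′) (≡.sym i≡i′) i′∈)))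
          j , _ , j∈ = ∈-padˡ⁻ k (q ∩ q′) (incl x∈)
      in _ , ∈-∣⁺ (A ∧Π A′) (B ∧Π B′) (right (∈-∧⁺ B B′ q∈ q′∈ (j , j∈))) , incl

subsets : ∀ n → List (Subset n)
subsets zero    = Vec.[] ∷ []
subsets (suc n) = map (outside Vec.∷_) (subsets n) ++ map (inside Vec.∷_) (subsets n)

sublists : ∀ {a} {X : Set a} → List X → List (List X)
sublists []       = [] ∷ []
sublists (x ∷ xs) = sublists xs ++ map (x ∷_) (sublists xs)

isPartition? : (ps : List (Subset n)) → Dec (IsPartition ps)
isPartition? ps = map′
  (λ (ne , cov , dis) → record { nonempty = ne ; covering = cov ; disjoint = dis })
  (λ P → IsPartition.nonempty P , IsPartition.covering P , IsPartition.disjoint P)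
  (All.all? nonempty? ps
    ×-dec Fin.all? (λ i → Any.any? (i ∈?_) ps)
    ×-dec All.all? (λ p → All.all? (λ q → nonempty? (p ∩ q) →-dec Vec.≡-dec _≟ᵇ_ p q) ps) ps)

toPartition : List (Subset n) → Maybe (SetPartition n)
toPartition ps with isPartition? ps
... | yes P = just (record { parts = ps ; isPartition = P })
... | no  _ = nothing

partitions : ∀ n → List (SetPartition n)
partitions n = mapMaybe toPartition (sublists (subsets n))

∈-subsets : (p : Subset n) → p ∈ˡ subsets n
∈-subsets Vec.[]            = here refl
∈-subsets (outside Vec.∷ p) = ∈-++⁺ˡ (∈-map⁺ _ (∈-subsets p))
∈-subsets (inside Vec.∷ p)  = ∈-++⁺ʳ (map _ (subsets _)) (∈-map⁺ _ (∈-subsets p))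

∈-sublists-filter : ∀ {a p} {X : Set a} {P : X → Set p} (P? : ∀ x → Dec (P x)) (xs : List X) →
                    filter P? xs ∈ˡ sublists xs
∈-sublists-filter P? []       = here refl
∈-sublists-filter P? (x ∷ xs) with P? x
... | yes _ = ∈-++⁺ʳ (sublists xs) (∈-map⁺ (x ∷_) (∈-sublists-filter P? xs))
... | no  _ = ∈-++⁺ˡ (∈-sublists-filter P? xs)

partitions-complete : (A : SetPartition n) → ∃ λ A′ → A′ ∈ˡ partitions n × A ≈Π A′
partitions-complete {n} A = keep (sublists (subsets n)) (∈-sublists-filter inA? (subsets n))
  where
  inA? : ∀ p → Dec (p ∈ˡ parts A)
  inA? p = Any.any? (Vec.≡-dec _≟ᵇ_ p) (parts A)

  ps = filter inA? (subsets n)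

  to : ∀ {p} → p ∈ˡ parts A → p ∈ˡ ps
  to p∈ = ∈-filter⁺ inA? (∈-subsets _) p∈

  from : ∀ {p} → p ∈ˡ ps → p ∈ˡ parts A
  from p∈ = proj₂ (∈-filter⁻ inA? {xs = subsets n} p∈)

  P : IsPartition ps
  P = mkIsPartition (λ p∈ → part-nonempty A (from p∈))
                    (λ i → let p , p∈ , i∈p = part-of A i in p , to p∈ , i∈p)
                    (λ p∈ q∈ → part-unique A (from p∈) (from q∈))

  keep : ∀ xss → ps ∈ˡ xss → ∃ λ A′ → A′ ∈ˡ mapMaybe toPartition xss × A ≈Π A′
  keep (xs ∷ xss) (here refl) with isPartition? xs
  ... | yes _ = _ , here refl , mk≈Π (mk⇔ to from)
  ... | no ¬P = ⊥-elim (¬P P)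
  keep (xs ∷ xss) (there ps∈) with isPartition? xs
  ... | yes _ = let A′ , A′∈ , A≈A′ = keep xss ps∈ in A′ , there A′∈ , A≈A′
  ... | no  _ = keep xss ps∈

private
  module _ {a p q} {X : Set a} {P : X → Set p} {Q : X → Set q}
           (P? : ∀ x → Dec (P x)) (Q? : ∀ x → Dec (Q x)) (P⊆Q : ∀ {x} → P x → Q x) where

    filter-≤ : ∀ xs → length (filter P? xs) ≤ length (filter Q? xs)
    filter-≤ []       = z≤n
    filter-≤ (x ∷ xs) with P? x | Q? x
    ... | yes _ | yes _ = s≤s (filter-≤ xs)
    ... | yes p | no ¬q = ⊥-elim (¬q (P⊆Q p))
    ... | no _  | yes _ = ℕ.m≤n⇒m≤1+n (filter-≤ xs)
    ... | no _  | no _  = filter-≤ xs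

    filter-< : ∀ {y} xs → y ∈ˡ xs → ¬ P y → Q y → length (filter P? xs) < length (filter Q? xs)
    filter-< (x ∷ xs) (here refl) ¬p q with P? x | Q? x
    ... | yes p | _     = ⊥-elim (¬p p)
    ... | no _  | yes _ = s≤s (filter-≤ xs)
    ... | no _  | no ¬q = ⊥-elim (¬q q)
    filter-< (x ∷ xs) (there y∈) ¬p q with P? x | Q? x
    ... | yes _ | yes _ = s≤s (filter-< xs y∈ ¬p q)
    ... | yes p | no ¬q = ⊥-elim (¬q (P⊆Q p))
    ... | no _  | yes _ = ℕ.m≤n⇒m≤1+n (filter-< xs y∈ ¬p q)
    ... | no _  | no _  = filter-< xs y∈ ¬p q

  downset-size : SetPartition n → ℕ
  downset-size {n} A = length (filter (_≤Π? A) (partitions n))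

  downset-size-mono : {A B : SetPartition n} → A <Π B → downset-size A < downset-size B
  downset-size-mono {n} {A} {B} (A≤B , B≰A) =
    let B′ , B′∈ , B≈B′ = partitions-complete B
    in filter-< (_≤Π? A) (_≤Π? B) (λ {C} C≤A → ≤Π-trans C A B C≤A A≤B) (partitions n) B′∈
         (λ B′≤A → B≰A (≤Π-trans B B′ A (≈Π⇒≤Π B B′ B≈B′) B′≤A))
         (≈Π⇒≤Π B′ B (≈Π-sym B B′ B≈B′))

abstract
  <Π-wellFounded : WellFounded (_<Π_ {n})
  <Π-wellFounded = Subrelation.wellFounded (λ {A} {B} → downset-size-mono {A = A} {B})
                     (On.wellFounded downset-size <-wellFounded)

-- The image of the integer μ(B,A) in R, for B ≤ A:
-- μ(A,A) = 1 and μ(B,A) = - Σ_{B ≤ C < A} μ(B,C).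
module Möbius {c ℓ} (R : Ring c ℓ) where
  open Ring R using (Carrier; 0#; 1#; -_) renaming (_+_ to _⊕_)

  μ-acc : (B A : SetPartition n) → Acc _<Π_ A → Carrier
  μ-acc {n} B A (acc rs) with B ≈Π? A
  ... | yes _ = 1#
  ... | no  _ = - foldr _⊕_ 0# (map term (filter (B ≤Π?_) (partitions n)))
    where
    term : SetPartition n → Carrier
    term C with C <Π? A
    ... | yes C<A = μ-acc B C (rs C<A)
    ... | no  _   = 0#

  μ : (B A : SetPartition n) → Carrier
  μ B A = μ-acc B A (<Π-wellFounded A)

record Field c ℓ : Set (lsuc (c ⊔ ℓ)) where
  field
    commutativeRing : CommutativeRing c ℓ
  open CommutativeRing commutativeRing public
  field
    1≉0     : ¬ 1# ≈ 0#
    inverse : ∀ x → ¬ x ≈ 0# → ∃ λ y → x * y ≈ 1#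

CharacteristicZero : Field c ℓ → Set ℓ
CharacteristicZero K = ∀ n → ¬ (suc n ×ₙ 1#) ≈ 0#
  where
  open Field K
  open RawMonoidDefinitions +-rawMonoid using () renaming (_×_ to _×ₙ_)

-- Commutative monoids by generators and relations: a list stands for the
-- formal sum of its entries.

module FormalSum {X : Set x} (_⟶_ : Rel (List X) r) where

  infix 4 _≋_

  data _≋_ : Rel (List X) (x ⊔ r) where
    rel     : ∀ {xs ys} → xs ⟶ ys → xs ≋ ys
    refl    : ∀ {xs} → xs ≋ xs
    sym     : ∀ {xs ys} → xs ≋ ys → ys ≋ xs
    trans   : ∀ {xs ys zs} → xs ≋ ys → ys ≋ zs → xs ≋ zs
    ++-cong : ∀ {xs xs′ ys ys′} → xs ≋ xs′ → ys ≋ ys′ → xs ++ ys ≋ xs′ ++ ys′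
    ++-comm : ∀ xs ys → xs ++ ys ≋ ys ++ xs

  reflexive : ∀ {xs ys} → xs ≡ ys → xs ≋ ys
  reflexive ≡.refl = refl

  setoid : Setoid x (x ⊔ r)
  setoid = record { _≈_ = _≋_ ; isEquivalence = record { refl = refl ; sym = sym ; trans = trans } }

  isCommutativeMonoid : IsCommutativeMonoid _≋_ _++_ []
  isCommutativeMonoid = record
    { isMonoid = record
      { isSemigroup = record
        { isMagma = record { isEquivalence = Setoid.isEquivalence setoid ; ∙-cong = ++-cong }
        ; assoc   = λ xs ys zs → reflexive (List.++-assoc xs ys zs)
        }
      ; identity = (λ _ → refl) , λ xs → reflexive (List.++-identityʳ xs)
      }
    ; comm = ++-comm
    }

  open SetoidReasoning setoid

  interchange : ∀ ws xs ys zs → (ws ++ xs) ++ (ys ++ zs) ≋ (ws ++ ys) ++ (xs ++ zs)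
  interchange ws xs ys zs = begin
    (ws ++ xs) ++ (ys ++ zs) ≡⟨ List.++-assoc ws xs (ys ++ zs) ⟩
    ws ++ (xs ++ (ys ++ zs)) ≡⟨ ≡.cong (ws ++_) (List.++-assoc xs ys zs) ⟨
    ws ++ ((xs ++ ys) ++ zs) ≈⟨ ++-cong {ws} refl (++-cong {xs ++ ys} {_} {zs} (++-comm xs ys) refl) ⟩
    ws ++ ((ys ++ xs) ++ zs) ≡⟨ ≡.cong (ws ++_) (List.++-assoc ys xs zs) ⟩
    ws ++ (ys ++ (xs ++ zs)) ≡⟨ List.++-assoc ws ys (xs ++ zs) ⟨
    (ws ++ ys) ++ (xs ++ zs) ∎

  module _ {Y : Set y} where

    concatMap-≋ : {f g : Y → List X} → (∀ y → f y ≋ g y) → ∀ ys → concatMap f ys ≋ concatMap g ys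
    concatMap-≋ f≋g []       = refl
    concatMap-≋ f≋g (y ∷ ys) = ++-cong (f≋g y) (concatMap-≋ f≋g ys)

    concatMap-zip : (f g : Y → List X) → ∀ ys →
                    concatMap (λ y → f y ++ g y) ys ≋ concatMap f ys ++ concatMap g ys
    concatMap-zip f g []       = refl
    concatMap-zip f g (y ∷ ys) = trans (++-cong refl (concatMap-zip f g ys))
                                       (interchange (f y) (g y) _ _)

    concatMap-[] : {f : Y → List X} → (∀ y → f y ≋ []) → ∀ ys → concatMap f ys ≋ []
    concatMap-[] f≋[] []       = refl
    concatMap-[] f≋[] (y ∷ ys) = ++-cong (f≋[] y) (concatMap-[] f≋[] ys)

  concatMap-singleton : {f : X → List X} → (∀ x → f x ≋ [ x ]) → ∀ xs → concatMap f xs ≋ xs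
  concatMap-singleton f≋ []       = refl
  concatMap-singleton f≋ (x ∷ xs) = ++-cong (f≋ x) (concatMap-singleton f≋ xs)

concatMap-concatMap : {X : Set x} {Y : Set y} {Z : Set a} (g : Y → List Z) (f : X → List Y) → ∀ xs →
                      concatMap g (concatMap f xs) ≡ concatMap (concatMap g ∘ f) xs
concatMap-concatMap g f []       = ≡.refl
concatMap-concatMap g f (x ∷ xs) = ≡.trans (List.concatMap-++ g (f x) (concatMap f xs))
                                           (≡.cong (concatMap g (f x) ++_) (concatMap-concatMap g f xs))

concatMap-resp : {X : Set x} {Y : Set y} {_⟶X_ : Rel (List X) r} {_⟶Y_ : Rel (List Y) s} →
  let open FormalSum _⟶X_ using () renaming (_≋_ to _≋X_)
      open FormalSum _⟶Y_ using () renaming (_≋_ to _≋Y_) in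
  (f : X → List Y) → (∀ {xs ys} → xs ⟶X ys → concatMap f xs ≋Y concatMap f ys) →
  ∀ {xs ys} → xs ≋X ys → concatMap f xs ≋Y concatMap f ys
concatMap-resp {_⟶X_ = _⟶X_} {_⟶Y_} f f-rel = go
  where
  module X = FormalSum _⟶X_
  module Y = FormalSum _⟶Y_
  open SetoidReasoning Y.setoid

  go : ∀ {xs ys} → xs X.≋ ys → concatMap f xs Y.≋ concatMap f ys
  go (X.rel p)     = f-rel p
  go X.refl        = Y.refl
  go (X.sym p)     = Y.sym (go p)
  go (X.trans p q) = Y.trans (go p) (go q)
  go (X.++-cong {xs} {xs′} {ys} {ys′} p q) = begin
    concatMap f (xs ++ ys)             ≡⟨ List.concatMap-++ f xs ys ⟩
    concatMap f xs ++ concatMap f ys   ≈⟨ Y.++-cong (go p) (go q) ⟩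
    concatMap f xs′ ++ concatMap f ys′ ≡⟨ List.concatMap-++ f xs′ ys′ ⟨
    concatMap f (xs′ ++ ys′)           ∎
  go (X.++-comm xs ys) = begin
    concatMap f (xs ++ ys)           ≡⟨ List.concatMap-++ f xs ys ⟩
    concatMap f xs ++ concatMap f ys ≈⟨ Y.++-comm (concatMap f xs) (concatMap f ys) ⟩
    concatMap f ys ++ concatMap f xs ≡⟨ List.concatMap-++ f ys xs ⟨
    concatMap f (ys ++ xs)           ∎

-- An action of R on generators, extended additively to formal sums.
module _ (R : Ring c ℓ) {X : Set x} (_⟶_ : Rel (List X) r) where
  open Ring R
  open FormalSum _⟶_ using (_≋_)

  record IsActionOnGenerators (act : Carrier → X → List X) : Set (c ⊔ ℓ ⊔ x ⊔ r) where
    field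
      act-rel  : ∀ k {xs ys} → xs ⟶ ys → concatMap (act k) xs ≋ concatMap (act k) ys
      act-cong : ∀ {k l} → k ≈ l → ∀ x → act k x ≋ act l x
      act-+    : ∀ k l x → act (k + l) x ≋ act k x ++ act l x
      act-0    : ∀ x → act 0# x ≋ []
      act-*    : ∀ k l x → act (k * l) x ≋ concatMap (act k) (act l x)
      act-1    : ∀ x → act 1# x ≋ [ x ]

module _ {R : Ring c ℓ} {X : Set x} {_⟶_ : Rel (List X) r} where
  open Ring R using (Carrier; _+_; _*_; -_; 0#; 1#; +-congˡ; -‿inverseʳ)
  open FormalSum _⟶_

  extend : (Carrier → X → List X) → Carrier → List X → List X
  extend act k = concatMap (act k)

  abstract
    presented-isLeftModule : {act : Carrier → X → List X} → IsActionOnGenerators R _⟶_ act →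
                             IsLeftModule R _≋_ _++_ [] (extend act (- 1#)) (extend act)
    presented-isLeftModule {act} isAction = record
      { isLeftSemimodule = record
        { +ᴹ-isCommutativeMonoid = isCommutativeMonoid
        ; isPreleftSemimodule    = record
          { *ₗ-cong      = λ {k} {l} {xs} {ys} k≈l xs≋ys →
              trans (concatMap-≋ (act-cong k≈l) xs) (concatMap-resp (act l) (act-rel l) xs≋ys)
          ; *ₗ-zeroˡ     = concatMap-[] act-0
          ; *ₗ-distribʳ  = distribʳ
          ; *ₗ-identityˡ = concatMap-singleton act-1
          ; *ₗ-assoc     = λ k l xs → trans (concatMap-≋ (act-* k l) xs)
                                            (reflexive (≡.sym (concatMap-concatMap (act k) (act l) xs)))
          ; *ₗ-zeroʳ     = λ _ → refl
          ; *ₗ-distribˡ  = λ k xs ys → reflexive (List.concatMap-++ (act k) xs ys)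
          }
        }
      ; -ᴹ‿cong    = concatMap-resp (act (- 1#)) (act-rel (- 1#))
      ; -ᴹ‿inverse = (λ xs → trans (++-comm _ xs) (inverseʳ xs)) , inverseʳ
      }
      where
      open IsActionOnGenerators isAction

      infixr 7 _·_
      _·_ : Carrier → List X → List X
      k · xs = concatMap (act k) xs

      distribʳ : ∀ xs k l → (k + l) · xs ≋ k · xs ++ l · xs
      distribʳ xs k l = trans (concatMap-≋ (act-+ k l) xs) (concatMap-zip (act k) (act l) xs)

      open SetoidReasoning setoid

      inverseʳ : ∀ xs → xs ++ (- 1#) · xs ≋ []
      inverseʳ xs = begin
        xs ++ (- 1#) · xs      ≈⟨ ++-cong (concatMap-singleton act-1 xs) refl ⟨
        1# · xs ++ (- 1#) · xs ≈⟨ distribʳ xs 1# (- 1#) ⟨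
        (1# + - 1#) · xs       ≈⟨ concatMap-≋ (act-cong (-‿inverseʳ 1#)) xs ⟩
        0# · xs                ≈⟨ concatMap-[] act-0 xs ⟩
        []                     ∎

  presentedModule : {act : Carrier → X → List X} → IsActionOnGenerators R _⟶_ act → LeftModule R x (x ⊔ r)
  presentedModule {act} isAction = record
    { Carrierᴹ     = List X
    ; _≈ᴹ_         = _≋_
    ; _+ᴹ_         = _++_
    ; _*ₗ_         = extend act
    ; 0ᴹ           = []
    ; -ᴹ_          = extend act (- 1#)
    ; isLeftModule = presented-isLeftModule isAction
    }

restrictScalars : {R : Ring a b} {S : Ring c ℓ} {φ : Ring.Carrier R → Ring.Carrier S} →
  IsRingHomomorphism (Ring.rawRing R) (Ring.rawRing S) φ → LeftModule S m ℓm → LeftModule R m ℓm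
restrictScalars {S = S} {φ} φ-homo V = record
  { Carrierᴹ     = Carrierᴹ
  ; _≈ᴹ_         = _≈ᴹ_
  ; _+ᴹ_         = _+ᴹ_
  ; _*ₗ_         = λ k v → φ k *ₗ v
  ; 0ᴹ           = 0ᴹ
  ; -ᴹ_          = -ᴹ_
  ; isLeftModule = record
    { isLeftSemimodule = record
      { +ᴹ-isCommutativeMonoid = +ᴹ-isCommutativeMonoid
      ; isPreleftSemimodule    = record
        { *ₗ-cong      = λ k≈l v≈w → *ₗ-cong (⟦⟧-cong k≈l) v≈w
        ; *ₗ-zeroˡ     = λ v → ≈ᴹ-trans (*ₗ-congʳ 0#-homo) (*ₗ-zeroˡ v)
        ; *ₗ-distribʳ  = λ v k l → ≈ᴹ-trans (*ₗ-congʳ (+-homo k l)) (*ₗ-distribʳ v _ _)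
        ; *ₗ-identityˡ = λ v → ≈ᴹ-trans (*ₗ-congʳ 1#-homo) (*ₗ-identityˡ v)
        ; *ₗ-assoc     = λ k l v → ≈ᴹ-trans (*ₗ-congʳ (*-homo k l)) (*ₗ-assoc _ _ v)
        ; *ₗ-zeroʳ     = λ _ → *ₗ-zeroʳ _
        ; *ₗ-distribˡ  = λ _ → *ₗ-distribˡ _
        }
      }
    ; -ᴹ‿cong    = -ᴹ‿cong
    ; -ᴹ‿inverse = -ᴹ‿inverse
    }
  }
  where
  open LeftModule V
  open IsRingHomomorphism φ-homo

-- {v ∈ V : φ(1)v = v} as an R-module, for a possibly non-unital φ : R → S.
Res : {R : Ring a b} {S : Ring c ℓ} {φ : Ring.Carrier R → Ring.Carrier S} →
  IsRingWithoutOneHomomorphism (Ring.rawRingWithoutOne R) (Ring.rawRingWithoutOne S) φ →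
  LeftModule S m ℓm → LeftModule R (m ⊔ ℓm) ℓm
Res {R = R} {S} {φ} φ-homo V = record
  { Carrierᴹ     = ∃ λ v → e *ₗ v ≈ᴹ v
  ; _≈ᴹ_         = λ (v , _) (w , _) → v ≈ᴹ w
  ; _+ᴹ_         = λ (v , ev) (w , ew) →
      v +ᴹ w , ≈ᴹ-trans (*ₗ-distribˡ e v w) (+ᴹ-cong ev ew)
  ; _*ₗ_         = λ r (v , ev) →
      φ r *ₗ v , ≈ᴹ-trans (≈ᴹ-sym (*ₗ-assoc e (φ r) v))
                          (*ₗ-congʳ (S.trans (S.sym (*-homo R.1# r)) (⟦⟧-cong (R.*-identityˡ r))))
  ; 0ᴹ           = 0ᴹ , *ₗ-zeroʳ e
  ; -ᴹ_          = λ (v , ev) → -ᴹ v , ≈ᴹ-trans (*ₗ-neg v) (-ᴹ‿cong ev)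
  ; isLeftModule = record
    { isLeftSemimodule = record
      { +ᴹ-isCommutativeMonoid = record
        { isMonoid = record
          { isSemigroup = record
            { isMagma = record
              { isEquivalence = On.isEquivalence proj₁ ≈ᴹ-isEquivalence
              ; ∙-cong        = +ᴹ-cong
              }
            ; assoc = λ _ _ _ → +ᴹ-assoc _ _ _
            }
          ; identity = (λ _ → +ᴹ-identityˡ _) , λ _ → +ᴹ-identityʳ _
          }
        ; comm = λ _ _ → +ᴹ-comm _ _
        }
      ; isPreleftSemimodule = record
        { *ₗ-cong      = λ k≈l v≈w → *ₗ-cong (⟦⟧-cong k≈l) v≈w
        ; *ₗ-zeroˡ     = λ (v , _) → ≈ᴹ-trans (*ₗ-congʳ 0#-homo) (*ₗ-zeroˡ v)
        ; *ₗ-distribʳ  = λ (v , _) k l → ≈ᴹ-trans (*ₗ-congʳ (+-homo k l)) (*ₗ-distribʳ v _ _)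
        ; *ₗ-identityˡ = λ (_ , ev) → ev
        ; *ₗ-assoc     = λ k l (v , _) → ≈ᴹ-trans (*ₗ-congʳ (*-homo k l)) (*ₗ-assoc _ _ v)
        ; *ₗ-zeroʳ     = λ _ → *ₗ-zeroʳ _
        ; *ₗ-distribˡ  = λ _ _ _ → *ₗ-distribˡ _ _ _
        }
      }
    ; -ᴹ‿cong    = -ᴹ‿cong
    ; -ᴹ‿inverse = (λ _ → -ᴹ‿inverseˡ _) , λ _ → -ᴹ‿inverseʳ _
    }
  }
  where
  module R = Ring R
  module S = Ring S
  open LeftModule V
  open IsRingWithoutOneHomomorphism φ-homo
  open LeftModuleProperties V using (inverseˡ-uniqueᴹ)

  e = φ R.1#

  *ₗ-neg : ∀ v → e *ₗ (-ᴹ v) ≈ᴹ -ᴹ (e *ₗ v)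
  *ₗ-neg v = inverseˡ-uniqueᴹ _ _ (≈ᴹ-trans (≈ᴹ-sym (*ₗ-distribˡ e (-ᴹ v) v))
                                            (≈ᴹ-trans (*ₗ-congˡ (-ᴹ‿inverseˡ v)) (*ₗ-zeroʳ e)))

leftIdeal : (R : Ring c ℓ) → Ring.Carrier R → LeftModule R (c ⊔ ℓ) ℓ
leftIdeal R e = record
  { Carrierᴹ     = ∃ λ x → ∃ λ y → x ≈ y * e
  ; _≈ᴹ_         = λ (x , _) (x′ , _) → x ≈ x′
  ; _+ᴹ_         = λ (x , y , p) (x′ , y′ , p′) →
      x + x′ , y + y′ , trans (+-cong p p′) (sym (distribʳ e y y′))
  ; _*ₗ_         = λ r (x , y , p) → r * x , r * y , trans (*-congˡ p) (sym (*-assoc r y e))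
  ; 0ᴹ           = 0# , 0# , sym (zeroˡ e)
  ; -ᴹ_          = λ (x , y , p) → - x , - y , trans (-‿cong p) (-‿distribˡ-* y e)
  ; isLeftModule = record
    { isLeftSemimodule = record
      { +ᴹ-isCommutativeMonoid = record
        { isMonoid = record
          { isSemigroup = record
            { isMagma = record
              { isEquivalence = On.isEquivalence proj₁ isEquivalence
              ; ∙-cong        = +-cong
              }
            ; assoc = λ _ _ _ → +-assoc _ _ _
            }
          ; identity = (λ _ → +-identityˡ _) , λ _ → +-identityʳ _
          }
        ; comm = λ _ _ → +-comm _ _
        }
      ; isPreleftSemimodule = record
        { *ₗ-cong      = *-cong
        ; *ₗ-zeroˡ     = λ _ → zeroˡ _
        ; *ₗ-distribʳ  = λ _ _ _ → distribʳ _ _ _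
        ; *ₗ-identityˡ = λ _ → *-identityˡ _
        ; *ₗ-assoc     = λ _ _ _ → *-assoc _ _ _
        ; *ₗ-zeroʳ     = λ _ → zeroʳ _
        ; *ₗ-distribˡ  = λ _ _ _ → distribˡ _ _ _
        }
      }
    ; -ᴹ‿cong    = -‿cong
    ; -ᴹ‿inverse = (λ _ → -‿inverseˡ _) , λ _ → -‿inverseʳ _
    }
  }
  where
  open Ring R hiding (refl; zero)
  open RingProperties R using (-‿distribˡ-*)

record ShortExact {R : Ring a b} (U V W : LeftModule R m ℓm) : Set (a ⊔ m ⊔ ℓm) where
  private
    module U = LeftModule U
    module V = LeftModule V
    module W = LeftModule W
  field
    f      : U.Carrierᴹ → V.Carrierᴹ
    g      : V.Carrierᴹ → W.Carrierᴹ
    f-mono : IsLeftModuleMonomorphism U.rawLeftModule V.rawLeftModule f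
    g-homo : IsLeftModuleHomomorphism V.rawLeftModule W.rawLeftModule g
    g-surj : Surjective V._≈ᴹ_ W._≈ᴹ_ g
    exact  : ∀ v → (g v W.≈ᴹ W.0ᴹ) ⇔ (∃ λ u → f u V.≈ᴹ v)

module LinearAlgebra (K : CommutativeRing c ℓ) where
  private module K = CommutativeRing K
  open K using (_≈_; _+_; _*_; -_; 0#; 1#; ring; *-congˡ; *-congʳ; *-assoc; *-comm; *-identityˡ; *-identityʳ;
                distribˡ; distribʳ; zeroˡ; zeroʳ) renaming (Carrier to 𝕜)

  VectorSpace : ∀ m ℓm → Set (c ⊔ ℓ ⊔ lsuc (m ⊔ ℓm))
  VectorSpace m ℓm = LeftModule ring m ℓm

  module _ (B : Setoid a b) where
    private module B = Setoid B

    data FreeRelation : Rel (List (𝕜 × B.Carrier)) (c ⊔ ℓ ⊔ a ⊔ b) where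
      cong : ∀ {k k′ x x′} → k ≈ k′ → x B.≈ x′ → FreeRelation [ k , x ] [ k′ , x′ ]
      add  : ∀ k l x → FreeRelation [ k + l , x ] ((k , x) ∷ (l , x) ∷ [])
      zero : ∀ x → FreeRelation [ 0# , x ] []

    open FormalSum FreeRelation using (rel; reflexive)

    abstract
      Free-isAction : IsActionOnGenerators ring FreeRelation (λ k (l , x) → [ k * l , x ])
      Free-isAction = record
        { act-rel  = λ
          { k (cong l≈l′ x≈x′) → rel (cong (*-congˡ l≈l′) x≈x′)
          ; k (add l l′ x)     → FormalSum.trans (rel (cong (distribˡ k l l′) B.refl)) (rel (add _ _ x))
          ; k (zero x)         → FormalSum.trans (rel (cong (zeroʳ k) B.refl)) (rel (zero x))
          }
        ; act-cong = λ k≈l _ → rel (cong (*-congʳ k≈l) B.refl)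
        ; act-+    = λ k l (j , x) → FormalSum.trans (rel (cong (distribʳ j k l) B.refl)) (rel (add _ _ x))
        ; act-0    = λ (j , x) → FormalSum.trans (rel (cong (zeroˡ j) B.refl)) (rel (zero x))
        ; act-*    = λ k l (j , x) → rel (cong (*-assoc k l j) B.refl)
        ; act-1    = λ (j , x) → rel (cong (*-identityˡ j) B.refl)
        }

    Free : VectorSpace (c ⊔ a) (c ⊔ ℓ ⊔ a ⊔ b)
    Free = presentedModule Free-isAction

  ⟨_⟩ : {B : Set b} → B → List (𝕜 × B)
  ⟨ x ⟩ = [ 1# , x ]

  module _ {v ℓv w ℓw} (V : VectorSpace v ℓv) (W : VectorSpace w ℓw) where
    private
      module V = LeftModule V
      module W = LeftModule W
    open V using () renaming (_≈ᴹ_ to _≈ⱽ_; _+ᴹ_ to _+ⱽ_; _*ₗ_ to _*ⱽ_; 0ᴹ to 0ⱽ)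
    open W using () renaming (_≈ᴹ_ to _≈ᵂ_; _+ᴹ_ to _+ᵂ_; _*ₗ_ to _*ᵂ_; 0ᴹ to 0ᵂ)

    data TensorRelation : Rel (List (V.Carrierᴹ × W.Carrierᴹ)) (c ⊔ v ⊔ ℓv ⊔ w ⊔ ℓw) where
      cong   : ∀ {v v′ w w′} → v ≈ⱽ v′ → w ≈ᵂ w′ → TensorRelation [ v , w ] [ v′ , w′ ]
      addˡ   : ∀ v v′ w → TensorRelation [ v +ⱽ v′ , w ] ((v , w) ∷ (v′ , w) ∷ [])
      addʳ   : ∀ v w w′ → TensorRelation [ v , w +ᵂ w′ ] ((v , w) ∷ (v , w′) ∷ [])
      scalar : ∀ k v w → TensorRelation [ k *ⱽ v , w ] [ v , k *ᵂ w ]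
      zeroˡ′ : ∀ w → TensorRelation [ 0ⱽ , w ] []

    open FormalSum TensorRelation

    zeroʳ′ : ∀ v → [ v , 0ᵂ ] ≋ []
    zeroʳ′ v = trans (rel (cong V.≈ᴹ-refl (W.≈ᴹ-sym (W.*ₗ-zeroʳ 0#))))
              (trans (sym (rel (scalar 0# v 0ᵂ)))
              (trans (rel (cong (V.*ₗ-zeroˡ v) W.≈ᴹ-refl)) (rel (zeroˡ′ 0ᵂ))))

    abstract
      ⊗-isAction : IsActionOnGenerators ring TensorRelation (λ k (v , w) → [ k *ⱽ v , w ])
      ⊗-isAction = record
        { act-rel  = λ
          { k (cong v≈v′ w≈w′) → rel (cong (V.*ₗ-congˡ v≈v′) w≈w′)
          ; k (addˡ v v′ w)    → trans (rel (cong (V.*ₗ-distribˡ k v v′) W.≈ᴹ-refl)) (rel (addˡ _ _ w))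
          ; k (addʳ v w w′)    → rel (addʳ _ w w′)
          ; k (scalar l v w)   → trans (rel (cong (slide k l v) W.≈ᴹ-refl)) (rel (scalar l _ w))
          ; k (zeroˡ′ w)       → trans (rel (cong (V.*ₗ-zeroʳ k) W.≈ᴹ-refl)) (rel (zeroˡ′ w))
          }
        ; act-cong = λ k≈l _ → rel (cong (V.*ₗ-congʳ k≈l) W.≈ᴹ-refl)
        ; act-+    = λ k l (v , w) → trans (rel (cong (V.*ₗ-distribʳ v k l) W.≈ᴹ-refl)) (rel (addˡ _ _ w))
        ; act-0    = λ (v , w) → trans (rel (cong (V.*ₗ-zeroˡ v) W.≈ᴹ-refl)) (rel (zeroˡ′ w))
        ; act-*    = λ k l (v , w) → rel (cong (V.*ₗ-assoc k l v) W.≈ᴹ-refl)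
        ; act-1    = λ (v , w) → rel (cong (V.*ₗ-identityˡ v) W.≈ᴹ-refl)
        }
        where
        slide : ∀ k l v → k *ⱽ (l *ⱽ v) ≈ⱽ l *ⱽ (k *ⱽ v)
        slide k l v = V.≈ᴹ-trans (V.≈ᴹ-sym (V.*ₗ-assoc k l v))
                     (V.≈ᴹ-trans (V.*ₗ-congʳ (*-comm k l)) (V.*ₗ-assoc l k v))

    infixr 7 _⊗_

    _⊗_ : VectorSpace (v ⊔ w) (c ⊔ v ⊔ ℓv ⊔ w ⊔ ℓw)
    _⊗_ = presentedModule ⊗-isAction

  infixr 7 _⊗ₑ_

  _⊗ₑ_ : {V : Set a} {W : Set b} → V → W → List (V × W)
  v ⊗ₑ w = [ v , w ]

  -- The additive extension of v ⊗ w ↦ β v w; well defined when β is bilinear.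
  ⊗-rec : ∀ {V : Set a} {W : Set b} (U : VectorSpace m ℓm) →
          (V → W → LeftModule.Carrierᴹ U) → List (V × W) → LeftModule.Carrierᴹ U
  ⊗-rec U β = foldr (λ (v , w) u → β v w +ᴹ u) 0ᴹ
    where open LeftModule U

  module MonoidAlgebra (M : Monoid a b) where
    open RingProperties ring using (-1*x≈-x)
    private module M = Monoid M
    open FormalSum (FreeRelation M.setoid)
    private module F = LeftModule (Free M.setoid)
    open SetoidReasoning setoid

    term : 𝕜 × M.Carrier → 𝕜 × M.Carrier → List (𝕜 × M.Carrier)
    term (k , x) (l , y) = [ k * l , x M.∙ y ]

    infixl 7 _⊛_
    _⊛_ : (xs ys : List (𝕜 × M.Carrier)) → List (𝕜 × M.Carrier)
    xs ⊛ ys = concatMap (λ y → concatMap (λ x → term x y) xs) ys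

    private
      congˡ : ∀ xs {ys ys′} → ys ≋ ys′ → xs ⊛ ys ≋ xs ⊛ ys′
      congˡ xs = concatMap-resp (λ y → concatMap (λ x → term x y) xs) λ
        { (cong l≈l′ y≈y′) → ++-cong (concatMap-≋ (λ _ → rel (cong (*-congˡ l≈l′) (M.∙-congˡ y≈y′))) xs) refl
        ; (add l l′ y)     → begin
            concatMap (λ x → term x (l + l′ , y)) xs ++ []
              ≈⟨ ++-cong (concatMap-≋ (λ (k , x) → trans (rel (cong (distribˡ k l l′) M.refl)) (rel (add _ _ _))) xs) refl ⟩
            concatMap (λ x → term x (l , y) ++ term x (l′ , y)) xs ++ []
              ≈⟨ ++-cong (concatMap-zip _ _ xs) refl ⟩
            (concatMap (λ x → term x (l , y)) xs ++ concatMap (λ x → term x (l′ , y)) xs) ++ []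
              ≡⟨ List.++-assoc (concatMap (λ x → term x (l , y)) xs) _ [] ⟩
            concatMap (λ x → term x (l , y)) xs ++ (concatMap (λ x → term x (l′ , y)) xs ++ []) ∎
        ; (zero y)         → ++-cong (concatMap-[] (λ (k , x) → trans (rel (cong (zeroʳ k) M.refl)) (rel (zero _))) xs) refl
        }

      congʳ : ∀ ys {xs xs′} → xs ≋ xs′ → xs ⊛ ys ≋ xs′ ⊛ ys
      congʳ ys xs≋xs′ = concatMap-≋ (λ (l , y) → concatMap-resp (λ x → term x (l , y)) (λ
        { (cong k≈k′ x≈x′) → rel (cong (*-congʳ k≈k′) (M.∙-congʳ x≈x′))
        ; (add k k′ x)     → trans (rel (cong (distribʳ l k k′) M.refl)) (rel (add _ _ _))
        ; (zero x)         → trans (rel (cong (zeroˡ l) M.refl)) (rel (zero _))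
        }) xs≋xs′) ys

      assoc : ∀ xs ys zs → (xs ⊛ ys) ⊛ zs ≋ xs ⊛ (ys ⊛ zs)
      assoc xs ys zs = begin
        (xs ⊛ ys) ⊛ zs
          ≈⟨ concatMap-≋ inner zs ⟩
        concatMap (λ z → xs ⊛ concatMap (λ y → term y z) ys) zs
          ≡⟨ concatMap-concatMap _ _ zs ⟨
        xs ⊛ (ys ⊛ zs) ∎
        where
        inner : ∀ z → concatMap (λ w → term w z) (xs ⊛ ys) ≋ xs ⊛ concatMap (λ y → term y z) ys
        inner z = begin
          concatMap (λ w → term w z) (xs ⊛ ys)
            ≡⟨ concatMap-concatMap _ _ ys ⟩
          concatMap (λ y → concatMap (λ w → term w z) (concatMap (λ x → term x y) xs)) ys
            ≈⟨ concatMap-≋ (λ y → trans (reflexive (concatMap-concatMap _ _ xs))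
                                  (concatMap-≋ (λ x → rel (cong (*-assoc _ _ _) (M.assoc _ _ _))) xs)) ys ⟩
          concatMap (λ y → concatMap (λ x → concatMap (term x) (term y z)) xs) ys
            ≡⟨ List.concatMap-cong (λ y → ≡.sym (List.++-identityʳ _)) ys ⟩
          concatMap (λ y → concatMap (λ w → concatMap (λ x → term x w) xs) (term y z)) ys
            ≡⟨ concatMap-concatMap _ _ ys ⟨
          xs ⊛ concatMap (λ y → term y z) ys ∎

    abstract
      algebra-isRing : IsRing F._≈ᴹ_ F._+ᴹ_ _⊛_ F.-ᴹ_ F.0ᴹ [ 1# , M.ε ]
      algebra-isRing = record
        { +-isAbelianGroup = F.+ᴹ-isAbelianGroup
        ; *-cong     = λ {xs} {xs′} {ys} {ys′} p q → trans (congʳ ys p) (congˡ xs′ q)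
        ; *-assoc    = assoc
        ; *-identity =
            (concatMap-singleton λ _ → rel (cong (*-identityˡ _) (M.identityˡ _)))
          , (λ xs → trans (reflexive (List.++-identityʳ _))
                          (concatMap-singleton (λ _ → rel (cong (*-identityʳ _) (M.identityʳ _))) xs))
        ; distrib    =
            (λ xs ys zs → reflexive (List.concatMap-++ _ ys zs))
          , (λ zs xs ys → trans (concatMap-≋ (λ z → reflexive (List.concatMap-++ (λ x → term x z) xs ys)) zs)
                                (concatMap-zip _ _ zs))
        }

    algebra : Ring (c ⊔ a) (c ⊔ ℓ ⊔ a ⊔ b)
    algebra = record
      { Carrier = F.Carrierᴹ
      ; _≈_     = F._≈ᴹ_
      ; _+_     = F._+ᴹ_
      ; _*_     = _⊛_
      ; -_      = F.-ᴹ_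
      ; 0#      = F.0ᴹ
      ; 1#      = [ 1# , M.ε ]
      ; isRing  = algebra-isRing
      }

    scalars : 𝕜 → Ring.Carrier algebra
    scalars k = [ k , M.ε ]

    abstract
      scalars-homo : IsRingHomomorphism (Ring.rawRing ring) (Ring.rawRing algebra) scalars
      scalars-homo = record
        { isSemiringHomomorphism = record
          { isNearSemiringHomomorphism = record
            { +-isMonoidHomomorphism = record
              { isMagmaHomomorphism = record
                { isRelHomomorphism = record { cong = λ k≈l → rel (cong k≈l M.refl) }
                ; homo              = λ k l → rel (add k l M.ε)
                }
              ; ε-homo = rel (zero M.ε)
              }
            ; *-homo = λ k l → rel (cong K.refl (M.sym (M.identityˡ M.ε)))
            }
          ; 1#-homo = refl
          }
        ; -‿homo = λ k → rel (cong (K.sym (-1*x≈-x k)) M.refl)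
        }

    underlying : LeftModule algebra m ℓm → VectorSpace m ℓm
    underlying = restrictScalars scalars-homo

  algebra : Monoid a b → Ring (c ⊔ a) (c ⊔ ℓ ⊔ a ⊔ b)
  algebra = MonoidAlgebra.algebra

  -- V ⊗ W as a 𝕜P-module, with p ∈ P acting by p · (v ⊗ w) = f(p)v ⊗ g(p)w.
  module _ {M : Monoid a b} {N : Monoid x y} {P : Monoid r s}
           {f : Monoid.Carrier P → Monoid.Carrier M} {g : Monoid.Carrier P → Monoid.Carrier N}
           (f-homo : IsMonoidHomomorphism (Monoid.rawMonoid P) (Monoid.rawMonoid M) f)
           (g-homo : IsMonoidHomomorphism (Monoid.rawMonoid P) (Monoid.rawMonoid N) g)
           {v ℓv w ℓw} (V : LeftModule (algebra M) v ℓv) (W : LeftModule (algebra N) w ℓw) where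
    private
      module M = Monoid M
      module N = Monoid N
      module P = Monoid P
      module 𝕜M = MonoidAlgebra M
      module 𝕜N = MonoidAlgebra N
      module 𝕜P = MonoidAlgebra P
      module V = LeftModule V
      module W = LeftModule W
      module f = IsMonoidHomomorphism f-homo
      module g = IsMonoidHomomorphism g-homo
      _⟶_ = TensorRelation (𝕜M.underlying V) (𝕜N.underlying W)
      module FM = FormalSum (FreeRelation M.setoid)
      module FN = FormalSum (FreeRelation N.setoid)
    open FormalSum _⟶_

    _▷_ : 𝕜 × P.Carrier → V.Carrierᴹ × W.Carrierᴹ → V.Carrierᴹ × W.Carrierᴹ
    (k , p) ▷ (v , w) = [ k , f p ] V.*ₗ v , [ 1# , g p ] W.*ₗ w

    private
      ▷-scalar : ∀ k p l v → [ k , f p ] V.*ₗ ([ l , M.ε ] V.*ₗ v) V.≈ᴹ [ l , M.ε ] V.*ₗ ([ k , f p ] V.*ₗ v)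
      ▷-scalar k p l v = V.≈ᴹ-trans (V.≈ᴹ-sym (V.*ₗ-assoc _ _ v)) (V.≈ᴹ-trans (V.*ₗ-congʳ
        (FM.rel (cong (*-comm k l) (M.trans (M.identityʳ _) (M.sym (M.identityˡ _))))))
        (V.*ₗ-assoc _ _ v))

      ▷-scalarʳ : ∀ p l w → [ l , N.ε ] W.*ₗ ([ 1# , g p ] W.*ₗ w) W.≈ᴹ [ 1# , g p ] W.*ₗ ([ l , N.ε ] W.*ₗ w)
      ▷-scalarʳ p l w = W.≈ᴹ-trans (W.≈ᴹ-sym (W.*ₗ-assoc _ _ w)) (W.≈ᴹ-trans (W.*ₗ-congʳ
        (FN.rel (cong (*-comm l 1#) (N.trans (N.identityˡ _) (N.sym (N.identityʳ _))))))
        (W.*ₗ-assoc _ _ w))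

      ▷-relˡ : ∀ z {xs ys} → xs ⟶ ys → concatMap (λ t → [ z ▷ t ]) xs ≋ concatMap (λ t → [ z ▷ t ]) ys
      ▷-relˡ z       (cong v≈v′ w≈w′) = rel (cong (V.*ₗ-congˡ v≈v′) (W.*ₗ-congˡ w≈w′))
      ▷-relˡ z       (addˡ v v′ w)    = trans (rel (cong (V.*ₗ-distribˡ _ v v′) W.≈ᴹ-refl)) (rel (addˡ _ _ _))
      ▷-relˡ z       (addʳ v w w′)    = trans (rel (cong V.≈ᴹ-refl (W.*ₗ-distribˡ _ w w′))) (rel (addʳ _ _ _))
      ▷-relˡ (k , p) (scalar l v w)   = trans (rel (cong (▷-scalar k p l v) W.≈ᴹ-refl))
                                       (trans (rel (scalar l _ _)) (rel (cong V.≈ᴹ-refl (▷-scalarʳ p l w))))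
      ▷-relˡ z       (zeroˡ′ w)       = trans (rel (cong (V.*ₗ-zeroʳ _) W.≈ᴹ-refl)) (rel (zeroˡ′ _))

      ▷-relʳ : ∀ t {xs ys} → FreeRelation P.setoid xs ys → concatMap (λ z → [ z ▷ t ]) xs ≋ concatMap (λ z → [ z ▷ t ]) ys
      ▷-relʳ t (cong k≈l p≈q) = rel (cong (V.*ₗ-congʳ (FM.rel (cong k≈l (f.⟦⟧-cong p≈q))))
                                          (W.*ₗ-congʳ (FN.rel (cong K.refl (g.⟦⟧-cong p≈q)))))
      ▷-relʳ (v , w) (add k l p) = trans (rel (cong (V.≈ᴹ-trans (V.*ₗ-congʳ (FM.rel (add k l (f p)))) (V.*ₗ-distribʳ v _ _))
                                                    W.≈ᴹ-refl))
                                         (rel (addˡ _ _ _))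
      ▷-relʳ (v , w) (zero p) = trans (rel (cong (V.≈ᴹ-trans (V.*ₗ-congʳ (FM.rel (zero (f p)))) (V.*ₗ-zeroˡ v)) W.≈ᴹ-refl))
                                      (rel (zeroˡ′ _))

      ▷-assoc : ∀ k p l q t → [ (k * l , p P.∙ q) ▷ t ] ≋ [ (k , p) ▷ ((l , q) ▷ t) ]
      ▷-assoc k p l q (v , w) = rel (cong
        (V.≈ᴹ-trans (V.*ₗ-congʳ (FM.rel (cong K.refl (f.homo p q)))) (V.*ₗ-assoc _ _ v))
        (W.≈ᴹ-trans (W.*ₗ-congʳ (FN.rel (cong (K.sym (*-identityˡ 1#)) (g.homo p q)))) (W.*ₗ-assoc _ _ w)))

      swap : ∀ xs (ts : List (V.Carrierᴹ × W.Carrierᴹ)) →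
             concatMap (λ t → concatMap (λ z → [ z ▷ t ]) xs) ts ≋ concatMap (λ z → concatMap (λ t → [ z ▷ t ]) ts) xs
      swap xs []       = sym (concatMap-[] (λ _ → refl) xs)
      swap xs (t ∷ ts) = trans (++-cong refl (swap xs ts)) (sym (concatMap-zip _ _ xs))

    abstract
      tensor-isAction : IsActionOnGenerators 𝕜P.algebra _⟶_ (λ xs t → concatMap (λ z → [ z ▷ t ]) xs)
      tensor-isAction = record
        { act-rel  = λ xs {ts} {us} ts⟶us →
            trans (swap xs ts) (trans (concatMap-≋ (λ z → ▷-relˡ z ts⟶us) xs) (sym (swap xs us)))
        ; act-cong = λ xs≋ys t → concatMap-resp (λ z → [ z ▷ t ]) (▷-relʳ t) xs≋ys
        ; act-+    = λ xs ys t → reflexive (List.concatMap-++ _ xs ys)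
        ; act-0    = λ _ → refl
        ; act-*    = λ xs ys t → trans (reflexive (concatMap-concatMap _ _ ys))
            (trans (concatMap-≋ (λ (l , q) → trans (reflexive (concatMap-concatMap _ _ xs))
               (trans (concatMap-≋ (λ (k , p) → ▷-assoc k p l q t) xs)
                      (reflexive (≡.sym (List.++-identityʳ _))))) ys)
               (reflexive (≡.sym (concatMap-concatMap _ _ ys))))
        ; act-1    = λ (v , w) → rel (cong
            (V.≈ᴹ-trans (V.*ₗ-congʳ (FM.rel (cong K.refl f.ε-homo))) (V.*ₗ-identityˡ v))
            (W.≈ᴹ-trans (W.*ₗ-congʳ (FN.rel (cong K.refl g.ε-homo))) (W.*ₗ-identityˡ w)))
        }

    tensorModule : LeftModule 𝕜P.algebra (v ⊔ w) (c ⊔ v ⊔ ℓv ⊔ w ⊔ ℓw)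
    tensorModule = presentedModule tensor-isAction

  diagonalTensor : (M : Monoid a b) {v ℓv w ℓw : Level} →
    LeftModule (algebra M) v ℓv → LeftModule (algebra M) w ℓw → LeftModule (algebra M) (v ⊔ w) (c ⊔ v ⊔ ℓv ⊔ w ⊔ ℓw)
  diagonalTensor M = tensorModule {M = M} {M} {M} id-homo id-homo
    where id-homo = Identity.isMonoidHomomorphism (Monoid.rawMonoid M) (Monoid.refl M)

  -- 𝕜M ⊗ 𝕜N, as the algebra with basis M × N; (x , y) stands for x ⊗ y.
  _⊗ᴬ_ : (M : Monoid a b) (N : Monoid x y) → Ring (c ⊔ a ⊔ x) (c ⊔ ℓ ⊔ a ⊔ x ⊔ b ⊔ y)
  M ⊗ᴬ N = algebra (M ×-monoid N)

  externalTensor : (M : Monoid a b) (N : Monoid x y) {v ℓv w ℓw : Level} →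
    LeftModule (algebra M) v ℓv → LeftModule (algebra N) w ℓw → LeftModule (M ⊗ᴬ N) (v ⊔ w) (c ⊔ v ⊔ ℓv ⊔ w ⊔ ℓw)
  externalTensor M N = tensorModule {M = M} {N} {M ×-monoid N}
    (Proj.Proj₁.isMonoidHomomorphism (Monoid.refl M)) (Proj.Proj₂.isMonoidHomomorphism (Monoid.refl N))
    where module Proj = DirectProduct.Monoid (Monoid.rawMonoid M) (Monoid.rawMonoid N)

  module _ {M : Monoid a b} {N : Monoid x y} {f : Monoid.Carrier M → Monoid.Carrier N}
           (f-homo : IsMagmaHomomorphism (Monoid.rawMagma M) (Monoid.rawMagma N) f) where
    private
      module M = Monoid M
      module N = Monoid N
      module 𝕜M = Ring (algebra M)
      module 𝕜N = Ring (algebra N)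
      module f = IsMagmaHomomorphism f-homo
      module FM = FormalSum (FreeRelation M.setoid)
    open FormalSum (FreeRelation N.setoid)
    open SetoidReasoning setoid

    linearExtension : 𝕜M.Carrier → 𝕜N.Carrier
    linearExtension = concatMap (λ (k , x) → [ k , f x ])

    abstract
      linearExtension-homo : IsRingWithoutOneHomomorphism 𝕜M.rawRingWithoutOne 𝕜N.rawRingWithoutOne linearExtension
      linearExtension-homo = record
        { +-isGroupHomomorphism = record
          { isMonoidHomomorphism = record
            { isMagmaHomomorphism = record
              { isRelHomomorphism = record { cong = concatMap-resp _ λ
                { (cong k≈l x≈y) → rel (cong k≈l (f.⟦⟧-cong x≈y))
                ; (add k l x)    → rel (add k l (f x))
                ; (zero x)       → rel (zero (f x))
                } }
              ; homo = λ xs ys → reflexive (List.concatMap-++ _ xs ys)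
              }
            ; ε-homo = refl
            }
          ; ⁻¹-homo = λ xs → reflexive (≡.trans (concatMap-concatMap _ _ xs) (≡.sym (concatMap-concatMap _ _ xs)))
          }
        ; *-homo = λ xs ys → begin
            linearExtension (xs 𝕜M.* ys)
              ≡⟨ concatMap-concatMap _ _ ys ⟩
            _ ≈⟨ concatMap-≋ (λ y → begin
                   _ ≡⟨ concatMap-concatMap _ _ xs ⟩
                   _ ≈⟨ concatMap-≋ (λ x → rel (cong K.refl (f.homo _ _))) xs ⟩
                   _ ≡⟨ concatMap-concatMap _ _ xs ⟨
                   _ ≡⟨ List.++-identityʳ _ ⟨
                   _ ∎) ys ⟩
            _ ≡⟨ concatMap-concatMap _ _ ys ⟨
            linearExtension xs 𝕜N.* linearExtension ys ∎
        }

  record IsBilinear {v ℓv w ℓw u ℓu} (V : VectorSpace v ℓv) (W : VectorSpace w ℓw) (U : VectorSpace u ℓu)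
                    (β : LeftModule.Carrierᴹ V → LeftModule.Carrierᴹ W → LeftModule.Carrierᴹ U) :
                    Set (c ⊔ v ⊔ ℓv ⊔ w ⊔ ℓw ⊔ u ⊔ ℓu) where
    field
      homoˡ : ∀ w → IsLeftModuleHomomorphism (LeftModule.rawLeftModule V) (LeftModule.rawLeftModule U) (λ v → β v w)
      homoʳ : ∀ v → IsLeftModuleHomomorphism (LeftModule.rawLeftModule W) (LeftModule.rawLeftModule U) (β v)

  -- An associative algebra and a counital coalgebra whose coproduct and
  -- counit are multiplicative.  No unit is required: on ⨁ₙ G₀(𝕜Πₙ) a unit for
  -- the degreewise product would have a nonzero component in every degree.
  record IsBialgebra {v ℓv} (V : VectorSpace v ℓv) (_⊙_ : Op₂ (LeftModule.Carrierᴹ V))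
                     (Δ : LeftModule.Carrierᴹ V → LeftModule.Carrierᴹ (V ⊗ V)) :
                     Set (c ⊔ ℓ ⊔ v ⊔ ℓv) where
    open LeftModule V using (Carrierᴹ; _≈ᴹ_; _*ₗ_; rawLeftModule)
    V⊗V   = V ⊗ V
    V⊗V⊗V = V ⊗ V⊗V
    open LeftModule V⊗V using () renaming (Carrierᴹ to Carrier²; _≈ᴹ_ to _≈²_; rawLeftModule to rawLeftModule²)
    open LeftModule V⊗V⊗V using () renaming (Carrierᴹ to Carrier³; _≈ᴹ_ to _≈³_)

    field
      ⊙-bilinear : IsBilinear V V V _⊙_
      ⊙-assoc    : ∀ x y z → ((x ⊙ y) ⊙ z) ≈ᴹ (x ⊙ (y ⊙ z))

    field
      Δ-linear : IsLeftModuleHomomorphism rawLeftModule rawLeftModule² Δ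

    [id⊗Δ] : Carrier² → Carrier³
    [id⊗Δ] = ⊗-rec V⊗V⊗V λ x y → x ⊗ₑ Δ y

    -- Δ ⊗ id followed by the associator (V ⊗ V) ⊗ V → V ⊗ (V ⊗ V).
    [Δ⊗id] : Carrier² → Carrier³
    [Δ⊗id] = ⊗-rec V⊗V⊗V λ x z → ⊗-rec V⊗V⊗V (λ x₁ x₂ → x₁ ⊗ₑ (x₂ ⊗ₑ z)) (Δ x)

    field
      Δ-coassoc : ∀ x → [Δ⊗id] (Δ x) ≈³ [id⊗Δ] (Δ x)

    field
      ε        : Carrierᴹ → 𝕜
      ε-linear : IsLeftModuleHomomorphism rawLeftModule (TensorUnit.rawLeftModule {R = K.rawRing}) ε
      counitˡ  : ∀ x → ⊗-rec V (λ x₁ x₂ → ε x₁ *ₗ x₂) (Δ x) ≈ᴹ x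
      counitʳ  : ∀ x → ⊗-rec V (λ x₁ x₂ → ε x₂ *ₗ x₁) (Δ x) ≈ᴹ x

    _⊙²_ : Carrier² → Carrier² → Carrier²
    s ⊙² t = ⊗-rec V⊗V (λ x₁ x₂ → ⊗-rec V⊗V (λ y₁ y₂ → (x₁ ⊙ y₁) ⊗ₑ (x₂ ⊙ y₂)) t) s

    field
      Δ-⊙ : ∀ x y → Δ (x ⊙ y) ≈² (Δ x ⊙² Δ y)
      ε-⊙ : ∀ x y → ε (x ⊙ y) ≈ ε x * ε y

module Grothendieck (K : Field c ℓ) where
  private module K = Field K
  open LinearAlgebra K.commutativeRing
  open Möbius K.ring

  𝕜Π : ℕ → Ring c (c ⊔ ℓ)
  𝕜Π n = algebra (Π-monoid n)

  Mod : Ring c (c ⊔ ℓ) → Set (lsuc (c ⊔ ℓ))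
  Mod R = LeftModule R (c ⊔ ℓ) (c ⊔ ℓ)

  e : SetPartition n → Ring.Carrier (𝕜Π n)
  e {n} A = map (λ B → μ B A , B) (filter (_≤Π? A) (partitions n))

  V⟨_⟩ : SetPartition n → Mod (𝕜Π n)
  V⟨_⟩ {n} A = leftIdeal (𝕜Π n) (e A)

  -- Here the S i are the simple R-modules and G is the Grothendieck group,
  -- with basis the classes s i = [S i].  HasClass V x says [V] = x, i.e. that
  -- V has a composition series whose factors add up to x.  Over a semisimple
  -- algebra the V having a class are the finite dimensional modules, and by
  -- Jordan–Hölder the class is unique.
  module _ {R : Ring c (c ⊔ ℓ)} {I : Set} (S : I → Mod R)
           {g ℓg} (G : VectorSpace g ℓg) (s : I → LeftModule.Carrierᴹ G) where
    open LeftModule G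

    data HasClass : Mod R → Carrierᴹ → Set (lsuc (c ⊔ ℓ) ⊔ g ⊔ ℓg) where
      simple : ∀ i → HasClass (S i) (s i)
      zero   : ∀ {V} → (∀ v → LeftModule._≈ᴹ_ V v (LeftModule.0ᴹ V)) → HasClass V 0ᴹ
      exact  : ∀ {U V W x y} → ShortExact U V W → HasClass U x → HasClass W y → HasClass V (x +ᴹ y)
      resp   : ∀ {V x y} → x ≈ᴹ y → HasClass V x → HasClass V y

  G₀ : ℕ → VectorSpace c (c ⊔ ℓ)
  G₀ n = Free (Monoid.setoid (Π-monoid n))

  ClassOf : ∀ n → Mod (𝕜Π n) → LeftModule.Carrierᴹ (G₀ n) → Set (lsuc (c ⊔ ℓ))
  ClassOf n = HasClass {R = 𝕜Π n} V⟨_⟩ (G₀ n) ⟨_⟩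

  ClassOf² : ∀ k l → Mod (Π-monoid k ⊗ᴬ Π-monoid l) → LeftModule.Carrierᴹ (G₀ k ⊗ G₀ l) → Set (lsuc (c ⊔ ℓ))
  ClassOf² k l = HasClass {R = Π-monoid k ⊗ᴬ Π-monoid l} {I = SetPartition k × SetPartition l}
                          (λ (B , C) → externalTensor (Π-monoid k) (Π-monoid l) V⟨ B ⟩ V⟨ C ⟩)
                          (G₀ k ⊗ G₀ l) (λ (B , C) → ⟨ B ⟩ ⊗ₑ ⟨ C ⟩)

  data _≈ᵍ_ : Rel (Σ ℕ SetPartition) 0ℓ where
    same : ∀ {A B : SetPartition n} → A ≈Π B → (n , A) ≈ᵍ (n , B)

  Π-graded : Setoid 0ℓ 0ℓ
  Π-graded = record
    { Carrier       = Σ ℕ SetPartition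
    ; _≈_           = _≈ᵍ_
    ; isEquivalence = record
      { refl  = λ { {n , A} → same (Monoid.refl (Π-monoid n)) }
      ; sym   = λ { (same {n} p) → same (Monoid.sym (Π-monoid n) p) }
      ; trans = λ { (same {n} p) (same q) → same (Monoid.trans (Π-monoid n) p q) }
      }
    }

  -- ⨁ₙ G₀(𝕜Πₙ), a direct sum of free modules, is free on the disjoint union
  -- of the bases.
  G₀Π : VectorSpace c (c ⊔ ℓ)
  G₀Π = Free Π-graded

  ι : ∀ n → LeftModule.Carrierᴹ (G₀ n) → LeftModule.Carrierᴹ G₀Π
  ι n = map λ (q , A) → q , (n , A)

  ι² : ∀ k l → LeftModule.Carrierᴹ (G₀ k ⊗ G₀ l) → LeftModule.Carrierᴹ (G₀Π ⊗ G₀Π)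
  ι² k l = map λ (x , y) → ι k x , ι l y

  ρ-basis : k +ℕ l ≡ n → SetPartition k × SetPartition l → SetPartition n
  ρ-basis eq (C , D) = subst SetPartition eq (C ∣Π D)

  ρ-basis-homo : (eq : k +ℕ l ≡ n) →
    IsMagmaHomomorphism (Monoid.rawMagma (Π-monoid k ×-monoid Π-monoid l)) (Monoid.rawMagma (Π-monoid n)) (ρ-basis eq)
  ρ-basis-homo refl = record
    { isRelHomomorphism = record { cong = λ { {C , D} {C′ , D′} (C≈C′ , D≈D′) → ∣Π-cong C C′ D D′ C≈C′ D≈D′ } }
    ; homo              = λ (C , D) (C′ , D′) → ∣Π-∧Π C C′ D D′
    }

  Resρ : ∀ k l n → k +ℕ l ≡ n → Mod (𝕜Π n) → Mod (Π-monoid k ⊗ᴬ Π-monoid l)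
  Resρ k l n eq = Res {R = Π-monoid k ⊗ᴬ Π-monoid l} {S = 𝕜Π n}
    (linearExtension-homo {M = Π-monoid k ×-monoid Π-monoid l} {N = Π-monoid n} (ρ-basis-homo eq))

  open LeftModule G₀Π using () renaming (Carrierᴹ to |G₀Π|; _≈ᴹ_ to _≈₁_; 0ᴹ to 0₁)
  open LeftModule (G₀Π ⊗ G₀Π) using () renaming (Carrierᴹ to |G₀Π⊗G₀Π|; _≈ᴹ_ to _≈₂_; +ᴹ-rawMonoid to +₂-rawMonoid)
  open RawMonoidDefinitions +₂-rawMonoid using (sum)

  -- [V] ⊙ [W] = [V ⊗ W].  Taking V and W simple, this determines a bilinear
  -- ⊙ uniquely, because classes are unique.
  record IsTensorProductOfClasses (_⊙_ : Op₂ |G₀Π|) : Set (lsuc (c ⊔ ℓ)) where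
    field
      same-degree : ∀ {n} {V W : Mod (𝕜Π n)} {x y} → ClassOf n V x → ClassOf n W y →
        ∃ λ z → ClassOf n (diagonalTensor (Π-monoid n) V W) z × (ι n x ⊙ ι n y) ≈₁ ι n z
      different-degree : ∀ {k l} → k ≢ l → (A : SetPartition k) (B : SetPartition l) →
        (ι k ⟨ A ⟩ ⊙ ι l ⟨ B ⟩) ≈₁ 0₁

  -- Δ[V] = Σᵢ [Res V] over 0 ≤ i ≤ n, where y i is the class of the
  -- restriction of V along ρ_{i,n-i}.  This determines a linear Δ uniquely.
  record IsSumOfRestrictions (Δ : |G₀Π| → |G₀Π⊗G₀Π|) : Set (lsuc (c ⊔ ℓ)) where
    field
      restrict : ∀ {n} {V : Mod (𝕜Π n)} {x} → ClassOf n V x →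
        ∃ λ (y : (i : Fin (suc n)) → LeftModule.Carrierᴹ (G₀ (toℕ i) ⊗ G₀ (n ∸ toℕ i))) →
          (∀ i → ClassOf² (toℕ i) (n ∸ toℕ i)
                   (Resρ (toℕ i) (n ∸ toℕ i) n (ℕ.m+[n∸m]≡n (Fin.toℕ≤pred[n] i)) V) (y i)) ×
          Δ (ι n x) ≈₂ sum {suc n} (λ i → ι² (toℕ i) (n ∸ toℕ i) (y i))

{-# OPTIONS --safe #-}
-- Write ⟨A⟩ for the class of V_A.  From A = ∑_{B ≤ A} e_B one gets, by induction
-- on A, that C ∧ e_A = e_A if A ≤ C and C ∧ e_A = 0 otherwise: V_A is a line on
-- which Πₙ acts through the character χ_A(C) = [A ≤ C].  As χ_A χ_B = χ_{A ∨ B},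
-- V_A ⊗ V_B is isomorphic to V_{A ∨ B}, so the product is ⟨A⟩ ⊙ ⟨B⟩ = ⟨A ∨ B⟩.
-- If A = B|C then χ_A(D|E) = χ_B(D) χ_C(E), so V_A restricts to V_B ⊗ V_C; if A
-- has no such decomposition then χ_A(𝟏|𝟏) = 0 and the restriction is zero.
-- Restriction and tensoring over a field are exact, which extends both formulas
-- from simple modules to all classes.  On basis elements, Δ is multiplicative
-- because A ∨ B splits at k exactly when A and B do, the parts of A ∨ B being
-- then the joins of those of A and B; coassociativity says that splitting in
-- three can be done in either order.
module Submission where

open import Defs
open import Algebra.Bundles using (CommutativeMonoid; CommutativeRing; Monoid; Ring)
open import Algebra.Construct.DirectProduct using () renaming (monoid to _×-monoid_)
import Algebra.Definitions.RawMonoid as RawMonoidDefinitions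
open import Algebra.Module.Bundles using (LeftModule)
import Algebra.Module.Construct.TensorUnit as TensorUnit
open import Algebra.Module.Morphism.Structures using (IsLeftModuleHomomorphism; IsLeftModuleMonomorphism)
import Algebra.Module.Properties.LeftModule as LeftModuleProperties
import Algebra.Morphism.Construct.DirectProduct as DirectProduct
import Algebra.Morphism.Construct.Identity as Identity
open import Algebra.Morphism.Structures using (IsMagmaHomomorphism; IsMonoidHomomorphism; IsRingWithoutOneHomomorphism)
import Algebra.Properties.CommutativeMonoid.Sum as CommutativeMonoidSum
import Algebra.Properties.CommutativeSemigroup as CommutativeSemigroupProperties
import Algebra.Properties.Group as GroupProperties
open import Data.Bool.Base using (if_then_else_)
open import Data.Empty using (⊥-elim)
open import Data.Fin.Base using (Fin; toℕ; splitAt; _↑ˡ_; _↑ʳ_)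
import Data.Fin.Properties as Fin
open import Data.Fin.Subset using (Subset; Nonempty; _∈_)
open import Data.Fin.Subset.Properties using (_∈?_; nonempty?)
open import Data.List.Base using (List; []; _∷_; [_]; _++_; map; filter; mapMaybe; foldr; concatMap)
open import Data.List.Membership.Propositional using () renaming (_∈_ to _∈ˡ_; find to findᵐ; lose to loseᵐ)
open import Data.List.Membership.Propositional.Properties
  using (∈-filter⁺; ∈-filter⁻; ∈-map⁺; ∈-map⁻; ∈-++⁻)
import Data.List.Properties as List
open import Data.List.Relation.Binary.BagAndSetEquality using (_∼[_]_; set)
open import Data.List.Relation.Unary.All as All using (All; []; _∷_)
import Data.List.Relation.Unary.All.Properties as All
open import Data.List.Relation.Unary.AllPairs as AllPairs using (AllPairs; []; _∷_)
import Data.List.Relation.Unary.AllPairs.Properties as AllPairs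
open import Data.List.Relation.Unary.Any as Any using (here; there)
open import Data.List.Relation.Unary.Unique.Propositional using (Unique)
import Data.List.Relation.Unary.Unique.Propositional.Properties as Unique
open import Data.Nat.Base using (ℕ; zero; suc; _∸_) renaming (_+_ to _+ℕ_)
import Data.Nat.Properties as ℕ
open import Data.Product.Base using (∃; Σ; _×_; _,_; proj₁; proj₂)
open import Data.Sum.Base using (_⊎_; inj₁; inj₂)
import Data.Vec.Base as Vec
import Data.Vec.Properties as Vec
open import Function.Base using (_∘_; id; case_of_)
open import Function.Bundles using (_⇔_; mk⇔; Equivalence)
open import Induction.WellFounded using (Acc; acc)
open import Level using (Level; 0ℓ; _⊔_) renaming (suc to lsuc)
open import Relation.Binary.Bundles using (Setoid)
open import Relation.Binary.Core using (Rel)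
open import Relation.Binary.Definitions using (Symmetric)
open import Relation.Binary.PropositionalEquality as ≡ using (_≡_; _≢_; subst)
import Relation.Binary.Reasoning.Setoid as SetoidReasoning
open import Relation.Nullary using (¬_; Dec; yes; no; does; map′; ¬?; _×-dec_)

open SetPartition using (parts; part-nonempty; part-of; part-unique)

-- The lattice of set partitions

private
  variable
    k l m n : ℕ

≤Π-refl : (A : SetPartition n) → A ≤Π A
≤Π-refl A = mk≤Π A A λ p∈ → _ , p∈ , id

≈Π-refl : (A : SetPartition n) → A ≈Π A
≈Π-refl A = ≤Π-antisym A A (≤Π-refl A) (≤Π-refl A)

≈Π-trans : (A B C : SetPartition n) → A ≈Π B → B ≈Π C → A ≈Π C
≈Π-trans A B C A≈B B≈C = Monoid.trans (Π-monoid _) {A} {B} {C} A≈B B≈C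

Together : SetPartition n → Fin n → Fin n → Set
Together A i j = ∃ λ p → p ∈ˡ parts A × i ∈ p × j ∈ p

together? : (A : SetPartition n) → ∀ i j → Dec (Together A i j)
together? A i j = map′ findᵐ (λ (_ , p∈ , ij∈) → loseᵐ p∈ ij∈)
                       (Any.any? (λ p → i ∈? p ×-dec j ∈? p) (parts A))

together-≤ : (A B : SetPartition n) → A ≤Π B → ∀ {i j} → Together A i j → Together B i j
together-≤ A B A≤B (p , p∈ , i∈ , j∈) =
  let q , q∈ , p⊆q = container A B A≤B p∈ in q , q∈ , p⊆q i∈ , p⊆q j∈

≤-together : (A B : SetPartition n) → (∀ {i j} → Together A i j → Together B i j) → A ≤Π B
≤-together A B f = mk≤Π A B λ {p} p∈ →
  let i , i∈p      = part-nonempty A p∈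
      q , q∈ , i∈q = part-of B i
  in q , q∈ , λ j∈p → let q′ , q′∈ , i∈q′ , j∈q′ = f (p , p∈ , i∈p , j∈p)
                      in subst (_ ∈_) (part-unique B q′∈ q∈ i∈q′ i∈q) j∈q′

subsets-unique : ∀ n → Unique (subsets n)
subsets-unique zero    = [] ∷ []
subsets-unique (suc n) = Unique.++⁺
  (Unique.map⁺ Vec.∷-injectiveʳ (subsets-unique n))
  (Unique.map⁺ Vec.∷-injectiveʳ (subsets-unique n))
  λ (p∈ , q∈) → case (∈-map⁻ _ p∈ , ∈-map⁻ _ q∈) of λ { ((_ , _ , ≡.refl) , (_ , _ , ())) }

module _ {a} {X : Set a} where

  sublists-⊆ : ∀ (xs : List X) {ys} → ys ∈ˡ sublists xs → ∀ {x} → x ∈ˡ ys → x ∈ˡ xs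
  sublists-⊆ []       (here ≡.refl) x∈ = x∈
  sublists-⊆ (y ∷ xs) ys∈ x∈ with ∈-++⁻ (sublists xs) ys∈
  ... | inj₁ ys∈ˡ = there (sublists-⊆ xs ys∈ˡ x∈)
  ... | inj₂ ys∈ʳ with ∈-map⁻ (y ∷_) ys∈ʳ
  ...   | zs , zs∈ , ≡.refl with x∈
  ...     | here x≡y  = here x≡y
  ...     | there x∈zs = there (sublists-⊆ xs zs∈ x∈zs)

  sublists-distinct : ∀ {xs : List X} → Unique xs → AllPairs (λ ys zs → ¬ ys ∼[ set ] zs) (sublists xs)
  sublists-distinct []                      = [] ∷ []
  sublists-distinct {x ∷ xs} (x∉xs ∷ uniq) = AllPairs.++⁺ ih
    (AllPairs.map⁺ (AllPairs.map (λ {ys} {zs} (x∉ys , x∉zs , ys≁zs) (eq : (x ∷ ys) ∼[ set ] (x ∷ zs)) → ys≁zs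
        (mk⇔ (drop x∉ys λ y∈ → Equivalence.to eq y∈) (drop x∉zs λ y∈ → Equivalence.from eq y∈))) (strengthen (All.tabulate id) ih)))
    (All.tabulate λ ys∈ → All.map⁺ (All.tabulate λ zs∈ eq → x∉ (sublists-⊆ xs ys∈ (Equivalence.from eq (here ≡.refl)))))
    where
    ih = sublists-distinct uniq

    x∉ : ¬ x ∈ˡ xs
    x∉ x∈ = All.lookup x∉xs x∈ ≡.refl

    drop : ∀ {ys zs} → ¬ x ∈ˡ ys → (∀ {y} → y ∈ˡ (x ∷ ys) → y ∈ˡ (x ∷ zs)) → ∀ {y} → y ∈ˡ ys → y ∈ˡ zs
    drop x∉ys f y∈ with f (there y∈)
    ... | here ≡.refl = ⊥-elim (x∉ys y∈)
    ... | there y∈′ = y∈′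

    strengthen : ∀ {yss} → All (_∈ˡ sublists xs) yss → AllPairs (λ ys zs → ¬ ys ∼[ set ] zs) yss →
                 AllPairs (λ ys zs → ¬ x ∈ˡ ys × ¬ x ∈ˡ zs × ¬ ys ∼[ set ] zs) yss
    strengthen []        []          = []
    strengthen (y∈ ∷ all) (ps ∷ pss) =
      All.zipWith (λ (z∈ , p) → x∉ ∘ sublists-⊆ xs y∈ , x∉ ∘ sublists-⊆ xs z∈ , p) (all , ps) ∷ strengthen all pss

partitions-distinct : ∀ n → AllPairs (λ A B → ¬ A ≈Π B) (partitions n)
partitions-distinct n = go (sublists-distinct (subsets-unique n))
  where
  goᴬ : ∀ {ps} (P : IsPartition ps) {xss} → All (λ qs → ¬ ps ∼[ set ] qs) xss →
        All (λ B → ¬ record { isPartition = P } ≈Π B) (mapMaybe toPartition xss)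
  goᴬ P [] = []
  goᴬ P {xs ∷ _} (p ∷ ps) with isPartition? xs
  ... | yes _ = (λ eq → p (_≈Π_.same-parts eq)) ∷ goᴬ P ps
  ... | no _  = goᴬ P ps

  go : ∀ {xss} → AllPairs (λ ys zs → ¬ ys ∼[ set ] zs) xss → AllPairs (λ A B → ¬ A ≈Π B) (mapMaybe (toPartition {n}) xss)
  go [] = []
  go {xs ∷ _} (p ∷ ps) with isPartition? xs
  ... | yes P = goᴬ P p ∷ go ps
  ... | no _  = go ps

module _ (A B : SetPartition n) where
  private
    upper? : (C : SetPartition n) → Dec (A ≤Π C × B ≤Π C)
    upper? C = A ≤Π? C ×-dec B ≤Π? C

  infixr 6 _∨Π_

  abstract
    _∨Π_ : SetPartition n
    _∨Π_ = foldr _∧Π_ (𝟏 n) (filter upper? (partitions n))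

    ∨Π-least : ∀ C → A ≤Π C → B ≤Π C → _∨Π_ ≤Π C
    ∨Π-least C A≤C B≤C =
      let C′ , C′∈ , C≈C′ = partitions-complete C
          C≤C′ = ≈Π⇒≤Π C C′ C≈C′
      in ≤Π-trans _∨Π_ C′ C
           (lower _ (∈-filter⁺ upper? C′∈ (≤Π-trans A C C′ A≤C C≤C′ , ≤Π-trans B C C′ B≤C C≤C′)))
           (≈Π⇒≤Π C′ C (≈Π-sym C C′ C≈C′))
      where
      lower : ∀ Cs {C} → C ∈ˡ Cs → foldr _∧Π_ (𝟏 n) Cs ≤Π C
      lower (D ∷ Cs) (here ≡.refl) = proj₁ (∧Π-infimum D (foldr _∧Π_ (𝟏 n) Cs))
      lower (D ∷ Cs) {C} (there C∈) =
        ≤Π-trans (D ∧Π foldr _∧Π_ (𝟏 n) Cs) (foldr _∧Π_ (𝟏 n) Cs) C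
          (proj₁ (proj₂ (∧Π-infimum D (foldr _∧Π_ (𝟏 n) Cs)))) (lower Cs C∈)

    ∨Π-greatest : ∀ D → (∀ C → A ≤Π C → B ≤Π C → D ≤Π C) → D ≤Π _∨Π_
    ∨Π-greatest D D≤ = go _ λ {C} C∈ →
      let _ , A≤C , B≤C = ∈-filter⁻ upper? {xs = partitions n} C∈ in D≤ C A≤C B≤C
      where
      go : ∀ Cs → (∀ {C} → C ∈ˡ Cs → D ≤Π C) → D ≤Π foldr _∧Π_ (𝟏 n) Cs
      go []       _ = ≤Π-maximum D
      go (C ∷ Cs) f = proj₂ (proj₂ (∧Π-infimum C (foldr _∧Π_ (𝟏 n) Cs))) D (f (here ≡.refl)) (go Cs (f ∘ there))

  ∨Π-upperˡ : A ≤Π _∨Π_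
  ∨Π-upperˡ = ∨Π-greatest A λ _ A≤C _ → A≤C

  ∨Π-upperʳ : B ≤Π _∨Π_
  ∨Π-upperʳ = ∨Π-greatest B λ _ _ B≤C → B≤C

  ∨Π-≤⁻ : ∀ C → _∨Π_ ≤Π C → A ≤Π C × B ≤Π C
  ∨Π-≤⁻ C A∨B≤C = ≤Π-trans A _∨Π_ C ∨Π-upperˡ A∨B≤C , ≤Π-trans B _∨Π_ C ∨Π-upperʳ A∨B≤C

preimage : (Fin m → Fin n) → Subset n → Subset m
preimage f p = Vec.tabulate (Vec.lookup p ∘ f)

∈-preimage⁺ : (f : Fin m → Fin n) {p : Subset n} → ∀ {i} → f i ∈ p → i ∈ preimage f p
∈-preimage⁺ f {p} {i} fi∈ = Vec.lookup⇒[]= i _ (≡.trans (Vec.lookup∘tabulate _ i) (Vec.[]=⇒lookup fi∈))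

∈-preimage⁻ : (f : Fin m → Fin n) {p : Subset n} → ∀ {i} → i ∈ preimage f p → f i ∈ p
∈-preimage⁻ f {p} {i} i∈ = Vec.lookup⇒[]= (f i) p (≡.trans (≡.sym (Vec.lookup∘tabulate _ i)) (Vec.[]=⇒lookup i∈))

module _ (f : Fin m → Fin n) (A : SetPartition n) where
  private
    ps : List (Subset m)
    ps = filter nonempty? (map (preimage f) (parts A))

    ∈-ps⁺ : ∀ {p i} → p ∈ˡ parts A → f i ∈ p → preimage f p ∈ˡ ps
    ∈-ps⁺ p∈ fi∈ = ∈-filter⁺ nonempty? (∈-map⁺ (preimage f) p∈) (_ , ∈-preimage⁺ f fi∈)

    ∈-ps⁻ : ∀ {q} → q ∈ˡ ps → Nonempty q × ∃ λ p → p ∈ˡ parts A × q ≡ preimage f p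
    ∈-ps⁻ q∈ = let q∈′ , ne = ∈-filter⁻ nonempty? {xs = map (preimage f) (parts A)} q∈
               in ne , ∈-map⁻ (preimage f) q∈′

    abstract
      ps-isPartition : IsPartition ps
      ps-isPartition = mkIsPartition
        (λ q∈ → proj₁ (∈-ps⁻ q∈))
        (λ i → let p , p∈ , fi∈ = part-of A (f i) in preimage f p , ∈-ps⁺ p∈ fi∈ , ∈-preimage⁺ f fi∈)
        λ q∈ q′∈ i∈q i∈q′ → case (∈-ps⁻ q∈ , ∈-ps⁻ q′∈) of λ
          { ((_ , _ , p∈ , ≡.refl) , (_ , _ , p′∈ , ≡.refl)) →
            ≡.cong (preimage f) (part-unique A p∈ p′∈ (∈-preimage⁻ f i∈q) (∈-preimage⁻ f i∈q′)) }

  abstract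
    pullback : SetPartition m
    pullback = record { parts = ps ; isPartition = ps-isPartition }

    pullback⁺ : ∀ {i j} → Together A (f i) (f j) → Together pullback i j
    pullback⁺ (p , p∈ , i∈ , j∈) = preimage f p , ∈-ps⁺ p∈ i∈ , ∈-preimage⁺ f i∈ , ∈-preimage⁺ f j∈

    pullback⁻ : ∀ {i j} → Together pullback i j → Together A (f i) (f j)
    pullback⁻ (q , q∈ , i∈ , j∈) with ∈-ps⁻ q∈
    ... | _ , p , p∈ , ≡.refl = p , p∈ , ∈-preimage⁻ f i∈ , ∈-preimage⁻ f j∈

pullback-mono : (f : Fin m → Fin n) (A B : SetPartition n) → A ≤Π B → pullback f A ≤Π pullback f B
pullback-mono f A B A≤B = ≤-together (pullback f A) (pullback f B)
  (pullback⁺ f B ∘ together-≤ A B A≤B ∘ pullback⁻ f A)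

pullback-cong : (f : Fin m → Fin n) (A B : SetPartition n) → A ≈Π B → pullback f A ≈Π pullback f B
pullback-cong f A B A≈B = ≤Π-antisym (pullback f A) (pullback f B)
  (pullback-mono f A B (≈Π⇒≤Π A B A≈B)) (pullback-mono f B A (≈Π⇒≤Π B A (≈Π-sym A B A≈B)))

record Cut (k l n : ℕ) : Set where
  constructor cut
  field
    sum≡ : k +ℕ l ≡ n

open Cut

inˡ : Cut k l n → Fin k → Fin n
inˡ {l = l} (cut eq) i = subst Fin eq (i ↑ˡ l)

inʳ : Cut k l n → Fin l → Fin n
inʳ {k} (cut eq) j = subst Fin eq (k ↑ʳ j)

toℕ-inˡ : (c : Cut k l n) (i : Fin k) → toℕ (inˡ c i) ≡ toℕ i
toℕ-inˡ {l = l} (cut ≡.refl) i = Fin.toℕ-↑ˡ i l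

toℕ-inʳ : (c : Cut k l n) (j : Fin l) → toℕ (inʳ c j) ≡ k +ℕ toℕ j
toℕ-inʳ {k} (cut ≡.refl) j = Fin.toℕ-↑ʳ k j

data InView (c : Cut k l n) : Fin n → Set where
  isˡ : ∀ i → InView c (inˡ c i)
  isʳ : ∀ j → InView c (inʳ c j)

inView : (c : Cut k l n) → ∀ x → InView c x
inView {k} {l} (cut ≡.refl) x with splitAt k x | Fin.join-splitAt k l x
... | inj₁ i | ≡.refl = isˡ i
... | inj₂ j | ≡.refl = isʳ j

infix 8 _↾ˡ_ _↾ʳ_

_↾ˡ_ : SetPartition n → Cut k l n → SetPartition k
A ↾ˡ c = pullback (inˡ c) A

_↾ʳ_ : SetPartition n → Cut k l n → SetPartition l
A ↾ʳ c = pullback (inʳ c) A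

-- A ≈ B ∣Π C for some B ∈ Πₖ and C ∈ Πₗ, namely B = A ↾ˡ c and C = A ↾ʳ c.
Splits : SetPartition n → Cut k l n → Set
Splits A c = ∀ i j → ¬ Together A (inˡ c i) (inʳ c j)

abstract
  splits? : (A : SetPartition n) (c : Cut k l n) → Dec (Splits A c)
  splits? A c = Fin.all? λ i → Fin.all? λ j → ¬? (together? A (inˡ c i) (inʳ c j))

together-sym : (A : SetPartition n) → ∀ {i j} → Together A i j → Together A j i
together-sym A (p , p∈ , i∈ , j∈) = p , p∈ , j∈ , i∈

module _ (C : SetPartition k) (D : SetPartition l) where

  ∣-together-ˡˡ⁺ : ∀ {i j} → Together C i j → Together (C ∣Π D) (i ↑ˡ l) (j ↑ˡ l)
  ∣-together-ˡˡ⁺ (p , p∈ , i∈ , j∈) = padʳ l p , ∈-∣⁺ C D (left p∈) , ∈-padʳ⁺ l i∈ , ∈-padʳ⁺ l j∈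

  ∣-together-ʳʳ⁺ : ∀ {i j} → Together D i j → Together (C ∣Π D) (k ↑ʳ i) (k ↑ʳ j)
  ∣-together-ʳʳ⁺ (q , q∈ , i∈ , j∈) = padˡ k q , ∈-∣⁺ C D (right q∈) , ∈-padˡ⁺ k i∈ , ∈-padˡ⁺ k j∈

  private
    unpadʳ : ∀ {i : Fin k} p → i ↑ˡ l ∈ padʳ l p → i ∈ p
    unpadʳ {i} p i∈ = let i′ , eq , i′∈ = ∈-padʳ⁻ l p i∈ in subst (_∈ p) (≡.sym (Fin.↑ˡ-injective l i i′ eq)) i′∈

    unpadˡ : ∀ {j : Fin l} q → k ↑ʳ j ∈ padˡ k q → j ∈ q
    unpadˡ {j} q j∈ = let j′ , eq , j′∈ = ∈-padˡ⁻ k q j∈ in subst (_∈ q) (≡.sym (Fin.↑ʳ-injective k j j′ eq)) j′∈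

  ∣-together-ˡˡ⁻ : ∀ {i j} → Together (C ∣Π D) (i ↑ˡ l) (j ↑ˡ l) → Together C i j
  ∣-together-ˡˡ⁻ {i} {j} (r , r∈ , i∈ , j∈) with ∈-∣⁻ C D r∈
  ... | left {p} p∈  = p , p∈ , unpadʳ {i} p i∈ , unpadʳ {j} p j∈
  ... | right {q} q∈ = let j′ , eq , _ = ∈-padˡ⁻ k q i∈ in ⊥-elim (↑ˡ≢↑ʳ {k} {l} {i} {j′} eq)

  ∣-together-ʳʳ⁻ : ∀ {i j} → Together (C ∣Π D) (k ↑ʳ i) (k ↑ʳ j) → Together D i j
  ∣-together-ʳʳ⁻ {i} {j} (r , r∈ , i∈ , j∈) with ∈-∣⁻ C D r∈
  ... | right {q} q∈ = q , q∈ , unpadˡ {i} q i∈ , unpadˡ {j} q j∈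
  ... | left {p} p∈  = let i′ , eq , _ = ∈-padʳ⁻ l p i∈ in ⊥-elim (↑ˡ≢↑ʳ {k} {l} {i′} {i} (≡.sym eq))

  ∣-together-ˡʳ : ∀ {i j} → ¬ Together (C ∣Π D) (i ↑ˡ l) (k ↑ʳ j)
  ∣-together-ˡʳ {i} {j} (r , r∈ , i∈ , j∈) with ∈-∣⁻ C D r∈
  ... | left {p} p∈  = let i′ , eq , _ = ∈-padʳ⁻ l p j∈ in ↑ˡ≢↑ʳ {k} {l} {i′} {j} (≡.sym eq)
  ... | right {q} q∈ = let j′ , eq , _ = ∈-padˡ⁻ k q i∈ in ↑ˡ≢↑ʳ {k} {l} {i} {j′} eq

module _ {A : SetPartition n} {C : SetPartition k} {D : SetPartition l} where

  ≤-∣⁻ : (c : Cut k l n) → A ≤Π subst SetPartition (sum≡ c) (C ∣Π D) → Splits A c × A ↾ˡ c ≤Π C × A ↾ʳ c ≤Π D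
  ≤-∣⁻ c@(cut ≡.refl) A≤ = (λ i j ij → ∣-together-ˡʳ C D (together-≤ A (C ∣Π D) A≤ ij))
               , ≤-together (A ↾ˡ c) C (∣-together-ˡˡ⁻ C D ∘ together-≤ A (C ∣Π D) A≤ ∘ pullback⁻ (inˡ c) A)
               , ≤-together (A ↾ʳ c) D (∣-together-ʳʳ⁻ C D ∘ together-≤ A (C ∣Π D) A≤ ∘ pullback⁻ (inʳ c) A)

  ≤-∣⁺ : (c : Cut k l n) → Splits A c → A ↾ˡ c ≤Π C → A ↾ʳ c ≤Π D → A ≤Π subst SetPartition (sum≡ c) (C ∣Π D)
  ≤-∣⁺ c@(cut ≡.refl) s A≤C A≤D = ≤-together A (C ∣Π D) λ {x} {y} → go (inView c x) (inView c y)
    where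
    go : ∀ {x y} → InView c x → InView c y → Together A x y → Together (C ∣Π D) x y
    go (isˡ i) (isˡ j) t = ∣-together-ˡˡ⁺ C D (together-≤ (A ↾ˡ c) C A≤C (pullback⁺ (inˡ c) A t))
    go (isˡ i) (isʳ j) t = ⊥-elim (s i j t)
    go (isʳ i) (isˡ j) t = ⊥-elim (s j i (together-sym A t))
    go (isʳ i) (isʳ j) t = ∣-together-ʳʳ⁺ C D (together-≤ (A ↾ʳ c) D A≤D (pullback⁺ (inʳ c) A t))

splits-≤ : (A B : SetPartition n) (c : Cut k l n) → A ≤Π B → Splits B c → Splits A c
splits-≤ A B c A≤B s i j t = s i j (together-≤ A B A≤B t)

splits-vacuousˡ : (A : SetPartition n) (c : Cut 0 n n) → Splits A c
splits-vacuousˡ A c ()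

splits-vacuousʳ : (A : SetPartition n) (c : Cut n 0 n) → Splits A c
splits-vacuousʳ A c i ()

≈-from-upper-bounds : (A B : SetPartition n) → (∀ C → A ≤Π C ⇔ B ≤Π C) → A ≈Π B
≈-from-upper-bounds A B f = ≤Π-antisym A B
  (Equivalence.from (f B) (≤Π-refl B)) (Equivalence.to (f A) (≤Π-refl A))

∨Π-cong : (A A′ B B′ : SetPartition n) → A ≈Π A′ → B ≈Π B′ → (A ∨Π B) ≈Π (A′ ∨Π B′)
∨Π-cong A A′ B B′ A≈A′ B≈B′ = ≤Π-antisym (A ∨Π B) (A′ ∨Π B′)
  (mono A A′ B B′ (≈Π⇒≤Π A A′ A≈A′) (≈Π⇒≤Π B B′ B≈B′))
  (mono A′ A B′ B (≈Π⇒≤Π A′ A (≈Π-sym A A′ A≈A′)) (≈Π⇒≤Π B′ B (≈Π-sym B B′ B≈B′)))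
  where
  mono : (A A′ B B′ : SetPartition _) → A ≤Π A′ → B ≤Π B′ → (A ∨Π B) ≤Π (A′ ∨Π B′)
  mono A A′ B B′ A≤A′ B≤B′ = ∨Π-least A B (A′ ∨Π B′)
    (≤Π-trans A A′ _ A≤A′ (∨Π-upperˡ A′ B′)) (≤Π-trans B B′ _ B≤B′ (∨Π-upperʳ A′ B′))

∨Π-assoc : (A B C : SetPartition n) → ((A ∨Π B) ∨Π C) ≈Π (A ∨Π (B ∨Π C))
∨Π-assoc A B C = ≈-from-upper-bounds ((A ∨Π B) ∨Π C) (A ∨Π (B ∨Π C)) λ D → mk⇔
  (λ le → let AB≤D , C≤D = ∨Π-≤⁻ (A ∨Π B) C D le
              A≤D , B≤D  = ∨Π-≤⁻ A B D AB≤D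
          in ∨Π-least A (B ∨Π C) D A≤D (∨Π-least B C D B≤D C≤D))
  (λ le → let A≤D , BC≤D = ∨Π-≤⁻ A (B ∨Π C) D le
              B≤D , C≤D  = ∨Π-≤⁻ B C D BC≤D
          in ∨Π-least (A ∨Π B) C D (∨Π-least A B D A≤D B≤D) C≤D)

module _ (A B : SetPartition n) (c : Cut k l n) where

  splits-∨ : Splits A c → Splits B c → Splits (A ∨Π B) c
  splits-∨ sA sB = proj₁ (≤-∣⁻ {C = 𝟏 k} {𝟏 l} c (∨Π-least A B _
    (≤-∣⁺ c sA (≤Π-maximum (A ↾ˡ c)) (≤Π-maximum (A ↾ʳ c)))
    (≤-∣⁺ c sB (≤Π-maximum (B ↾ˡ c)) (≤Π-maximum (B ↾ʳ c)))))

  splits-∨⁻ : Splits (A ∨Π B) c → Splits A c × Splits B c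
  splits-∨⁻ s = splits-≤ A (A ∨Π B) c (∨Π-upperˡ A B) s , splits-≤ B (A ∨Π B) c (∨Π-upperʳ A B) s

  module _ (s : Splits (A ∨Π B) c) where
    private
      ↾-≤ : (C : SetPartition k) (D : SetPartition l) →
            ((A ∨Π B) ↾ˡ c ≤Π C × (A ∨Π B) ↾ʳ c ≤Π D) ⇔
            ((A ↾ˡ c ∨Π B ↾ˡ c) ≤Π C × (A ↾ʳ c ∨Π B ↾ʳ c) ≤Π D)
      ↾-≤ C D = mk⇔
        (λ (≤C , ≤D) → let A≤ , B≤ = ∨Π-≤⁻ A B _ (≤-∣⁺ {C = C} {D} c s ≤C ≤D)
                           _ , A≤C , A≤D = ≤-∣⁻ {C = C} {D} c A≤
                           _ , B≤C , B≤D = ≤-∣⁻ {C = C} {D} c B≤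
                       in ∨Π-least (A ↾ˡ c) (B ↾ˡ c) C A≤C B≤C , ∨Π-least (A ↾ʳ c) (B ↾ʳ c) D A≤D B≤D)
        (λ (≤C , ≤D) → let A≤C , B≤C = ∨Π-≤⁻ (A ↾ˡ c) (B ↾ˡ c) C ≤C
                           A≤D , B≤D = ∨Π-≤⁻ (A ↾ʳ c) (B ↾ʳ c) D ≤D
                           sA , sB = splits-∨⁻ s
                       in proj₂ (≤-∣⁻ {C = C} {D} c (∨Π-least A B _ (≤-∣⁺ c sA A≤C A≤D) (≤-∣⁺ c sB B≤C B≤D))))

    ↾ˡ-∨ : (A ∨Π B) ↾ˡ c ≈Π (A ↾ˡ c ∨Π B ↾ˡ c)
    ↾ˡ-∨ = ≈-from-upper-bounds _ _ λ C → mk⇔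
      (λ le → proj₁ (Equivalence.to (↾-≤ C (𝟏 l)) (le , ≤Π-maximum _)))
      (λ le → proj₁ (Equivalence.from (↾-≤ C (𝟏 l)) (le , ≤Π-maximum _)))

    ↾ʳ-∨ : (A ∨Π B) ↾ʳ c ≈Π (A ↾ʳ c ∨Π B ↾ʳ c)
    ↾ʳ-∨ = ≈-from-upper-bounds _ _ λ D → mk⇔
      (λ le → proj₂ (Equivalence.to (↾-≤ (𝟏 k) D) (≤Π-maximum _ , le)))
      (λ le → proj₂ (Equivalence.from (↾-≤ (𝟏 k) D) (≤Π-maximum _ , le)))

≈-from-together : (A B : SetPartition n) → (∀ {i j} → Together A i j ⇔ Together B i j) → A ≈Π B
≈-from-together A B f = ≤Π-antisym A B (≤-together A B (Equivalence.to f)) (≤-together B A (Equivalence.from f))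

↾ʳ-full : (A : SetPartition n) (c : Cut 0 n n) → A ↾ʳ c ≈Π A
↾ʳ-full A c = ≈-from-together (A ↾ʳ c) A λ {i} {j} → mk⇔
  (subst id (≡.cong₂ (Together A) (inʳ≡ i) (inʳ≡ j)) ∘ pullback⁻ (inʳ c) A)
  (pullback⁺ (inʳ c) A ∘ subst id (≡.sym (≡.cong₂ (Together A) (inʳ≡ i) (inʳ≡ j))))
  where
  inʳ≡ : ∀ i → inʳ c i ≡ i
  inʳ≡ i = Fin.toℕ-injective (toℕ-inʳ c i)

↾ˡ-full : (A : SetPartition n) (c : Cut n 0 n) → A ↾ˡ c ≈Π A
↾ˡ-full A c = ≈-from-together (A ↾ˡ c) A λ {i} {j} → mk⇔
  (subst id (≡.cong₂ (Together A) (inˡ≡ i) (inˡ≡ j)) ∘ pullback⁻ (inˡ c) A)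
  (pullback⁺ (inˡ c) A ∘ subst id (≡.sym (≡.cong₂ (Together A) (inˡ≡ i) (inˡ≡ j))))
  where
  inˡ≡ : ∀ i → inˡ c i ≡ i
  inˡ≡ i = Fin.toℕ-injective (toℕ-inˡ c i)

module _ {p q l k m n : ℕ} (c : Cut k l n) (c′ : Cut p q k) (d : Cut p m n) (d′ : Cut q l m)
         (A : SetPartition n) where
  private
    in₁ : ∀ i → inˡ c (inˡ c′ i) ≡ inˡ d i
    in₁ i = Fin.toℕ-injective (≡.trans (toℕ-inˡ c _) (≡.trans (toℕ-inˡ c′ i) (≡.sym (toℕ-inˡ d i))))

    in₂ : ∀ i → inˡ c (inʳ c′ i) ≡ inʳ d (inˡ d′ i)
    in₂ i = Fin.toℕ-injective (≡.trans (toℕ-inˡ c _) (≡.trans (toℕ-inʳ c′ i)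
      (≡.sym (≡.trans (toℕ-inʳ d _) (≡.cong (p +ℕ_) (toℕ-inˡ d′ i))))))

    in₃ : ∀ i → inʳ c i ≡ inʳ d (inʳ d′ i)
    in₃ i = Fin.toℕ-injective (≡.trans (toℕ-inʳ c i) (≡.trans
      (≡.cong (_+ℕ toℕ i) (≡.sym (Cut.sum≡ c′)))
      (≡.trans (ℕ.+-assoc p q (toℕ i))
      (≡.sym (≡.trans (toℕ-inʳ d _) (≡.cong (p +ℕ_) (toℕ-inʳ d′ i)))))))

    move : ∀ {x x′ y y′} → x ≡ x′ → y ≡ y′ → Together A x y → Together A x′ y′
    move ≡.refl ≡.refl t = t

  ↾-coassocˡ : (A ↾ˡ c) ↾ˡ c′ ≈Π A ↾ˡ d
  ↾-coassocˡ = ≈-from-together _ _ λ {i} {j} → mk⇔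
    (pullback⁺ (inˡ d) A ∘ move (in₁ i) (in₁ j) ∘ pullback⁻ (inˡ c) A ∘ pullback⁻ (inˡ c′) (A ↾ˡ c))
    (pullback⁺ (inˡ c′) (A ↾ˡ c) ∘ pullback⁺ (inˡ c) A ∘ move (≡.sym (in₁ i)) (≡.sym (in₁ j)) ∘ pullback⁻ (inˡ d) A)

  ↾-coassocᵐ : (A ↾ˡ c) ↾ʳ c′ ≈Π (A ↾ʳ d) ↾ˡ d′
  ↾-coassocᵐ = ≈-from-together _ _ λ {i} {j} → mk⇔
    (pullback⁺ (inˡ d′) (A ↾ʳ d) ∘ pullback⁺ (inʳ d) A ∘ move (in₂ i) (in₂ j) ∘
      pullback⁻ (inˡ c) A ∘ pullback⁻ (inʳ c′) (A ↾ˡ c))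
    (pullback⁺ (inʳ c′) (A ↾ˡ c) ∘ pullback⁺ (inˡ c) A ∘ move (≡.sym (in₂ i)) (≡.sym (in₂ j)) ∘
      pullback⁻ (inʳ d) A ∘ pullback⁻ (inˡ d′) (A ↾ʳ d))

  ↾-coassocʳ : A ↾ʳ c ≈Π (A ↾ʳ d) ↾ʳ d′
  ↾-coassocʳ = ≈-from-together _ _ λ {i} {j} → mk⇔
    (pullback⁺ (inʳ d′) (A ↾ʳ d) ∘ pullback⁺ (inʳ d) A ∘ move (in₃ i) (in₃ j) ∘ pullback⁻ (inʳ c) A)
    (pullback⁺ (inʳ c) A ∘ move (≡.sym (in₃ i)) (≡.sym (in₃ j)) ∘ pullback⁻ (inʳ d) A ∘ pullback⁻ (inʳ d′) (A ↾ʳ d))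

  splits-coassoc⁺ : Splits A c → Splits (A ↾ˡ c) c′ → Splits A d × Splits (A ↾ʳ d) d′
  splits-coassoc⁺ s s′ = (λ i x → go i (inView d′ x))
    , λ i j t → s (inʳ c′ i) j (move (≡.sym (in₂ i)) (≡.sym (in₃ j)) (pullback⁻ (inʳ d) A t))
    where
    go : ∀ i {x} → InView d′ x → ¬ Together A (inˡ d i) (inʳ d x)
    go i (isˡ j) t = s′ i j (pullback⁺ (inˡ c) A (move (≡.sym (in₁ i)) (≡.sym (in₂ j)) t))
    go i (isʳ j) t = s (inˡ c′ i) j (move (≡.sym (in₁ i)) (≡.sym (in₃ j)) t)

  splits-coassoc⁻ : Splits A d → Splits (A ↾ʳ d) d′ → Splits A c × Splits (A ↾ˡ c) c′
  splits-coassoc⁻ s s′ = (λ x j → go (inView c′ x) j)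
    , λ i j t → s i (inˡ d′ j) (move (in₁ i) (in₂ j) (pullback⁻ (inˡ c) A t))
    where
    go : ∀ {x} → InView c′ x → ∀ j → ¬ Together A (inˡ c x) (inʳ c j)
    go (isˡ i) j t = s i (inʳ d′ j) (move (in₁ i) (in₃ j) t)
    go (isʳ i) j t = s′ i j (pullback⁺ (inʳ d) A (move (in₂ i) (in₃ j) t))

-- The Möbius function and the idempotents e_A

module ListSum {c ℓ} (M : CommutativeMonoid c ℓ) where
  open CommutativeMonoid M renaming (Carrier to C)
  open CommutativeSemigroupProperties commutativeSemigroup using (interchange)

  infixl 3 _when_
  _when_ : ∀ {p} {P : Set p} → C → Dec P → C
  x when d = if does d then x else ε

  module _ {p} {P : Set p} where

    when-yes : ∀ {x} (d : Dec P) → P → (x when d) ≈ x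
    when-yes (yes _) _ = refl
    when-yes (no ¬p) p = ⊥-elim (¬p p)

    when-no : ∀ {x} (d : Dec P) → ¬ P → (x when d) ≈ ε
    when-no (yes p) ¬p = ⊥-elim (¬p p)
    when-no (no _)  _  = refl

    when-cong : ∀ {x y} (d : Dec P) → (P → x ≈ y) → (x when d) ≈ (y when d)
    when-cong (yes p) x≈y = x≈y p
    when-cong (no _)  _   = refl

  when-⇔ : ∀ {p q} {P : Set p} {Q : Set q} {x y} (d : Dec P) (d′ : Dec Q) → (P → Q) → (Q → P) → (P → x ≈ y) →
           (x when d) ≈ (y when d′)
  when-⇔ (yes p) d′ P⇒Q _   x≈y = trans (x≈y p) (sym (when-yes d′ (P⇒Q p)))
  when-⇔ (no ¬p) d′ _   Q⇒P _   = sym (when-no d′ λ q → ¬p (Q⇒P q))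

  module _ {a} {A : Set a} where

    ∑ : List A → (A → C) → C
    ∑ xs f = foldr (λ x s → f x ∙ s) ε xs

    ∑-cong : ∀ {f g} xs → (∀ x → f x ≈ g x) → ∑ xs f ≈ ∑ xs g
    ∑-cong []       f≈g = refl
    ∑-cong (x ∷ xs) f≈g = ∙-cong (f≈g x) (∑-cong xs f≈g)

    ∑-ε : ∀ {f} xs → (∀ {x} → x ∈ˡ xs → f x ≈ ε) → ∑ xs f ≈ ε
    ∑-ε []       f≈ε = refl
    ∑-ε (x ∷ xs) f≈ε = trans (∙-cong (f≈ε (here ≡.refl)) (∑-ε xs (λ x∈ → f≈ε (there x∈)))) (identityˡ ε)

    ∑-∙ : ∀ f g xs → ∑ xs (λ x → f x ∙ g x) ≈ ∑ xs f ∙ ∑ xs g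
    ∑-∙ f g []       = sym (identityˡ ε)
    ∑-∙ f g (x ∷ xs) = trans (∙-congˡ (∑-∙ f g xs)) (interchange (f x) (g x) _ _)

    ∑-when : ∀ {p} {P : Set p} f xs (d : Dec P) → (∑ xs f when d) ≈ ∑ xs (λ x → f x when d)
    ∑-when f xs (yes _) = refl
    ∑-when f xs (no _)  = sym (∑-ε xs λ _ → refl)

    ∑-single : ∀ {r} {_~_ : Rel A r} → Symmetric _~_ → ∀ {f xs x} → AllPairs (λ y z → ¬ y ~ z) xs → x ∈ˡ xs →
               (∀ y → ¬ y ~ x → f y ≈ ε) → ∑ xs f ≈ f x
    ∑-single ~-sym {xs = x ∷ xs} (x≁ ∷ _) (here ≡.refl) f≈ε =
      trans (∙-congˡ (∑-ε xs λ y∈ → f≈ε _ λ y~x → All.lookup x≁ y∈ (~-sym y~x))) (identityʳ _)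
    ∑-single ~-sym {xs = y ∷ xs} (y≁ ∷ ≁) (there x∈) f≈ε =
      trans (∙-congʳ (f≈ε _ (All.lookup y≁ x∈))) (trans (identityˡ _) (∑-single ~-sym ≁ x∈ f≈ε))

    foldr-filter : ∀ {p} {P : A → Set p} (P? : ∀ x → Dec (P x)) f xs →
                   foldr _∙_ ε (map f (filter P? xs)) ≈ ∑ xs (λ x → f x when P? x)
    foldr-filter P? f []       = refl
    foldr-filter P? f (x ∷ xs) with P? x
    ... | yes _ = ∙-congˡ (foldr-filter P? f xs)
    ... | no _  = trans (foldr-filter P? f xs) (sym (identityˡ _))

  ∑-swap : ∀ {a b} {A : Set a} {B : Set b} (f : A → B → C) xs ys →
           ∑ xs (λ x → ∑ ys (f x)) ≈ ∑ ys (λ y → ∑ xs (λ x → f x y))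
  ∑-swap f []       ys = sym (∑-ε ys λ _ → refl)
  ∑-swap f (x ∷ xs) ys = trans (∙-congˡ (∑-swap f xs ys)) (sym (∑-∙ (f x) _ ys))

  module _ {n : ℕ} (f : SetPartition n → C) (f-cong : ∀ A B → A ≈Π B → f A ≈ f B) where
    open SetoidReasoning setoid
    private
      L = partitions n

    ∑-partitions-single : ∀ A → ∑ L (λ B → f B when B ≈Π? A) ≈ f A
    ∑-partitions-single A = begin
      ∑ L (λ B → f B when B ≈Π? A) ≈⟨ ∑-single (λ {B} {C} → ≈Π-sym B C) (partitions-distinct n) A′∈
                                        (λ B B≉A′ → when-no (B ≈Π? A) (B≉A′ ∘ λ B≈A → ≈Π-trans B A A′ B≈A A≈A′)) ⟩
      f A′ when A′ ≈Π? A           ≈⟨ when-yes (A′ ≈Π? A) (≈Π-sym A A′ A≈A′) ⟩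
      f A′                         ≈⟨ f-cong A A′ A≈A′ ⟨
      f A                          ∎
      where
      rep = partitions-complete A
      A′ = proj₁ rep
      A′∈ = proj₁ (proj₂ rep)
      A≈A′ = proj₂ (proj₂ rep)

    ∑-≤-split : ∀ A → ∑ L (λ B → f B when B ≤Π? A) ≈ f A ∙ ∑ L (λ B → f B when B <Π? A)
    ∑-≤-split A = begin
      ∑ L (λ B → f B when B ≤Π? A)                           ≈⟨ ∑-cong L split ⟩
      ∑ L (λ B → (f B when B ≈Π? A) ∙ (f B when B <Π? A))    ≈⟨ ∑-∙ _ _ L ⟩
      ∑ L (λ B → f B when B ≈Π? A) ∙ ∑ L (λ B → f B when B <Π? A) ≈⟨ ∙-congʳ (∑-partitions-single A) ⟩
      f A ∙ ∑ L (λ B → f B when B <Π? A)                     ∎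
      where
      split : ∀ B → (f B when B ≤Π? A) ≈ (f B when B ≈Π? A) ∙ (f B when B <Π? A)
      split B = by (A ≤Π? B)
        where
        by : Dec (A ≤Π B) → (f B when B ≤Π? A) ≈ (f B when B ≈Π? A) ∙ (f B when B <Π? A)
        by (yes A≤B) = sym (trans (∙-congˡ (when-no (B <Π? A) λ (_ , A≰B) → A≰B A≤B)) (trans (identityʳ _)
          (when-⇔ (B ≈Π? A) (B ≤Π? A) (≈Π⇒≤Π B A) (λ B≤A → ≤Π-antisym B A B≤A A≤B) (λ _ → refl))))
        by (no A≰B) = sym (trans (∙-congʳ (when-no (B ≈Π? A) λ B≈A → A≰B (≈Π⇒≤Π A B (≈Π-sym B A B≈A))))
          (trans (identityˡ _) (when-⇔ (B <Π? A) (B ≤Π? A) proj₁ (_, A≰B) (λ _ → refl))))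

module _ {c ℓ} (R : Ring c ℓ) where
  open Ring R using (Carrier; 0#; 1#; -_; -‿cong; +-commutativeMonoid)
    renaming (_≈_ to _≈ᴿ_; _+_ to _⊕_)
  private module R = Ring R
  open Möbius R
  open ListSum +-commutativeMonoid

  private
    module Step {n : ℕ} (B A : SetPartition n) (rs : ∀ {C} → C <Π A → Acc _<Π_ C) (B≉A : ¬ B ≈Π A) where

      unfold : ∃ λ t → μ-acc B A (acc rs) ≡ - foldr _⊕_ 0# (map t (filter (B ≤Π?_) (partitions n)))
      unfold with B ≈Π? A
      ... | yes B≈A = ⊥-elim (B≉A B≈A)
      ... | no _    = _ , ≡.refl

      unfold-< : ∀ C → C <Π A → ∃ λ C<A → proj₁ unfold C ≡ μ-acc B C (rs C<A)
      unfold-< C C<A with B ≈Π? A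
      ... | yes B≈A = ⊥-elim (B≉A B≈A)
      ... | no _ with C <Π? A
      ...   | yes C<A′ = C<A′ , ≡.refl
      ...   | no C≮A   = ⊥-elim (C≮A C<A)

      unfold-≮ : ∀ C → ¬ C <Π A → proj₁ unfold C ≡ 0#
      unfold-≮ C C≮A with B ≈Π? A
      ... | yes B≈A = ⊥-elim (B≉A B≈A)
      ... | no _ with C <Π? A
      ...   | yes C<A = ⊥-elim (C≮A C<A)
      ...   | no _    = ≡.refl

      unfold-∑ : (g : SetPartition n → Carrier) → (∀ C (C<A : C <Π A) → μ-acc B C (rs C<A) ≈ᴿ g C) →
                 μ-acc B A (acc rs) ≈ᴿ - ∑ (partitions n) (λ C → (g C when C <Π? A) when B ≤Π? C)
      unfold-∑ g μ≈g = R.trans (R.reflexive (proj₂ unfold)) (-‿cong (R.trans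
        (foldr-filter (B ≤Π?_) (proj₁ unfold) (partitions n))
        (∑-cong (partitions n) λ C → when-cong (B ≤Π? C) λ _ → step C (C <Π? A))))
        where
        step : ∀ C (d : Dec (C <Π A)) → proj₁ unfold C ≈ᴿ (g C when d)
        step C (yes C<A) = let C<A′ , eq = unfold-< C C<A in R.trans (R.reflexive eq) (μ≈g C C<A′)
        step C (no C≮A)  = R.reflexive (unfold-≮ C C≮A)

  module _ {n : ℕ} where

    μ-acc-≈ : (B A : SetPartition n) (a : Acc _<Π_ A) → B ≈Π A → μ-acc B A a ≈ᴿ 1#
    μ-acc-≈ B A (acc rs) B≈A with B ≈Π? A
    ... | yes _  = R.refl
    ... | no B≉A = ⊥-elim (B≉A B≈A)

    μ-acc-irrelevant : (B A A′ : SetPartition n) → A ≈Π A′ → (a : Acc _<Π_ A) (a′ : Acc _<Π_ A′) →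
                       μ-acc B A a ≈ᴿ μ-acc B A′ a′
    μ-acc-irrelevant B A A′ A≈A′ a@(acc rs) a′@(acc rs′) = by (B ≈Π? A)
      where
      A′≈A = ≈Π-sym A A′ A≈A′
      by : Dec (B ≈Π A) → μ-acc B A a ≈ᴿ μ-acc B A′ a′
      by (yes B≈A) = R.trans (μ-acc-≈ B A a B≈A) (R.sym (μ-acc-≈ B A′ a′ (≈Π-trans B A A′ B≈A A≈A′)))
      by (no B≉A)  = R.trans
        (Step.unfold-∑ B A rs B≉A t λ C C<A → irrelevant C C<A (rs C<A))
        (R.sym (R.trans
          (Step.unfold-∑ B A′ rs′ (λ B≈A′ → B≉A (≈Π-trans B A′ A B≈A′ A′≈A)) t λ C C<A′ →
            irrelevant C (<-resp C A′≈A C<A′) (rs′ C<A′))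
          (-‿cong (∑-cong (partitions n) λ C → when-cong (B ≤Π? C) λ _ →
            when-⇔ (C <Π? A′) (C <Π? A) (<-resp C A′≈A) (<-resp C A≈A′) λ _ → R.refl))))
        where
        t = proj₁ (Step.unfold B A rs B≉A)

        irrelevant : ∀ C → C <Π A → (a″ : Acc _<Π_ C) → μ-acc B C a″ ≈ᴿ t C
        irrelevant C C<A a″ = let C<A₁ , eq = Step.unfold-< B A rs B≉A C C<A in
          R.trans (R.sym (μ-acc-irrelevant B C C (≈Π-refl C) (rs C<A₁) a″)) (R.sym (R.reflexive eq))

        <-resp : ∀ C {A A′} → A ≈Π A′ → C <Π A → C <Π A′
        <-resp C {A} {A′} A≈A′ (C≤A , A≰C) =
          ≤Π-trans C A A′ C≤A (≈Π⇒≤Π A A′ A≈A′) , λ A′≤C → A≰C (≤Π-trans A A′ C (≈Π⇒≤Π A A′ A≈A′) A′≤C)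

    μ-≈ : (B A : SetPartition n) → B ≈Π A → μ B A ≈ᴿ 1#
    μ-≈ B A = μ-acc-≈ B A (<Π-wellFounded A)

    μ-congʳ : (B A A′ : SetPartition n) → A ≈Π A′ → μ B A ≈ᴿ μ B A′
    μ-congʳ B A A′ A≈A′ = μ-acc-irrelevant B A A′ A≈A′ (<Π-wellFounded A) (<Π-wellFounded A′)

    μ-≉ : (B A : SetPartition n) → ¬ B ≈Π A →
          μ B A ≈ᴿ - ∑ (partitions n) (λ C → (μ B C when C <Π? A) when B ≤Π? C)
    μ-≉ B A B≉A = by (<Π-wellFounded A)
      where
      by : (a : Acc _<Π_ A) → μ-acc B A a ≈ᴿ - ∑ (partitions n) (λ C → (μ B C when C <Π? A) when B ≤Π? C)
      by (acc rs) = Step.unfold-∑ B A rs B≉A (μ B) λ C C<A →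
        μ-acc-irrelevant B C C (≈Π-refl C) (rs C<A) (<Π-wellFounded C)

    when-comm : ∀ {p q} {P : Set p} {Q : Set q} {x} (d : Dec P) (d′ : Dec Q) →
                ((x when d) when d′) ≈ᴿ ((x when d′) when d)
    when-comm (yes _) _       = R.refl
    when-comm (no _)  (yes _) = R.refl
    when-comm (no _)  (no _)  = R.refl

    ∑-interval-μ : (B A : SetPartition n) →
      ∑ (partitions n) (λ C → (μ B C when B ≤Π? C) when C ≤Π? A) ≈ᴿ (1# when B ≈Π? A)
    ∑-interval-μ B A = R.trans (∑-≤-split (λ C → μ B C when B ≤Π? C) resp A) (by (B ≤Π? A) (B ≈Π? A))
      where
      L = partitions n

      resp : ∀ C C′ → C ≈Π C′ → (μ B C when B ≤Π? C) ≈ᴿ (μ B C′ when B ≤Π? C′)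
      resp C C′ C≈C′ = when-⇔ (B ≤Π? C) (B ≤Π? C′)
        (λ B≤C → ≤Π-trans B C C′ B≤C (≈Π⇒≤Π C C′ C≈C′))
        (λ B≤C′ → ≤Π-trans B C′ C B≤C′ (≈Π⇒≤Π C′ C (≈Π-sym C C′ C≈C′)))
        (λ _ → μ-congʳ B C C′ C≈C′)

      S = ∑ L (λ C → (μ B C when B ≤Π? C) when C <Π? A)

      S≈0 : ¬ B <Π A → S ≈ᴿ 0#
      S≈0 B≮A = ∑-ε L λ {C} _ → vanish C (B ≤Π? C) (C <Π? A)
        where
        vanish : ∀ C (d : Dec (B ≤Π C)) (d′ : Dec (C <Π A)) → ((μ B C when d) when d′) ≈ᴿ 0#
        vanish C (yes B≤C) (yes (C≤A , A≰C)) =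
          ⊥-elim (B≮A (≤Π-trans B C A B≤C C≤A , λ A≤B → A≰C (≤Π-trans A B C A≤B B≤C)))
        vanish C (no _)    (yes _) = R.refl
        vanish C _         (no _)  = R.refl

      by : (d : Dec (B ≤Π A)) (d′ : Dec (B ≈Π A)) → (μ B A when d) ⊕ S ≈ᴿ (1# when d′)
      by (no B≰A)  (yes B≈A) = ⊥-elim (B≰A (≈Π⇒≤Π B A B≈A))
      by (no B≰A)  (no _)    = R.trans (R.+-identityˡ S) (S≈0 λ (B≤A , _) → B≰A B≤A)
      by (yes B≤A) (yes B≈A) = R.trans (R.+-cong (μ-≈ B A B≈A)
        (S≈0 λ (_ , A≰B) → A≰B (≈Π⇒≤Π A B (≈Π-sym B A B≈A)))) (R.+-identityʳ 1#)
      by (yes B≤A) (no B≉A)  = R.trans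
        (R.+-congʳ (R.trans (μ-≉ B A B≉A) (-‿cong (∑-cong L λ C → when-comm (C <Π? A) (B ≤Π? C)))))
        (R.-‿inverseˡ S)

module _ {c ℓ} (K : Field c ℓ) where
  private
    module K = Field K
  open LinearAlgebra K.commutativeRing
  open Grothendieck K

  module _ {n : ℕ} where
    private
      module R = Ring (𝕜Π n)
      module Σᴷ = ListSum K.+-commutativeMonoid
      L = partitions n
      open Möbius K.ring
    open FormalSum (FreeRelation (Monoid.setoid (Π-monoid n))) using (rel; _≋_)
    open ListSum R.+-commutativeMonoid
    open SetoidReasoning R.setoid

    private
      map-filter : ∀ {a p} {X : Set a} {P : X → Set p} (P? : ∀ x → Dec (P x)) (g : X → K.Carrier × SetPartition n) xs →
                   map g (filter P? xs) ≋ ∑ xs (λ x → [ g x ] when P? x)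
      map-filter P? g []       = R.refl
      map-filter P? g (x ∷ xs) with P? x
      ... | yes _ = R.+-congˡ {[ g x ]} (map-filter P? g xs)
      ... | no _  = map-filter P? g xs

    e-∑ : (A : SetPartition n) → e A ≋ ∑ L (λ B → [ μ B A , B ] when B ≤Π? A)
    e-∑ A = map-filter (_≤Π? A) (λ B → μ B A , B) L

    e-cong : (A A′ : SetPartition n) → A ≈Π A′ → e A ≋ e A′
    e-cong A A′ A≈A′ = begin
      e A                                     ≈⟨ e-∑ A ⟩
      ∑ L (λ B → [ μ B A , B ] when B ≤Π? A)  ≈⟨ ∑-cong L (λ B → when-⇔ (B ≤Π? A) (B ≤Π? A′)
                                                   (λ B≤A → ≤Π-trans B A A′ B≤A (≈Π⇒≤Π A A′ A≈A′))
                                                   (λ B≤A′ → ≤Π-trans B A′ A B≤A′ (≈Π⇒≤Π A′ A (≈Π-sym A A′ A≈A′)))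
                                                   (λ _ → rel (cong (μ-congʳ K.ring B A A′ A≈A′) (≈Π-refl B)))) ⟩
      ∑ L (λ B → [ μ B A′ , B ] when B ≤Π? A′) ≈⟨ e-∑ A′ ⟨
      e A′                                    ∎

    private
      [when] : ∀ {p} {P : Set p} k (B : SetPartition n) (d : Dec P) → ([ k , B ] when d) ≋ [ (k Σᴷ.when d) , B ]
      [when] k B (yes _) = R.refl
      [when] k B (no _)  = R.sym (rel (zero B))

      ∑-[] : ∀ {a} {X : Set a} (f : X → K.Carrier) (B : SetPartition n) xs → ∑ xs (λ x → [ f x , B ]) ≋ [ Σᴷ.∑ xs f , B ]
      ∑-[] f B []       = R.sym (rel (zero B))
      ∑-[] f B (x ∷ xs) = R.trans (R.+-congˡ {[ f x , B ]} (∑-[] f B xs)) (R.sym (rel (add (f x) _ B)))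

    basis-∑-e : (X : SetPartition n) → ⟨ X ⟩ ≋ ∑ L (λ A → e A when A ≤Π? X)
    basis-∑-e X = R.sym (begin
      ∑ L (λ A → e A when A ≤Π? X)
        ≈⟨ ∑-cong L (λ A → R.trans (when-cong (A ≤Π? X) (λ _ → e-∑ A)) (∑-when _ L (A ≤Π? X))) ⟩
      ∑ L (λ A → ∑ L (λ B → ([ μ B A , B ] when B ≤Π? A) when A ≤Π? X))
        ≈⟨ ∑-swap _ L L ⟩
      ∑ L (λ B → ∑ L (λ A → ([ μ B A , B ] when B ≤Π? A) when A ≤Π? X))
        ≈⟨ ∑-cong L (λ B → R.trans (∑-cong L λ A → R.trans (when-cong (A ≤Π? X) (λ _ → [when] (μ B A) B (B ≤Π? A)))
                                                         ([when] _ B (A ≤Π? X)))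
                                   (∑-[] _ B L)) ⟩
      ∑ L (λ B → [ Σᴷ.∑ L (λ A → (μ B A Σᴷ.when B ≤Π? A) Σᴷ.when A ≤Π? X) , B ])
        ≈⟨ ∑-cong L (λ B → rel (cong (∑-interval-μ K.ring B X) (≈Π-refl B))) ⟩
      ∑ L (λ B → [ (K.1# Σᴷ.when B ≈Π? X) , B ])
        ≈⟨ ∑-cong L (λ B → [when] K.1# B (B ≈Π? X)) ⟨
      ∑ L (λ B → ⟨ B ⟩ when B ≈Π? X)
        ≈⟨ ∑-partitions-single (λ B → ⟨ B ⟩) (λ A B A≈B → rel (cong K.refl A≈B)) X ⟩
      ⟨ X ⟩ ∎)

    private
      ∑-distribˡ : ∀ {a} {X : Set a} r (f : X → R.Carrier) xs → (r R.* ∑ xs f) ≋ ∑ xs (λ x → r R.* f x)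
      ∑-distribˡ r f []       = R.zeroʳ r
      ∑-distribˡ r f (x ∷ xs) = R.trans (R.distribˡ r (f x) (∑ xs f)) (R.+-congˡ {r R.* f x} (∑-distribˡ r f xs))

    -- By induction on A, using the expansion of C ∧ A and that of A into idempotents.
    basis-*-e : (C A : SetPartition n) → (⟨ C ⟩ R.* e A) ≋ (e A when A ≤Π? C)
    basis-*-e C A = go A (<Π-wellFounded A)
      where
      ≤C : SetPartition n → R.Carrier
      ≤C Y = e Y when Y ≤Π? C

      ≤C-cong : ∀ Y Y′ → Y ≈Π Y′ → ≤C Y ≋ ≤C Y′
      ≤C-cong Y Y′ Y≈Y′ = when-⇔ (Y ≤Π? C) (Y′ ≤Π? C)
        (≤Π-trans Y′ Y C (≈Π⇒≤Π Y′ Y (≈Π-sym Y Y′ Y≈Y′))) (≤Π-trans Y Y′ C (≈Π⇒≤Π Y Y′ Y≈Y′))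
        (λ _ → e-cong Y Y′ Y≈Y′)

      when-∧ : ∀ A Y → (e Y when Y ≤Π? (C ∧Π A)) ≋ (≤C Y when Y ≤Π? A)
      when-∧ A Y = by (Y ≤Π? A)
        where
        by : (d : Dec (Y ≤Π A)) → (e Y when Y ≤Π? (C ∧Π A)) ≋ (≤C Y when d)
        by (yes Y≤A) = when-⇔ (Y ≤Π? (C ∧Π A)) (Y ≤Π? C)
          (λ Y≤ → ≤Π-trans Y (C ∧Π A) C Y≤ (proj₁ (∧Π-infimum C A)))
          (λ Y≤C → proj₂ (proj₂ (∧Π-infimum C A)) Y Y≤C Y≤A) (λ _ → R.refl)
        by (no Y≰A) = when-no (Y ≤Π? (C ∧Π A)) λ Y≤ → Y≰A (≤Π-trans Y (C ∧Π A) A Y≤ (proj₁ (proj₂ (∧Π-infimum C A))))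

      γ = ⟨ C ⟩

      go : ∀ A → Acc _<Π_ A → (γ R.* e A) ≋ ≤C A
      go A (acc rs) = GroupProperties.∙-cancelʳ R.+-group T (γ R.* e A) (≤C A) (begin
        (γ R.* e A) R.+ T
          ≈⟨ R.+-congˡ {γ R.* e A} (∑-cong L λ Y → below Y (Y <Π? A)) ⟨
        (γ R.* e A) R.+ ∑ L (λ Y → γ R.* (e Y when Y <Π? A))
          ≈⟨ R.+-congˡ {γ R.* e A} (∑-distribˡ γ _ L) ⟨
        (γ R.* e A) R.+ (γ R.* ∑ L (λ Y → e Y when Y <Π? A))
          ≈⟨ R.distribˡ γ (e A) (∑ L (λ Y → e Y when Y <Π? A)) ⟨
        γ R.* (e A R.+ ∑ L (λ Y → e Y when Y <Π? A))
          ≈⟨ R.*-congˡ {γ} (∑-≤-split e e-cong A) ⟨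
        γ R.* ∑ L (λ Y → e Y when Y ≤Π? A)
          ≈⟨ R.*-congˡ {γ} (basis-∑-e A) ⟨
        γ R.* (⟨ A ⟩)
          ≈⟨ rel (cong (K.*-identityˡ K.1#) (≈Π-refl (C ∧Π A))) ⟩
        (⟨ C ∧Π A ⟩)
          ≈⟨ basis-∑-e (C ∧Π A) ⟩
        ∑ L (λ Y → e Y when Y ≤Π? (C ∧Π A))
          ≈⟨ ∑-cong L (when-∧ A) ⟩
        ∑ L (λ Y → ≤C Y when Y ≤Π? A)
          ≈⟨ ∑-≤-split ≤C ≤C-cong A ⟩
        ≤C A R.+ T ∎)
        where
        T = ∑ L (λ Y → ≤C Y when Y <Π? A)

        below : ∀ Y (d : Dec (Y <Π A)) → (γ R.* (e Y when d)) ≋ (≤C Y when d)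
        below Y (yes Y<A) = go Y (rs Y<A)
        below Y (no _)    = R.zeroʳ γ

-- Linear maps out of free modules and tensor products

module _ {a b m ℓm n ℓn} {R : Ring a b} (V : LeftModule R m ℓm) (W : LeftModule R n ℓn) where
  private
    module V = LeftModule V
    module W = LeftModule W

  IsLinear : (V.Carrierᴹ → W.Carrierᴹ) → Set (a ⊔ m ⊔ ℓm ⊔ ℓn)
  IsLinear = IsLeftModuleHomomorphism V.rawLeftModule W.rawLeftModule

  mkLinear : ∀ {f} → (∀ {x y} → x V.≈ᴹ y → f x W.≈ᴹ f y) → (∀ x y → f (x V.+ᴹ y) W.≈ᴹ f x W.+ᴹ f y) →
             (∀ r x → f (r V.*ₗ x) W.≈ᴹ r W.*ₗ f x) → IsLinear f
  mkLinear {f} f-cong f-+ f-* = record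
    { +ᴹ-isGroupHomomorphism = record
      { isMonoidHomomorphism = record
        { isMagmaHomomorphism = record { isRelHomomorphism = record { cong = f-cong } ; homo = f-+ }
        ; ε-homo              = f-0
        }
      ; ⁻¹-homo = λ x → LeftModuleProperties.inverseˡ-uniqueᴹ W _ _
          (W.≈ᴹ-trans (W.≈ᴹ-sym (f-+ _ x)) (W.≈ᴹ-trans (f-cong (V.-ᴹ‿inverseˡ x)) f-0))
      }
    ; *ₗ-homo = f-*
    }
    where
    f-0 : f V.0ᴹ W.≈ᴹ W.0ᴹ
    f-0 = W.≈ᴹ-trans (f-cong (V.≈ᴹ-sym (V.*ₗ-zeroˡ V.0ᴹ))) (W.≈ᴹ-trans (f-* _ V.0ᴹ) (W.*ₗ-zeroˡ _))

module _ {a b m ℓm n ℓn o ℓo} {R : Ring a b} {U : LeftModule R m ℓm} {V : LeftModule R n ℓn} {W : LeftModule R o ℓo} where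
  private module W = LeftModule W
  open IsLeftModuleHomomorphism

  ∘-linear : ∀ {f g} → IsLinear V W g → IsLinear U V f → IsLinear U W (g ∘ f)
  ∘-linear g-lin f-lin = mkLinear U W (λ p → ⟦⟧-cong g-lin (⟦⟧-cong f-lin p))
    (λ x y → W.≈ᴹ-trans (⟦⟧-cong g-lin (+ᴹ-homo f-lin x y)) (+ᴹ-homo g-lin _ _))
    (λ r x → W.≈ᴹ-trans (⟦⟧-cong g-lin (*ₗ-homo f-lin r x)) (*ₗ-homo g-lin r _))

module AdditiveExtension {x c ℓ} {X : Set x} (M : CommutativeMonoid c ℓ) where
  open CommutativeMonoid M renaming (Carrier to C)
  open CommutativeSemigroupProperties commutativeSemigroup using (interchange)

  rec : (X → C) → List X → C
  rec g = foldr (λ x u → g x ∙ u) ε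

  rec-++ : ∀ (g : X → C) xs ys → rec g (xs ++ ys) ≈ rec g xs ∙ rec g ys
  rec-++ g []       ys = sym (identityˡ _)
  rec-++ g (x ∷ xs) ys = trans (∙-congˡ (rec-++ g xs ys)) (sym (assoc _ _ _))

  rec-cong : ∀ {g h : X → C} → (∀ x → g x ≈ h x) → ∀ xs → rec g xs ≈ rec h xs
  rec-cong g≈h []       = refl
  rec-cong g≈h (x ∷ xs) = ∙-cong (g≈h x) (rec-cong g≈h xs)

  rec-∙ : ∀ (g h : X → C) xs → rec (λ x → g x ∙ h x) xs ≈ rec g xs ∙ rec h xs
  rec-∙ g h []       = sym (identityˡ ε)
  rec-∙ g h (x ∷ xs) = trans (∙-congˡ (rec-∙ g h xs)) (interchange (g x) (h x) _ _)

  rec-resp : ∀ {r} {_⟶_ : Rel (List X) r} (g : X → C) → (∀ {xs ys} → xs ⟶ ys → rec g xs ≈ rec g ys) →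
             ∀ {xs ys} → FormalSum._≋_ _⟶_ xs ys → rec g xs ≈ rec g ys
  rec-resp {_⟶_ = _⟶_} g g-resp = go
    where
    open FormalSum _⟶_ using (_≋_; rel; ++-cong; ++-comm)
    go : ∀ {xs ys} → xs ≋ ys → rec g xs ≈ rec g ys
    go (rel p)             = g-resp p
    go FormalSum.refl      = refl
    go (FormalSum.sym p)   = sym (go p)
    go (FormalSum.trans p q) = trans (go p) (go q)
    go (++-cong {xs} {xs′} {ys} {ys′} p q) =
      trans (rec-++ g xs ys) (trans (∙-cong (go p) (go q)) (sym (rec-++ g xs′ ys′)))
    go (++-comm xs ys)     = trans (rec-++ g xs ys) (trans (comm _ _) (sym (rec-++ g ys xs)))

module Linear {c ℓ} (K : CommutativeRing c ℓ) where
  private module K = CommutativeRing K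
  open LinearAlgebra K
  open K using () renaming (Carrier to 𝕜)
  open IsLeftModuleHomomorphism

  𝕜¹ : VectorSpace c ℓ
  𝕜¹ = TensorUnit.leftModule {R = K.ring}

  module _ {b ℓb u ℓu} {B : Setoid b ℓb} (U : VectorSpace u ℓu) where
    private
      module B = Setoid B
      module U = LeftModule U
      module F = LeftModule (Free B)
    open AdditiveExtension {X = 𝕜 × B.Carrier} U.+ᴹ-commutativeMonoid

    Free-rec : (B.Carrier → U.Carrierᴹ) → F.Carrierᴹ → U.Carrierᴹ
    Free-rec f = rec (λ (k , x) → k U.*ₗ f x)

    Free-rec-⟨⟩ : ∀ f x → Free-rec f ⟨ x ⟩ U.≈ᴹ f x
    Free-rec-⟨⟩ f x = U.≈ᴹ-trans (U.+ᴹ-identityʳ _) (U.*ₗ-identityˡ (f x))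

    Free-rec-linear : ∀ {f} → (∀ {x y} → x B.≈ y → f x U.≈ᴹ f y) → IsLinear (Free B) U (Free-rec f)
    Free-rec-linear {f} f-cong = mkLinear (Free B) U (rec-resp _ λ
      { (cong k≈l x≈y) → U.+ᴹ-congʳ (U.*ₗ-cong k≈l (f-cong x≈y))
      ; (add k l x)    → U.≈ᴹ-trans (U.+ᴹ-congʳ (U.*ₗ-distribʳ (f x) k l)) (U.+ᴹ-assoc _ _ _)
      ; (zero x)       → U.≈ᴹ-trans (U.+ᴹ-congʳ (U.*ₗ-zeroˡ (f x))) (U.+ᴹ-identityˡ _)
      }) (rec-++ _) scale
      where
      scale : ∀ k xs → Free-rec f (k F.*ₗ xs) U.≈ᴹ k U.*ₗ Free-rec f xs
      scale k []             = U.≈ᴹ-sym (U.*ₗ-zeroʳ k)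
      scale k ((l , x) ∷ xs) = U.≈ᴹ-trans (U.+ᴹ-cong (U.*ₗ-assoc k l (f x)) (scale k xs))
                                          (U.≈ᴹ-sym (U.*ₗ-distribˡ k _ _))

    Free-ext : ∀ {f g} → IsLinear (Free B) U f → IsLinear (Free B) U g →
               (∀ x → f ⟨ x ⟩ U.≈ᴹ g ⟨ x ⟩) → ∀ xs → f xs U.≈ᴹ g xs
    Free-ext f-lin g-lin f≈g [] = U.≈ᴹ-trans (0ᴹ-homo f-lin) (U.≈ᴹ-sym (0ᴹ-homo g-lin))
    Free-ext {f} {g} f-lin g-lin f≈g ((k , x) ∷ xs) = begin
      f ([ k , x ] F.+ᴹ xs)         ≈⟨ +ᴹ-homo f-lin [ k , x ] xs ⟩
      f [ k , x ] U.+ᴹ f xs         ≈⟨ U.+ᴹ-cong head (Free-ext f-lin g-lin f≈g xs) ⟩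
      g [ k , x ] U.+ᴹ g xs         ≈⟨ +ᴹ-homo g-lin [ k , x ] xs ⟨
      g ([ k , x ] F.+ᴹ xs)         ∎
      where
      open SetoidReasoning U.≈ᴹ-setoid
      scaled : [ k , x ] F.≈ᴹ k F.*ₗ ⟨ x ⟩
      scaled = FormalSum.rel (cong (K.sym (K.*-identityʳ k)) B.refl)
      head : f [ k , x ] U.≈ᴹ g [ k , x ]
      head = begin
        f [ k , x ]          ≈⟨ ⟦⟧-cong f-lin scaled ⟩
        f (k F.*ₗ ⟨ x ⟩)     ≈⟨ *ₗ-homo f-lin k ⟨ x ⟩ ⟩
        k U.*ₗ f (⟨ x ⟩)     ≈⟨ U.*ₗ-congˡ (f≈g x) ⟩
        k U.*ₗ g (⟨ x ⟩)     ≈⟨ *ₗ-homo g-lin k ⟨ x ⟩ ⟨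
        g (k F.*ₗ (⟨ x ⟩))   ≈⟨ ⟦⟧-cong g-lin scaled ⟨
        g [ k , x ]          ∎

  module _ {v ℓv w ℓw u ℓu} {V : VectorSpace v ℓv} {W : VectorSpace w ℓw} (U : VectorSpace u ℓu) where
    private
      module V = LeftModule V
      module W = LeftModule W
      module U = LeftModule U
      module V⊗W = LeftModule (V ⊗ W)
    open AdditiveExtension {X = V.Carrierᴹ × W.Carrierᴹ} U.+ᴹ-commutativeMonoid

    ⊗-rec-⊗ₑ : ∀ (β : V.Carrierᴹ → W.Carrierᴹ → U.Carrierᴹ) x y → ⊗-rec U β (x ⊗ₑ y) U.≈ᴹ β x y
    ⊗-rec-⊗ₑ β x y = U.+ᴹ-identityʳ (β x y)

    ⊗-rec-linear : ∀ {β} → IsBilinear V W U β → IsLinear (V ⊗ W) U (⊗-rec U β)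
    ⊗-rec-linear {β} bilinear = mkLinear (V ⊗ W) U (rec-resp _ λ
      { (cong v≈v′ w≈w′)  → U.+ᴹ-congʳ (U.≈ᴹ-trans (⟦⟧-cong (homoˡ _) v≈v′) (⟦⟧-cong (homoʳ _) w≈w′))
      ; (addˡ v v′ w)     → U.≈ᴹ-trans (U.+ᴹ-congʳ (+ᴹ-homo (homoˡ w) v v′)) (U.+ᴹ-assoc _ _ _)
      ; (addʳ v w w′)     → U.≈ᴹ-trans (U.+ᴹ-congʳ (+ᴹ-homo (homoʳ v) w w′)) (U.+ᴹ-assoc _ _ _)
      ; (scalar k v w)    → U.+ᴹ-congʳ (U.≈ᴹ-trans (*ₗ-homo (homoˡ w) k v) (U.≈ᴹ-sym (*ₗ-homo (homoʳ v) k w)))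
      ; (zeroˡ′ w)        → U.≈ᴹ-trans (U.+ᴹ-congʳ (0ᴹ-homo (homoˡ w))) (U.+ᴹ-identityˡ _)
      }) (rec-++ _) scale
      where
      open IsBilinear bilinear
      scale : ∀ k xs → ⊗-rec U β (k V⊗W.*ₗ xs) U.≈ᴹ k U.*ₗ ⊗-rec U β xs
      scale k []             = U.≈ᴹ-sym (U.*ₗ-zeroʳ k)
      scale k ((v , w) ∷ xs) = U.≈ᴹ-trans (U.+ᴹ-cong (*ₗ-homo (homoˡ w) k v) (scale k xs))
                                          (U.≈ᴹ-sym (U.*ₗ-distribˡ k _ _))

  module _ {v ℓv w ℓw} {V : VectorSpace v ℓv} {W : VectorSpace w ℓw} where
    private
      module V = LeftModule V
      module W = LeftModule W
    open FormalSum (TensorRelation V W)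

    ⊗ₑ-bilinear : IsBilinear V W (V ⊗ W) _⊗ₑ_
    ⊗ₑ-bilinear = record
      { homoˡ = λ w → mkLinear V (V ⊗ W) (λ p → rel (cong p W.≈ᴹ-refl)) (λ v v′ → rel (addˡ v v′ w)) (λ _ _ → refl)
      ; homoʳ = λ v → mkLinear W (V ⊗ W) (λ p → rel (cong V.≈ᴹ-refl p)) (λ w w′ → rel (addʳ v w w′))
                        (λ k w → sym (rel (scalar k v w)))
      }

-- Exact sequences

module _ {a b m ℓm} {R : Ring a b} {U V W : LeftModule R m ℓm} where
  private
    module U = LeftModule U
    module V = LeftModule V
    module W = LeftModule W
  open IsLeftModuleHomomorphism

  -- HasClass is transported along an isomorphism V ≅ W by viewing it as an exact sequence 0 → V → W.
  iso⇒exact : (∀ u → u U.≈ᴹ U.0ᴹ) → ∀ {g} → IsLinear V W g →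
              (∀ {x y} → g x W.≈ᴹ g y → x V.≈ᴹ y) → (∀ w → ∃ λ v → g v W.≈ᴹ w) → ShortExact U V W
  iso⇒exact U≈0 {g} g-lin g-inj g-surj = record
    { f      = λ _ → V.0ᴹ
    ; g      = g
    ; f-mono = record
      { isLeftModuleHomomorphism = mkLinear U V (λ _ → V.≈ᴹ-refl) (λ _ _ → V.≈ᴹ-sym (V.+ᴹ-identityˡ V.0ᴹ))
                                                (λ r _ → V.≈ᴹ-sym (V.*ₗ-zeroʳ r))
      ; injective = λ _ → U.≈ᴹ-trans (U≈0 _) (U.≈ᴹ-sym (U≈0 _))
      }
    ; g-homo = g-lin
    ; g-surj = λ w → let v , gv≈w = g-surj w in v , λ z≈v → W.≈ᴹ-trans (⟦⟧-cong g-lin z≈v) gv≈w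
    ; exact  = λ v → mk⇔
        (λ gv≈0 → U.0ᴹ , V.≈ᴹ-sym (g-inj (W.≈ᴹ-trans gv≈0 (W.≈ᴹ-sym (0ᴹ-homo g-lin)))))
        (λ (_ , 0≈v) → W.≈ᴹ-trans (⟦⟧-cong g-lin (V.≈ᴹ-sym 0≈v)) (0ᴹ-homo g-lin))
    }

module _ {a b c ℓ m ℓm} {R : Ring a b} {S : Ring c ℓ} {φ : Ring.Carrier R → Ring.Carrier S}
         (φ-homo : IsRingWithoutOneHomomorphism (Ring.rawRingWithoutOne R) (Ring.rawRingWithoutOne S) φ)
         {U V W : LeftModule S m ℓm} where
  private
    module U = LeftModule U
    module V = LeftModule V
    module W = LeftModule W
    module R = Ring R
    module S = Ring S
    open IsRingWithoutOneHomomorphism φ-homo using (*-homo) renaming (⟦⟧-cong to φ-cong)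
    e = φ R.1#

    idem : S._≈_ (e S.* e) e
    idem = S.trans (S.sym (*-homo R.1# R.1#)) (φ-cong (R.*-identityˡ R.1#))

  -- Surjectivity survives restriction because a preimage v may be replaced by φ(1)v.
  Res-exact : ShortExact U V W → ShortExact (Res {R = R} {S} φ-homo U) (Res {R = R} {S} φ-homo V) (Res {R = R} {S} φ-homo W)
  Res-exact se = record
    { f      = λ (u , eu) → f u , V.≈ᴹ-trans (V.≈ᴹ-sym (f.*ₗ-homo e u)) (f.⟦⟧-cong eu)
    ; g      = λ (v , ev) → g v , W.≈ᴹ-trans (W.≈ᴹ-sym (g.*ₗ-homo e v)) (g.⟦⟧-cong ev)
    ; f-mono = record
      { isLeftModuleHomomorphism = mkLinear (Res {R = R} {S} φ-homo U) (Res {R = R} {S} φ-homo V)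
          (λ p → f.⟦⟧-cong p) (λ _ _ → f.+ᴹ-homo _ _) (λ _ _ → f.*ₗ-homo _ _)
      ; injective = f.injective
      }
    ; g-homo = mkLinear (Res {R = R} {S} φ-homo V) (Res {R = R} {S} φ-homo W) (λ p → g.⟦⟧-cong p) (λ _ _ → g.+ᴹ-homo _ _) (λ _ _ → g.*ₗ-homo _ _)
    ; g-surj = λ (w , ew) → let v , gv≈w = g-surj w in
        (e V.*ₗ v , V.≈ᴹ-trans (V.≈ᴹ-sym (V.*ₗ-assoc e e v)) (V.*ₗ-congʳ idem)) ,
        λ z≈ev → W.≈ᴹ-trans (g.⟦⟧-cong z≈ev) (W.≈ᴹ-trans (g.*ₗ-homo e v)
                 (W.≈ᴹ-trans (W.*ₗ-congˡ (gv≈w V.≈ᴹ-refl)) ew))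
    ; exact  = λ (v , ev) → mk⇔
        (λ gv≈0 → let u , fu≈v = Equivalence.to (exact v) gv≈0 in
          (u , f.injective (V.≈ᴹ-trans (f.*ₗ-homo e u) (V.≈ᴹ-trans (V.*ₗ-congˡ fu≈v)
                           (V.≈ᴹ-trans ev (V.≈ᴹ-sym fu≈v))))) , fu≈v)
        (λ ((u , _) , fu≈v) → Equivalence.from (exact v) (u , fu≈v))
    }
    where
    open ShortExact se
    module f = IsLeftModuleMonomorphism f-mono
    module g = IsLeftModuleHomomorphism g-homo

module Splitting {c ℓ} (K : CommutativeRing c ℓ) where
  private module K = CommutativeRing K
  open LinearAlgebra K
  open Linear K
  open K using () renaming (Carrier to 𝕜)
  open IsLeftModuleHomomorphism

  -- A dual basis of W splits every exact sequence ending in W.  Unlike the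
  -- choice of a basis, this needs no decidable equality on the base.
  record DualBasis {m ℓm} (V : VectorSpace m ℓm) : Set (c ⊔ ℓ ⊔ m ⊔ ℓm) where
    open LeftModule V
    open AdditiveExtension {X = Σ Carrierᴹ λ _ → ∃ (IsLinear V 𝕜¹)} +ᴹ-commutativeMonoid
    field
      elements : List (Σ Carrierᴹ λ _ → ∃ (IsLinear V 𝕜¹))
      expand   : ∀ v → v ≈ᴹ rec (λ (b , φ , _) → φ v *ₗ b) elements

  module _ {m ℓm} {U V W : VectorSpace m ℓm} (se : ShortExact U V W) (dualBasis : DualBasis W) where
    private
      module U = LeftModule U
      module V = LeftModule V
      module W = LeftModule W
      open ShortExact se
      module f = IsLeftModuleMonomorphism f-mono
      module g = IsLeftModuleHomomorphism g-homo
      open DualBasis dualBasis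

      lift : W.Carrierᴹ → V.Carrierᴹ
      lift w = proj₁ (g-surj w)

      module RecV {X : Set (c ⊔ ℓ ⊔ m ⊔ ℓm)} = AdditiveExtension {X = X} V.+ᴹ-commutativeMonoid

    section : W.Carrierᴹ → V.Carrierᴹ
    section w = RecV.rec (λ (b , φ , _) → φ w V.*ₗ lift b) elements

    section-linear : IsLinear W V section
    section-linear = mkLinear W V
      (λ p → RecV.rec-cong (λ (b , φ , lin) → V.*ₗ-congʳ (⟦⟧-cong lin p)) elements)
      (λ x y → V.≈ᴹ-trans (RecV.rec-cong (λ (b , φ , lin) →
          V.≈ᴹ-trans (V.*ₗ-congʳ (+ᴹ-homo lin x y)) (V.*ₗ-distribʳ (lift b) _ _)) elements)
        (RecV.rec-∙ _ _ elements))
      (λ k x → scale k x elements)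
      where
      scale : ∀ k x bs → RecV.rec (λ (b , φ , _) → φ (k W.*ₗ x) V.*ₗ lift b) bs V.≈ᴹ
                         k V.*ₗ RecV.rec (λ (b , φ , _) → φ x V.*ₗ lift b) bs
      scale k x []                   = V.≈ᴹ-sym (V.*ₗ-zeroʳ k)
      scale k x ((b , φ , lin) ∷ bs) = V.≈ᴹ-trans
        (V.+ᴹ-cong (V.≈ᴹ-trans (V.*ₗ-congʳ (*ₗ-homo lin k x)) (V.*ₗ-assoc k (φ x) (lift b))) (scale k x bs))
        (V.≈ᴹ-sym (V.*ₗ-distribˡ k _ _))

    section-inverse : ∀ w → g (section w) W.≈ᴹ w
    section-inverse w = W.≈ᴹ-trans (go elements) (W.≈ᴹ-sym (expand w))
      where
      go : ∀ bs → g (RecV.rec (λ (b , φ , _) → φ w V.*ₗ lift b) bs) W.≈ᴹ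
                  AdditiveExtension.rec W.+ᴹ-commutativeMonoid (λ (b , φ , _) → φ w W.*ₗ b) bs
      go []                 = g.0ᴹ-homo
      go ((b , φ , _) ∷ bs) = W.≈ᴹ-trans (g.+ᴹ-homo _ _)
        (W.+ᴹ-cong (W.≈ᴹ-trans (g.*ₗ-homo _ _) (W.*ₗ-congˡ (proj₂ (g-surj b) V.≈ᴹ-refl))) (go bs))

    private
      remainder : ∀ v → ∃ λ u → f u V.≈ᴹ v V.+ᴹ V.-ᴹ section (g v)
      remainder v = Equivalence.to (exact _) (W.≈ᴹ-trans (g.+ᴹ-homo _ _)
        (W.≈ᴹ-trans (W.+ᴹ-congˡ (W.≈ᴹ-trans (g.-ᴹ-homo _) (W.-ᴹ‿cong (section-inverse (g v)))))
                    (W.-ᴹ‿inverseʳ (g v))))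

    retraction : V.Carrierᴹ → U.Carrierᴹ
    retraction v = proj₁ (remainder v)

    split : ∀ v → v V.≈ᴹ f (retraction v) V.+ᴹ section (g v)
    split v = V.≈ᴹ-sym (V.≈ᴹ-trans (V.+ᴹ-congʳ (proj₂ (remainder v))) (V.≈ᴹ-trans (V.+ᴹ-assoc _ _ _)
      (V.≈ᴹ-trans (V.+ᴹ-congˡ (V.-ᴹ‿inverseˡ _)) (V.+ᴹ-identityʳ v))))

    private
      split-unique : ∀ {v u} → f u V.+ᴹ section (g v) V.≈ᴹ v → retraction v U.≈ᴹ u
      split-unique {v} {u} p = f.injective (GroupProperties.∙-cancelʳ V.+ᴹ-group (section (g v)) _ _
        (V.≈ᴹ-trans (V.≈ᴹ-sym (split v)) (V.≈ᴹ-sym p)))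

      sec = section-linear

    retraction-linear : IsLinear V U retraction
    retraction-linear = mkLinear V U
      (λ {x} {y} p → split-unique (V.≈ᴹ-trans (V.+ᴹ-congˡ (⟦⟧-cong sec (g.⟦⟧-cong p)))
                                  (V.≈ᴹ-trans (V.≈ᴹ-sym (split y)) (V.≈ᴹ-sym p))))
      (λ x y → split-unique (V.≈ᴹ-trans
        (V.+ᴹ-cong (f.+ᴹ-homo _ _) (V.≈ᴹ-trans (⟦⟧-cong sec (g.+ᴹ-homo x y)) (+ᴹ-homo sec (g x) (g y))))
        (V.≈ᴹ-trans (interchange _ _ _ _) (V.+ᴹ-cong (V.≈ᴹ-sym (split x)) (V.≈ᴹ-sym (split y))))))
      (λ k x → split-unique (V.≈ᴹ-trans
        (V.+ᴹ-cong (f.*ₗ-homo _ _) (V.≈ᴹ-trans (⟦⟧-cong sec (g.*ₗ-homo k x)) (*ₗ-homo sec k (g x))))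
        (V.≈ᴹ-trans (V.≈ᴹ-sym (V.*ₗ-distribˡ k _ _)) (V.*ₗ-congˡ (V.≈ᴹ-sym (split x))))))
      where
      open CommutativeSemigroupProperties
        (CommutativeMonoid.commutativeSemigroup V.+ᴹ-commutativeMonoid) using (interchange)

    retraction-inverse : ∀ u → retraction (f u) U.≈ᴹ u
    retraction-inverse u = split-unique (V.≈ᴹ-trans
      (V.+ᴹ-congˡ (V.≈ᴹ-trans (⟦⟧-cong sec (Equivalence.from (exact (f u)) (u , V.≈ᴹ-refl))) (0ᴹ-homo sec)))
      (V.+ᴹ-identityʳ _))

    extension-dualBasis : DualBasis U → DualBasis V
    extension-dualBasis dualBasisᵁ = record
      { elements = map liftᵂ elements ++ map liftᵁ (DualBasis.elements dualBasisᵁ)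
      ; expand   = λ v → V.≈ᴹ-sym (V.≈ᴹ-trans (RecV.rec-++ (coeff v) (map liftᵂ elements) _) (V.≈ᴹ-trans
          (V.+ᴹ-cong (onᵂ v elements) (onᵁ v (DualBasis.elements dualBasisᵁ)))
          (V.≈ᴹ-trans (V.+ᴹ-congˡ (f.⟦⟧-cong (U.≈ᴹ-sym (DualBasis.expand dualBasisᵁ (retraction v)))))
          (V.≈ᴹ-trans (V.+ᴹ-comm _ _) (V.≈ᴹ-sym (split v))))))
      }
      where
      liftᵂ : (Σ W.Carrierᴹ λ _ → ∃ (IsLinear W 𝕜¹)) → Σ V.Carrierᴹ λ _ → ∃ (IsLinear V 𝕜¹)
      liftᵂ (b , φ , lin) = lift b , φ ∘ g , ∘-linear {U = V} {V = W} {W = 𝕜¹} lin g-homo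

      liftᵁ : (Σ U.Carrierᴹ λ _ → ∃ (IsLinear U 𝕜¹)) → Σ V.Carrierᴹ λ _ → ∃ (IsLinear V 𝕜¹)
      liftᵁ (b , φ , lin) = f b , φ ∘ retraction , ∘-linear {U = V} {V = U} {W = 𝕜¹} lin retraction-linear

      coeff : V.Carrierᴹ → (Σ V.Carrierᴹ λ _ → ∃ (IsLinear V 𝕜¹)) → V.Carrierᴹ
      coeff v (b , φ , _) = φ v V.*ₗ b

      onᵂ : ∀ v bs → RecV.rec (coeff v) (map liftᵂ bs) V.≈ᴹ RecV.rec (λ (b , φ , _) → φ (g v) V.*ₗ lift b) bs
      onᵂ v []       = V.≈ᴹ-refl
      onᵂ v (b ∷ bs) = V.+ᴹ-congˡ (onᵂ v bs)

      onᵁ : ∀ v bs → RecV.rec (coeff v) (map liftᵁ bs) V.≈ᴹ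
                     f (AdditiveExtension.rec U.+ᴹ-commutativeMonoid (λ (b , φ , _) → φ (retraction v) U.*ₗ b) bs)
      onᵁ v []                 = V.≈ᴹ-sym f.0ᴹ-homo
      onᵁ v ((b , φ , _) ∷ bs) = V.≈ᴹ-sym (V.≈ᴹ-trans (f.+ᴹ-homo _ _)
        (V.+ᴹ-cong (f.*ₗ-homo _ _) (V.≈ᴹ-sym (onᵁ v bs))))

-- One-dimensional modules over monoid algebras

module MonoidModules {c ℓ} (K : CommutativeRing c ℓ) where
  private module K = CommutativeRing K
  open LinearAlgebra K
  open Linear K
  open Splitting K
  open K using () renaming (Carrier to 𝕜)
  open IsLeftModuleHomomorphism

  module _ {a b} {P : Monoid a b} where
    private
      module P = Monoid P
      module 𝕜P = Ring (algebra P)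
      open FormalSum (FreeRelation P.setoid) using (rel)
    open MonoidAlgebra P using (underlying; scalars)

    module _ {m ℓm n ℓn} (V : LeftModule (algebra P) m ℓm) (W : LeftModule (algebra P) n ℓn) where
      private
        module V = LeftModule V
        module W = LeftModule W

      mkMonomialLinear : ∀ {f} → (∀ {x y} → x V.≈ᴹ y → f x W.≈ᴹ f y) →
        (∀ x y → f (x V.+ᴹ y) W.≈ᴹ f x W.+ᴹ f y) → (∀ z x → f ([ z ] V.*ₗ x) W.≈ᴹ [ z ] W.*ₗ f x) → IsLinear V W f
      mkMonomialLinear {f} f-cong f-+ f-monomial = mkLinear V W f-cong f-+ scale
        where
        zero≋ : [ K.0# , P.ε ] 𝕜P.≈ []
        zero≋ = rel (zero P.ε)

        scale : ∀ zs x → f (zs V.*ₗ x) W.≈ᴹ zs W.*ₗ f x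
        scale []       x = W.≈ᴹ-trans (f-cong (V.*ₗ-congʳ (𝕜P.sym zero≋)))
                          (W.≈ᴹ-trans (f-monomial _ x) (W.*ₗ-congʳ zero≋))
        scale (z ∷ zs) x = W.≈ᴹ-trans (f-cong (V.*ₗ-distribʳ x [ z ] zs)) (W.≈ᴹ-trans (f-+ _ _)
                          (W.≈ᴹ-trans (W.+ᴹ-cong (f-monomial z x) (scale zs x)) (W.≈ᴹ-sym (W.*ₗ-distribʳ (f x) [ z ] zs))))

      underlying-linear : ∀ {f} → IsLinear V W f → IsLinear (underlying V) (underlying W) f
      underlying-linear f-lin = mkLinear (underlying V) (underlying W)
        (⟦⟧-cong f-lin) (+ᴹ-homo f-lin) (λ k → *ₗ-homo f-lin (scalars k))

    underlying-exact : ∀ {m ℓm} {U V W : LeftModule (algebra P) m ℓm} →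
                       ShortExact U V W → ShortExact (underlying U) (underlying V) (underlying W)
    underlying-exact {U = U} {V} {W} se = record
      { f      = f
      ; g      = g
      ; f-mono = record
        { isLeftModuleHomomorphism = underlying-linear U V isLeftModuleHomomorphism ; injective = injective }
      ; g-homo = underlying-linear V W g-homo
      ; g-surj = g-surj
      ; exact  = exact
      }
      where
      open ShortExact se
      open IsLeftModuleMonomorphism f-mono using (isLeftModuleHomomorphism; injective)

    record IsLine {m ℓm} (V : LeftModule (algebra P) m ℓm) (χ : P.Carrier → 𝕜) : Set (c ⊔ ℓ ⊔ a ⊔ b ⊔ m ⊔ ℓm) where
      open LeftModule V
      field
        v        : Carrierᴹ
        φ        : Carrierᴹ → 𝕜
        φ-linear : IsLinear (underlying V) 𝕜¹ φ
        φ-v      : φ v K.≈ K.1#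
        spans    : ∀ w → w ≈ᴹ scalars (φ w) *ₗ v
        eigen    : ∀ p → [ K.1# , p ] *ₗ v ≈ᴹ scalars (χ p) *ₗ v

      scalars-* : ∀ k l w → scalars k *ₗ scalars l *ₗ w ≈ᴹ scalars (k K.* l) *ₗ w
      scalars-* k l w = ≈ᴹ-trans (≈ᴹ-sym (*ₗ-assoc _ _ w)) (*ₗ-congʳ (rel (cong K.refl (P.identityˡ P.ε))))

      action : ∀ k p w → [ k , p ] *ₗ w ≈ᴹ scalars (k K.* φ w K.* χ p) *ₗ v
      action k p w = begin
        [ k , p ] *ₗ w                                     ≈⟨ *ₗ-congˡ (spans w) ⟩
        [ k , p ] *ₗ scalars (φ w) *ₗ v                    ≈⟨ *ₗ-assoc _ _ v ⟨
        [ k K.* φ w , p P.∙ P.ε ] *ₗ v                     ≈⟨ *ₗ-congʳ (rel (cong (K.sym (K.*-identityʳ _))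
                                                                (P.trans (P.identityʳ p) (P.sym (P.identityˡ p))))) ⟩
        [ k K.* φ w K.* K.1# , P.ε P.∙ p ] *ₗ v            ≈⟨ *ₗ-assoc _ _ v ⟩
        scalars (k K.* φ w) *ₗ [ K.1# , p ] *ₗ v           ≈⟨ *ₗ-congˡ (eigen p) ⟩
        scalars (k K.* φ w) *ₗ scalars (χ p) *ₗ v          ≈⟨ scalars-* _ _ v ⟩
        scalars (k K.* φ w K.* χ p) *ₗ v                   ∎
        where open SetoidReasoning ≈ᴹ-setoid

      φ-scalars : ∀ k → φ (scalars k *ₗ v) K.≈ k
      φ-scalars k = K.trans (*ₗ-homo φ-linear k v) (K.trans (K.*-congˡ φ-v) (K.*-identityʳ k))

      φ-action : ∀ k p w → φ ([ k , p ] *ₗ w) K.≈ k K.* φ w K.* χ p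
      φ-action k p w = K.trans (⟦⟧-cong φ-linear (action k p w)) (φ-scalars _)

      φ-injective : ∀ {x y} → φ x K.≈ φ y → x ≈ᴹ y
      φ-injective {x} {y} p =
        ≈ᴹ-trans (spans x) (≈ᴹ-trans (*ₗ-congʳ (rel (cong p P.refl))) (≈ᴹ-sym (spans y)))

      dualBasis : DualBasis (underlying V)
      dualBasis = record
        { elements = [ v , φ , φ-linear ]
        ; expand   = λ w → ≈ᴹ-trans (spans w) (≈ᴹ-sym (+ᴹ-identityʳ _))
        }

    module _ {m ℓm} {U V W : LeftModule (algebra P) m ℓm} {χ χ′ : P.Carrier → 𝕜} where
      private
        module V = LeftModule V
        module W = LeftModule W

      line-exact : (∀ u → LeftModule._≈ᴹ_ U u (LeftModule.0ᴹ U)) → IsLine V χ → IsLine W χ′ →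
                   (∀ p → χ p K.≈ χ′ p) → ShortExact U V W
      line-exact U≈0 V-line W-line χ≈χ′ = iso⇒exact {U = U} {V} {W} U≈0 {g} g-linear
        (λ {x} {y} p → V-line.φ-injective (K.trans (K.sym (W-line.φ-scalars _))
          (K.trans (⟦⟧-cong W-line.φ-linear p) (W-line.φ-scalars _))))
        (λ w → scalars (W-line.φ w) V.*ₗ V-line.v ,
               W.≈ᴹ-trans (W.*ₗ-congʳ (rel (cong (V-line.φ-scalars _) P.refl))) (W.≈ᴹ-sym (W-line.spans w)))
        where
        module V-line = IsLine V-line
        module W-line = IsLine W-line

        g : V.Carrierᴹ → W.Carrierᴹ
        g x = scalars (V-line.φ x) W.*ₗ W-line.v

        g-linear : IsLinear V W g
        g-linear = mkMonomialLinear V W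
          (λ p → W.*ₗ-congʳ (rel (cong (⟦⟧-cong V-line.φ-linear p) P.refl)))
          (λ x y → W.≈ᴹ-trans (W.*ₗ-congʳ (𝕜P.trans (rel (cong (+ᴹ-homo V-line.φ-linear x y) P.refl)) (rel (add _ _ P.ε))))
                              (W.*ₗ-distribʳ W-line.v _ _))
          (λ (k , p) x → W.≈ᴹ-trans
            (W.*ₗ-congʳ (rel (cong (K.trans (V-line.φ-action k p x) (K.*-cong (K.*-congˡ (K.sym (W-line.φ-scalars _))) (χ≈χ′ p))) P.refl)))
            (W.≈ᴹ-sym (W-line.action k p (g x))))

  module _ {a b x y} {P : Monoid a b} {Q : Monoid x y}
           {f : Monoid.Carrier P → Monoid.Carrier Q} (f-homo : IsMagmaHomomorphism (Monoid.rawMagma P) (Monoid.rawMagma Q) f)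
           {m ℓm} {V : LeftModule (algebra Q) m ℓm} {χ : Monoid.Carrier Q → 𝕜} (V-line : IsLine {P = Q} V χ) where
    private
      module P = Monoid P
      module Q = Monoid Q
      open LeftModule V
      open IsLine V-line
      module Qˢ = FormalSum (FreeRelation Q.setoid)

    ResV : LeftModule (algebra P) (m ⊔ ℓm) ℓm
    ResV = Res {R = algebra P} {S = algebra Q} (linearExtension-homo {M = P} {N = Q} f-homo) V

    Res-line : χ (f P.ε) K.≈ K.1# → IsLine {P = P} ResV (χ ∘ f)
    Res-line χ≈1 = record
      { v        = v , ≈ᴹ-trans (eigen (f P.ε)) (≈ᴹ-trans (*ₗ-congʳ (Qˢ.rel (cong χ≈1 Q.refl))) (*ₗ-identityˡ v))
      ; φ        = φ ∘ proj₁
      ; φ-linear = mkLinear (MonoidAlgebra.underlying P ResV) 𝕜¹ (λ p → ⟦⟧-cong φ-linear p) (λ _ _ → +ᴹ-homo φ-linear _ _)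
          (λ k (w , _) → K.trans (φ-action k (f P.ε) w) (K.trans (K.*-congˡ χ≈1) (K.*-identityʳ _)))
      ; φ-v      = φ-v
      ; spans    = λ (w , _) → ≈ᴹ-trans (spans w) (≈ᴹ-sym (via-f (φ w)))
      ; eigen    = λ p → ≈ᴹ-trans (eigen (f p)) (≈ᴹ-sym (via-f (χ (f p))))
      }
      where
      via-f : ∀ k → [ k , f P.ε ] *ₗ v ≈ᴹ [ k , Q.ε ] *ₗ v
      via-f k = ≈ᴹ-trans (action k (f P.ε) v) (*ₗ-congʳ (Qˢ.rel (cong
        (K.trans (K.*-cong (K.*-congˡ φ-v) χ≈1) (K.trans (K.*-identityʳ _) (K.*-identityʳ k))) Q.refl)))

    Res-zero : χ (f P.ε) K.≈ K.0# → ∀ w → LeftModule._≈ᴹ_ ResV w (LeftModule.0ᴹ ResV)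
    Res-zero χ≈0 (w , ew) = ≈ᴹ-trans (≈ᴹ-sym ew) (≈ᴹ-trans (action K.1# (f P.ε) w)
      (≈ᴹ-trans (*ₗ-congʳ (Qˢ.trans (Qˢ.rel (cong (K.trans (K.*-congˡ χ≈0) (K.zeroʳ _)) Q.refl)) (Qˢ.rel (zero Q.ε))))
                (*ₗ-zeroˡ v)))

module TensorModules {c ℓ} (K : CommutativeRing c ℓ) where
  private module K = CommutativeRing K
  open LinearAlgebra K
  open Linear K
  open Splitting K
  open MonoidModules K
  open K using () renaming (Carrier to 𝕜)
  open IsLeftModuleHomomorphism

  module _ {a b x y r s} {M : Monoid a b} {N : Monoid x y} {P : Monoid r s}
           {f : Monoid.Carrier P → Monoid.Carrier M} {g : Monoid.Carrier P → Monoid.Carrier N}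
           (f-homo : IsMonoidHomomorphism (Monoid.rawMonoid P) (Monoid.rawMonoid M) f)
           (g-homo : IsMonoidHomomorphism (Monoid.rawMonoid P) (Monoid.rawMonoid N) g)
           {m ℓm n ℓn} {V : LeftModule (algebra M) m ℓm} {W : LeftModule (algebra N) n ℓn}
           {χ : Monoid.Carrier M → 𝕜} {χ′ : Monoid.Carrier N → 𝕜}
           (V-line : IsLine {P = M} V χ) (W-line : IsLine {P = N} W χ′) where
    private
      module M = Monoid M
      module N = Monoid N
      module P = Monoid P
      module V = LeftModule V
      module W = LeftModule W
      module V-line = IsLine V-line
      module W-line = IsLine W-line
      module f = IsMonoidHomomorphism f-homo
      module g = IsMonoidHomomorphism g-homo
      module Mˢ = FormalSum (FreeRelation M.setoid)
      module Nˢ = FormalSum (FreeRelation N.setoid)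
      module Pˢ = FormalSum (FreeRelation P.setoid)
      uV = MonoidAlgebra.underlying M V
      uW = MonoidAlgebra.underlying N W
      T = tensorModule {M = M} {N} {P} f-homo g-homo V W
      module T = LeftModule T
      v⊗w = V-line.v ⊗ₑ W-line.v

      scalarsᴹ : 𝕜 → List (𝕜 × M.Carrier)
      scalarsᴹ k = [ k , M.ε ]

      scalarsᴺ : 𝕜 → List (𝕜 × N.Carrier)
      scalarsᴺ k = [ k , N.ε ]

      scalarsᴾ : 𝕜 → List (𝕜 × P.Carrier)
      scalarsᴾ k = [ k , P.ε ]
    open FormalSum (TensorRelation uV uW)

    private
      β : V.Carrierᴹ → W.Carrierᴹ → 𝕜
      β v w = V-line.φ v K.* W-line.φ w

      β-bilinear : IsBilinear uV uW 𝕜¹ β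
      β-bilinear = record
        { homoˡ = λ w → mkLinear uV 𝕜¹ (λ p → K.*-congʳ (⟦⟧-cong V-line.φ-linear p))
            (λ v v′ → K.trans (K.*-congʳ (+ᴹ-homo V-line.φ-linear v v′)) (K.distribʳ _ _ _))
            (λ k v → K.trans (K.*-congʳ (*ₗ-homo V-line.φ-linear k v)) (K.*-assoc _ _ _))
        ; homoʳ = λ v → mkLinear uW 𝕜¹ (λ p → K.*-congˡ (⟦⟧-cong W-line.φ-linear p))
            (λ w w′ → K.trans (K.*-congˡ (+ᴹ-homo W-line.φ-linear w w′)) (K.distribˡ _ _ _))
            (λ k w → K.trans (K.*-congˡ (*ₗ-homo W-line.φ-linear k w)) (x∙yz≈y∙xz _ _ _))
        }
        where open CommutativeSemigroupProperties (CommutativeMonoid.commutativeSemigroup K.*-commutativeMonoid)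
                     using (x∙yz≈y∙xz)

      φᵀ : List (V.Carrierᴹ × W.Carrierᴹ) → 𝕜
      φᵀ = ⊗-rec 𝕜¹ β

      act-f-ε : ∀ k v → [ k , f P.ε ] V.*ₗ v V.≈ᴹ scalarsᴹ k V.*ₗ v
      act-f-ε k v = V.*ₗ-congʳ (Mˢ.rel (cong K.refl f.ε-homo))

      act-g-ε : ∀ w → [ K.1# , g P.ε ] W.*ₗ w W.≈ᴹ w
      act-g-ε w = W.≈ᴹ-trans (W.*ₗ-congʳ (Nˢ.rel (cong K.refl g.ε-homo))) (W.*ₗ-identityˡ w)

      scalars-⊗ₑ : ∀ k v w → (scalarsᴾ k T.*ₗ (v ⊗ₑ w)) ≋ ((scalarsᴹ k V.*ₗ v) ⊗ₑ w)
      scalars-⊗ₑ k v w = rel (cong (act-f-ε k v) (act-g-ε w))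

      collect : ∀ k l → ((scalarsᴹ k V.*ₗ V-line.v) ⊗ₑ (scalarsᴺ l W.*ₗ W-line.v)) ≋ (scalarsᴾ (k K.* l) T.*ₗ v⊗w)
      collect k l = trans (sym (rel (scalar l _ _))) (trans
        (rel (cong (V.≈ᴹ-trans (V-line.scalars-* l k _) (V.*ₗ-congʳ (Mˢ.rel (cong (K.*-comm l k) M.refl)))) W.≈ᴹ-refl))
        (sym (scalars-⊗ₑ (k K.* l) _ _)))

      spans : ∀ t → t ≋ (scalarsᴾ (φᵀ t) T.*ₗ v⊗w)
      spans []            = sym (trans (T.*ₗ-congʳ {v⊗w} (Pˢ.rel (zero P.ε))) (T.*ₗ-zeroˡ v⊗w))
      spans ((v , w) ∷ t) = trans
        (++-cong (trans (rel (cong (V-line.spans v) (W-line.spans w))) (collect (V-line.φ v) (W-line.φ w))) (spans t))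
        (sym (trans (T.*ₗ-congʳ {v⊗w} (Pˢ.rel (add (β v w) (φᵀ t) P.ε))) (T.*ₗ-distribʳ v⊗w (scalarsᴾ (β v w)) (scalarsᴾ (φᵀ t)))))

    tensor-line : IsLine {P = P} T (λ p → χ (f p) K.* χ′ (g p))
    tensor-line = record
      { v        = v⊗w
      ; φ        = φᵀ
      ; φ-linear = mkLinear (MonoidAlgebra.underlying P T) 𝕜¹
          (⟦⟧-cong ⊗φ-linear) (+ᴹ-homo ⊗φ-linear) scale
      ; φ-v      = K.trans (K.+-identityʳ _) (K.trans (K.*-cong V-line.φ-v W-line.φ-v) (K.*-identityʳ K.1#))
      ; spans    = spans
      ; eigen    = λ p → trans (rel (cong (V-line.eigen (f p)) (W-line.eigen (g p)))) (collect (χ (f p)) (χ′ (g p)))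
      }
      where
      ⊗φ-linear : IsLinear (uV ⊗ uW) 𝕜¹ φᵀ
      ⊗φ-linear = ⊗-rec-linear 𝕜¹ β-bilinear

      scale : ∀ k t → φᵀ (scalarsᴾ k T.*ₗ t) K.≈ k K.* φᵀ t
      scale k []            = K.sym (K.zeroʳ k)
      scale k ((v , w) ∷ t) = K.trans
        (K.+-cong (K.trans (K.*-cong (K.trans (⟦⟧-cong V-line.φ-linear (act-f-ε k v)) (*ₗ-homo V-line.φ-linear k v))
                                     (⟦⟧-cong W-line.φ-linear (act-g-ε w)))
                           (K.*-assoc k _ _))
                  (scale k t))
        (K.sym (K.distribˡ k _ _))

  mapˡ : ∀ {v w x} {V : Set v} {W : Set w} {X : Set x} → (V → W) → List (V × X) → List (W × X)
  mapˡ h = concatMap (λ (v , x) → h v ⊗ₑ x)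

  module _ {v ℓv w ℓw x ℓx} {V : VectorSpace v ℓv} {W : VectorSpace w ℓw} {X : VectorSpace x ℓx} where
    private
      module V = LeftModule V
      module W = LeftModule W
      module X = LeftModule X
      module V⊗X = LeftModule (V ⊗ X)
      module W⊗X = LeftModule (W ⊗ X)
      open FormalSum (TensorRelation W X)

    mapˡ-cong : ∀ {h} → IsLinear V W h → ∀ {s t} → s V⊗X.≈ᴹ t → mapˡ h s W⊗X.≈ᴹ mapˡ h t
    mapˡ-cong {h} h-lin = concatMap-resp _ λ
      { (cong v≈v′ x≈x′) → rel (cong (⟦⟧-cong h-lin v≈v′) x≈x′)
      ; (addˡ v v′ x)    → trans (rel (cong (+ᴹ-homo h-lin v v′) X.≈ᴹ-refl)) (rel (addˡ _ _ x))
      ; (addʳ v x x′)    → rel (addʳ (h v) x x′)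
      ; (scalar k v x)   → trans (rel (cong (*ₗ-homo h-lin k v) X.≈ᴹ-refl)) (rel (scalar k (h v) x))
      ; (zeroˡ′ x)       → trans (rel (cong (0ᴹ-homo h-lin) X.≈ᴹ-refl)) (rel (zeroˡ′ x))
      }

  module _ {a b} {P : Monoid a b} {m ℓm x ℓx : Level} {X : LeftModule (algebra P) x ℓx} where
    private
      module X = LeftModule X
      uX = MonoidAlgebra.underlying P X

    infix 25 _⊗X
    _⊗X : ∀ {m ℓm} → LeftModule (algebra P) m ℓm → LeftModule (algebra P) (m ⊔ x) (c ⊔ m ⊔ ℓm ⊔ x ⊔ ℓx)
    V ⊗X = diagonalTensor P V X

    mapˡ-linear : ∀ {V W : LeftModule (algebra P) m ℓm} {h} → IsLinear V W h → IsLinear (V ⊗X) (W ⊗X) (mapˡ h)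
    mapˡ-linear {V} {W} {h} h-lin = mkMonomialLinear (V ⊗X) (W ⊗X)
      (mapˡ-cong {V = underlying V} {underlying W} {uX} (underlying-linear V W h-lin))
      (λ s t → reflexive (List.concatMap-++ _ s t))
      monomial
      where
      open MonoidAlgebra P using (underlying)
      open FormalSum (TensorRelation (underlying W) uX)
      module V⊗X = LeftModule (V ⊗X)
      module W⊗X = LeftModule (W ⊗X)

      monomial : ∀ z t → mapˡ h ([ z ] V⊗X.*ₗ t) W⊗X.≈ᴹ [ z ] W⊗X.*ₗ mapˡ h t
      monomial z             []            = refl
      monomial z@(k , p) ((v , x) ∷ t) = ++-cong {[ _ ]} {[ _ ]}
        (rel (cong (*ₗ-homo h-lin _ v) X.≈ᴹ-refl)) (monomial z t)

    -- A K-linear splitting of the sequence survives tensoring.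
    ⊗-exact : {U V W : LeftModule (algebra P) m ℓm} → DualBasis (MonoidAlgebra.underlying P W) →
              ShortExact U V W → ShortExact (U ⊗X) (V ⊗X) (W ⊗X)
    ⊗-exact {U} {V} {W} db se = record
      { f      = mapˡ f
      ; g      = mapˡ g
      ; f-mono = record
        { isLeftModuleHomomorphism = mapˡ-linear {U} {V} f-lin
        ; injective = λ {s} {t} p → Uˢ.trans (Uˢ.sym (retract s)) (Uˢ.trans (mapˡ-cong {V = uV} {uU} {uX} r-lin p) (retract t))
        }
      ; g-homo = mapˡ-linear {V} {W} g-homo
      ; g-surj = λ t → mapˡ s t , λ z≈ → Wˢ.trans (mapˡ-cong {V = uV} {uW} {uX} ug-lin z≈) (sect t)
      ; exact  = λ t → mk⇔
          (λ gt≈0 → mapˡ r t , Vˢ.sym (Vˢ.trans (decompose t) (Vˢ.trans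
            (Vˢ.++-cong (Vˢ.refl {mapˡ f (mapˡ r t)}) (mapˡ-cong {V = uW} {uV} {uX} s-lin gt≈0))
            (Vˢ.reflexive (List.++-identityʳ _)))))
          (λ (u , fu≈t) → Wˢ.trans (mapˡ-cong {V = uV} {uW} {uX} ug-lin (Vˢ.sym fu≈t)) (gf u))
      }
      where
      open ShortExact se
      open IsLeftModuleMonomorphism f-mono using () renaming (isLeftModuleHomomorphism to f-lin)
      open MonoidAlgebra P using (underlying)
      module U = LeftModule U
      module V = LeftModule V
      module W = LeftModule W
      uU = underlying U
      uV = underlying V
      uW = underlying W
      module Uˢ = FormalSum (TensorRelation uU uX)
      module Vˢ = FormalSum (TensorRelation uV uX)
      module Wˢ = FormalSum (TensorRelation uW uX)
      use = underlying-exact {U = U} {V} {W} se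
      s = section use db
      s-lin = section-linear use db
      r = retraction use db
      r-lin = retraction-linear use db
      ug-lin = underlying-linear V W g-homo

      retract : ∀ t → mapˡ r (mapˡ f t) Uˢ.≋ t
      retract []            = Uˢ.refl
      retract ((u , x) ∷ t) = Uˢ.++-cong (Uˢ.rel (cong (retraction-inverse use db u) X.≈ᴹ-refl)) (retract t)

      sect : ∀ t → mapˡ g (mapˡ s t) Wˢ.≋ t
      sect []            = Wˢ.refl
      sect ((w , x) ∷ t) = Wˢ.++-cong (Wˢ.rel (cong (section-inverse use db w) X.≈ᴹ-refl)) (sect t)

      gf : ∀ t → mapˡ g (mapˡ f t) Wˢ.≋ []
      gf []            = Wˢ.refl
      gf ((u , x) ∷ t) = Wˢ.++-cong {[ _ ]} {[]}
        (Wˢ.trans (Wˢ.rel (cong (Equivalence.from (exact (f u)) (u , V.≈ᴹ-refl)) X.≈ᴹ-refl)) (Wˢ.rel (zeroˡ′ x))) (gf t)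

      decompose : ∀ t → t Vˢ.≋ mapˡ f (mapˡ r t) ++ mapˡ s (mapˡ g t)
      decompose []            = Vˢ.refl
      decompose ((v , x) ∷ t) = Vˢ.trans
        (Vˢ.++-cong {[ _ ]} (Vˢ.trans (Vˢ.rel (cong (split use db v) X.≈ᴹ-refl)) (Vˢ.rel (addˡ _ _ x))) (decompose t))
        (Vˢ.interchange [ _ ] [ _ ] (mapˡ f (mapˡ r t)) (mapˡ s (mapˡ g t)))

  module _ {a b} {P : Monoid a b} {m ℓm n ℓn} (V : LeftModule (algebra P) m ℓm) (W : LeftModule (algebra P) n ℓn) where
    private
      module P = Monoid P
      module V = LeftModule V
      module W = LeftModule W
      module Pˢ = FormalSum (FreeRelation P.setoid)
      open MonoidAlgebra P using (underlying)
      open FormalSum (TensorRelation (underlying W) (underlying V))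
      module V⊗W = LeftModule (diagonalTensor P V W)
      module W⊗V = LeftModule (diagonalTensor P W V)

    swap : V⊗W.Carrierᴹ → W⊗V.Carrierᴹ
    swap = concatMap (λ (v , w) → w ⊗ₑ v)

    swap-linear : IsLinear (diagonalTensor P V W) (diagonalTensor P W V) swap
    swap-linear = mkMonomialLinear (diagonalTensor P V W) (diagonalTensor P W V)
      (concatMap-resp _ λ
        { (cong v≈v′ w≈w′) → rel (cong w≈w′ v≈v′)
        ; (addˡ v v′ w)    → rel (addʳ w v v′)
        ; (addʳ v w w′)    → rel (addˡ w w′ v)
        ; (scalar k v w)   → sym (rel (scalar k w v))
        ; (zeroˡ′ w)       → zeroʳ′ (underlying W) (underlying V) w
        })
      (λ s t → reflexive (List.concatMap-++ _ s t))
      monomial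
      where
      factor : ∀ {m ℓm} (V : LeftModule (algebra P) m ℓm) → let open LeftModule V in
               ∀ k p v → [ k , p ] *ₗ v ≈ᴹ [ k , P.ε ] *ₗ [ K.1# , p ] *ₗ v
      factor V k p v = ≈ᴹ-trans (*ₗ-congʳ (Pˢ.rel (cong (K.sym (K.*-identityʳ k)) (P.sym (P.identityˡ p)))))
                                (*ₗ-assoc _ _ v)
        where open LeftModule V

      monomial : ∀ z t → swap ([ z ] V⊗W.*ₗ t) ≋ [ z ] W⊗V.*ₗ swap t
      monomial z             []            = refl
      monomial z@(k , p) ((v , w) ∷ t) = ++-cong {[ _ ]} {[ _ ]}
        (trans (rel (cong W.≈ᴹ-refl (factor V k p v))) (trans (sym (rel (scalar k _ _)))
               (rel (cong (W.≈ᴹ-sym (factor W k p w)) V.≈ᴹ-refl))))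
        (monomial z t)

  module _ {a b} {P : Monoid a b} {m ℓm n ℓn} (V : LeftModule (algebra P) m ℓm) (W : LeftModule (algebra P) n ℓn) where

    swap-involutive : ∀ t → swap W V (swap V W t) ≡ t
    swap-involutive []      = ≡.refl
    swap-involutive (_ ∷ t) = ≡.cong (_ ∷_) (swap-involutive t)

-- The bialgebra structure

module Convolution {c ℓ} (M : CommutativeMonoid c ℓ) where
  open CommutativeMonoid M renaming (Carrier to C)
  open CommutativeSemigroupProperties commutativeSemigroup using (interchange)

  -- The sum of f k l over k + l = n.
  σ : ℕ → (ℕ → ℕ → C) → C
  σ zero    f = f 0 0
  σ (suc n) f = f 0 (suc n) ∙ σ n (λ k l → f (suc k) l)

  σ-cong : ∀ n {f g} → (∀ k l → k +ℕ l ≡ n → f k l ≈ g k l) → σ n f ≈ σ n g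
  σ-cong zero    f≈g = f≈g 0 0 ≡.refl
  σ-cong (suc n) f≈g = ∙-cong (f≈g 0 (suc n) ≡.refl) (σ-cong n λ k l eq → f≈g (suc k) l (≡.cong suc eq))

  σ-ε : ∀ n {f} → (∀ k l → k +ℕ l ≡ n → f k l ≈ ε) → σ n f ≈ ε
  σ-ε zero    f≈ε = f≈ε 0 0 ≡.refl
  σ-ε (suc n) f≈ε = trans (∙-cong (f≈ε 0 (suc n) ≡.refl) (σ-ε n λ k l eq → f≈ε (suc k) l (≡.cong suc eq))) (identityˡ ε)

  σ-∙ : ∀ n f g → σ n (λ k l → f k l ∙ g k l) ≈ σ n f ∙ σ n g
  σ-∙ zero    f g = refl
  σ-∙ (suc n) f g = trans (∙-congˡ (σ-∙ n _ _)) (interchange _ _ _ _)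

  σ-assoc : ∀ n (f : ℕ → ℕ → ℕ → C) →
            σ n (λ k l → σ k (λ p q → f p q l)) ≈ σ n (λ p m → σ m (λ q l → f p q l))
  σ-assoc zero    f = refl
  σ-assoc (suc n) f = trans (∙-congˡ (trans (σ-∙ n _ _) (∙-congˡ (σ-assoc n (λ p → f (suc p)))))) (sym (assoc _ _ _))

  σ-single : ∀ n {f} k l → k +ℕ l ≡ n → (∀ k′ l′ → k′ +ℕ l′ ≡ n → k′ ≢ k → f k′ l′ ≈ ε) → σ n f ≈ f k l
  σ-single zero    zero    l       ≡.refl f≈ε = refl
  σ-single (suc n) zero    .(suc n) ≡.refl f≈ε =
    trans (∙-congˡ (σ-ε n λ k′ l′ eq → f≈ε (suc k′) l′ (≡.cong suc eq) λ ())) (identityʳ _)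
  σ-single (suc n) (suc k) l       eq     f≈ε =
    trans (∙-cong (f≈ε 0 (suc n) ≡.refl λ ())
                  (σ-single n k l (ℕ.suc-injective eq) λ k′ l′ eq′ k′≢k →
                    f≈ε (suc k′) l′ (≡.cong suc eq′) λ eq″ → k′≢k (ℕ.suc-injective eq″)))
          (identityˡ _)

  σ-sum : ∀ n f → σ n f ≈ RawMonoidDefinitions.sum rawMonoid {suc n} (λ i → f (toℕ i) (n ∸ toℕ i))
  σ-sum zero    f = sym (identityʳ _)
  σ-sum (suc n) f = ∙-congˡ (σ-sum n λ k l → f (suc k) l)

module Parametrised {c ℓ} (K : CommutativeRing c ℓ) where
  private module K = CommutativeRing K
  open LinearAlgebra K
  open Linear K
  open K using () renaming (Carrier to 𝕜)
  open IsLeftModuleHomomorphism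

  module _ {v ℓv u ℓu} {V : VectorSpace v ℓv} {U : VectorSpace u ℓu} where
    private
      module V = LeftModule V
      module U = LeftModule U
      module Conv = Convolution U.+ᴹ-commutativeMonoid
      module ConvV = Convolution V.+ᴹ-commutativeMonoid
      open AdditiveExtension using (rec)
    open CommutativeSemigroupProperties
      (CommutativeMonoid.commutativeSemigroup U.+ᴹ-commutativeMonoid) using (interchange)

    zero-linear : IsLinear V U (λ _ → U.0ᴹ)
    zero-linear = mkLinear V U (λ _ → U.≈ᴹ-refl) (λ _ _ → U.≈ᴹ-sym (U.+ᴹ-identityˡ U.0ᴹ)) (λ k _ → U.≈ᴹ-sym (U.*ₗ-zeroʳ k))

    +-linear : ∀ {f g} → IsLinear V U f → IsLinear V U g → IsLinear V U (λ x → f x U.+ᴹ g x)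
    +-linear f-lin g-lin = mkLinear V U (λ p → U.+ᴹ-cong (⟦⟧-cong f-lin p) (⟦⟧-cong g-lin p))
      (λ x y → U.≈ᴹ-trans (U.+ᴹ-cong (+ᴹ-homo f-lin x y) (+ᴹ-homo g-lin x y)) (interchange _ _ _ _))
      (λ k x → U.≈ᴹ-trans (U.+ᴹ-cong (*ₗ-homo f-lin k x) (*ₗ-homo g-lin k x)) (U.≈ᴹ-sym (U.*ₗ-distribˡ k _ _)))

    *ₗ-linear : ∀ k {f} → IsLinear V U f → IsLinear V U (λ x → k U.*ₗ f x)
    *ₗ-linear k f-lin = mkLinear V U (λ p → U.*ₗ-congˡ (⟦⟧-cong f-lin p))
      (λ x y → U.≈ᴹ-trans (U.*ₗ-congˡ (+ᴹ-homo f-lin x y)) (U.*ₗ-distribˡ k _ _))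
      (λ l x → U.≈ᴹ-trans (U.*ₗ-congˡ (*ₗ-homo f-lin l x)) (U.≈ᴹ-trans (U.≈ᴹ-sym (U.*ₗ-assoc k l _))
               (U.≈ᴹ-trans (U.*ₗ-congʳ (K.*-comm k l)) (U.*ₗ-assoc l k _))))

    rec-linear : ∀ {x} {X : Set x} {g : X → V.Carrierᴹ → U.Carrierᴹ} → (∀ x → IsLinear V U (g x)) → ∀ xs →
                 IsLinear V U (λ y → rec U.+ᴹ-commutativeMonoid (λ x → g x y) xs)
    rec-linear g-lin []       = zero-linear
    rec-linear g-lin (x ∷ xs) = +-linear (g-lin x) (rec-linear g-lin xs)

    Free-rec-linearʳ : ∀ {b ℓb} {B : Setoid b ℓb} {g : Setoid.Carrier B → V.Carrierᴹ → U.Carrierᴹ} →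
      (∀ x → IsLinear V U (g x)) → ∀ xs → IsLinear V U (λ y → Free-rec {B = B} U (λ x → g x y) xs)
    Free-rec-linearʳ g-lin = rec-linear λ (k , x) → *ₗ-linear k (g-lin x)

    ⊗-rec-linearʳ : ∀ {a b} {A : Set a} {B : Set b} {g : A → B → V.Carrierᴹ → U.Carrierᴹ} →
      (∀ x y → IsLinear V U (g x y)) → ∀ t → IsLinear V U (λ z → ⊗-rec U (λ x y → g x y z) t)
    ⊗-rec-linearʳ g-lin = rec-linear λ (x , y) → g-lin x y

    σ-linear : ∀ {h} → IsLinear V U h → ∀ n f → h (ConvV.σ n f) U.≈ᴹ Conv.σ n (λ k l → h (f k l))
    σ-linear h-lin zero    f = U.≈ᴹ-refl
    σ-linear h-lin (suc n) f = U.≈ᴹ-trans (+ᴹ-homo h-lin _ _) (U.+ᴹ-congˡ (σ-linear h-lin n _))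

    σ-linearʳ : ∀ {h : ℕ → ℕ → V.Carrierᴹ → U.Carrierᴹ} → (∀ k l → IsLinear V U (h k l)) → ∀ n →
                IsLinear V U (λ x → Conv.σ n (λ k l → h k l x))
    σ-linearʳ h-lin zero    = h-lin 0 0
    σ-linearʳ h-lin (suc n) = +-linear (h-lin 0 (suc n)) (σ-linearʳ (λ k l → h-lin (suc k) l) n)

module Bialgebra {c ℓ} (K : Field c ℓ) where
  private
    module K = Field K
  open LinearAlgebra K.commutativeRing
  open Grothendieck K
  open Linear K.commutativeRing
  open Parametrised K.commutativeRing
  open IsLeftModuleHomomorphism

  private
    𝔾 = G₀Π
    𝔾² = G₀Π ⊗ G₀Π
    𝔾³ = G₀Π ⊗ 𝔾²
    module 𝔾 = LeftModule 𝔾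
    module 𝔾² = LeftModule 𝔾²
    module 𝔾³ = LeftModule 𝔾³
    Basis = Σ ℕ SetPartition
    module S = FormalSum (FreeRelation Π-graded)
    module S² = FormalSum (TensorRelation 𝔾 𝔾)
    module S³ = FormalSum (TensorRelation 𝔾 𝔾²)
    module When² = ListSum 𝔾².+ᴹ-commutativeMonoid
    module Conv = Convolution 𝔾.+ᴹ-commutativeMonoid
    module Conv² = Convolution 𝔾².+ᴹ-commutativeMonoid
    module Conv³ = Convolution 𝔾³.+ᴹ-commutativeMonoid
    open When² using (_when_; when-yes; when-no)

  basis-cong : {A B : SetPartition n} → A ≈Π B → ⟨ n , A ⟩ 𝔾.≈ᴹ ⟨ n , B ⟩
  basis-cong A≈B = S.rel (cong K.refl (same A≈B))

  product-if : Dec (k ≡ l) → SetPartition k → SetPartition l → 𝔾.Carrierᴹ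
  product-if {l = l} (yes ≡.refl) A B = ⟨ l , A ∨Π B ⟩
  product-if         (no _)       A B = []

  infixl 7 _·_ _⊙_

  _·_ : Basis → Basis → 𝔾.Carrierᴹ
  (k , A) · (l , B) = product-if (k ℕ.≟ l) A B

  ·-same : (A B : SetPartition n) → ((n , A) · (n , B)) 𝔾.≈ᴹ ⟨ n , A ∨Π B ⟩
  ·-same {n} A B = go (n ℕ.≟ n)
    where
    go : ∀ d → product-if d A B 𝔾.≈ᴹ ⟨ n , A ∨Π B ⟩
    go (yes p) with ≡.refl ← ℕ.≡-irrelevant p ≡.refl = S.refl
    go (no ¬p) = ⊥-elim (¬p ≡.refl)

  ·-different : k ≢ l → (A : SetPartition k) (B : SetPartition l) → ((k , A) · (l , B)) 𝔾.≈ᴹ []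
  ·-different {k} {l} k≢l A B = go (k ℕ.≟ l)
    where
    go : ∀ d → product-if d A B 𝔾.≈ᴹ []
    go (yes p) = ⊥-elim (k≢l p)
    go (no _)  = S.refl

  ·-cong : ∀ {a a′ b b′} → a ≈ᵍ a′ → b ≈ᵍ b′ → (a · b) 𝔾.≈ᴹ (a′ · b′)
  ·-cong (same {k} {A} {A′} A≈A′) (same {l} {B} {B′} B≈B′) = go (k ℕ.≟ l)
    where
    go : ∀ d → product-if d A B 𝔾.≈ᴹ product-if d A′ B′
    go (yes ≡.refl) = basis-cong (∨Π-cong A A′ B B′ A≈A′ B≈B′)
    go (no _)       = S.refl

  private
    graded-refl : ∀ a → a ≈ᵍ a
    graded-refl (_ , A) = same (≈Π-refl A)

  abstract
    _⊙_ : 𝔾.Carrierᴹ → 𝔾.Carrierᴹ → 𝔾.Carrierᴹ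
    x ⊙ y = Free-rec {B = Π-graded} 𝔾 (λ a → Free-rec {B = Π-graded} 𝔾 (a ·_) y) x

    private
      ·-linear : ∀ a → IsLinear 𝔾 𝔾 (Free-rec {B = Π-graded} 𝔾 (a ·_))
      ·-linear a = Free-rec-linear 𝔾 (·-cong (graded-refl a))

    ⊙-linearˡ : ∀ y → IsLinear 𝔾 𝔾 (_⊙ y)
    ⊙-linearˡ y = Free-rec-linear 𝔾 λ {a} {b} a≈b →
      Free-ext 𝔾 (·-linear a) (·-linear b) (λ e → 𝔾.≈ᴹ-trans (Free-rec-⟨⟩ {B = Π-graded} 𝔾 (a ·_) e)
        (𝔾.≈ᴹ-trans (·-cong a≈b (graded-refl e)) (𝔾.≈ᴹ-sym (Free-rec-⟨⟩ {B = Π-graded} 𝔾 (b ·_) e)))) y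

    ⊙-linearʳ : ∀ x → IsLinear 𝔾 𝔾 (x ⊙_)
    ⊙-linearʳ = Free-rec-linearʳ {V = 𝔾} {𝔾} {B = Π-graded} ·-linear

  ⊙-bilinear : IsBilinear 𝔾 𝔾 𝔾 _⊙_
  ⊙-bilinear = record { homoˡ = ⊙-linearˡ ; homoʳ = ⊙-linearʳ }

  abstract
    ⊙-basis : ∀ a b → (⟨ a ⟩ ⊙ ⟨ b ⟩) 𝔾.≈ᴹ (a · b)
    ⊙-basis a b = 𝔾.≈ᴹ-trans (Free-rec-⟨⟩ {B = Π-graded} 𝔾 (λ a → Free-rec {B = Π-graded} 𝔾 (a ·_) ⟨ b ⟩) a)
                              (Free-rec-⟨⟩ {B = Π-graded} 𝔾 (a ·_) b)

  ⊙-same : (A B : SetPartition n) → (⟨ n , A ⟩ ⊙ ⟨ n , B ⟩) 𝔾.≈ᴹ ⟨ n , A ∨Π B ⟩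
  ⊙-same A B = 𝔾.≈ᴹ-trans (⊙-basis _ _) (·-same A B)

  ⊙-different : k ≢ l → (A : SetPartition k) (B : SetPartition l) → (⟨ k , A ⟩ ⊙ ⟨ l , B ⟩) 𝔾.≈ᴹ []
  ⊙-different k≢l A B = 𝔾.≈ᴹ-trans (⊙-basis _ _) (·-different k≢l A B)

  ⊙-congˡ : ∀ x {y y′} → y 𝔾.≈ᴹ y′ → (x ⊙ y) 𝔾.≈ᴹ (x ⊙ y′)
  ⊙-congˡ x = ⟦⟧-cong (⊙-linearʳ x)

  ⊙-congʳ : ∀ y {x x′} → x 𝔾.≈ᴹ x′ → (x ⊙ y) 𝔾.≈ᴹ (x′ ⊙ y)
  ⊙-congʳ y = ⟦⟧-cong (⊙-linearˡ y)

  ⊙-zeroˡ : ∀ y → ([] ⊙ y) 𝔾.≈ᴹ []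
  ⊙-zeroˡ y = 0ᴹ-homo (⊙-linearˡ y)

  ⊙-zeroʳ : ∀ x → (x ⊙ []) 𝔾.≈ᴹ []
  ⊙-zeroʳ x = 0ᴹ-homo (⊙-linearʳ x)

  ⊙-assoc : ∀ x y z → ((x ⊙ y) ⊙ z) 𝔾.≈ᴹ (x ⊙ (y ⊙ z))
  ⊙-assoc x y z = Free-ext {B = Π-graded} 𝔾
    (∘-linear {U = 𝔾} {𝔾} {𝔾} (⊙-linearˡ z) (⊙-linearˡ y)) (⊙-linearˡ (y ⊙ z))
    (λ a → Free-ext {B = Π-graded} 𝔾
      (∘-linear {U = 𝔾} {𝔾} {𝔾} (⊙-linearˡ z) (⊙-linearʳ ⟨ a ⟩))
      (∘-linear {U = 𝔾} {𝔾} {𝔾} (⊙-linearʳ ⟨ a ⟩) (⊙-linearˡ z))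
      (λ b → Free-ext {B = Π-graded} 𝔾 (⊙-linearʳ (⟨ a ⟩ ⊙ ⟨ b ⟩))
        (∘-linear {U = 𝔾} {𝔾} {𝔾} (⊙-linearʳ ⟨ a ⟩) (⊙-linearʳ ⟨ b ⟩))
        (on-basis a b) z) y) x
    where
    open SetoidReasoning 𝔾.≈ᴹ-setoid
    on-basis : ∀ a b e → ((⟨ a ⟩ ⊙ ⟨ b ⟩) ⊙ ⟨ e ⟩) 𝔾.≈ᴹ (⟨ a ⟩ ⊙ (⟨ b ⟩ ⊙ ⟨ e ⟩))
    on-basis (k , A) (l , B) (m , C) = go A B C (k ℕ.≟ l) (l ℕ.≟ m)
      where
      go : ∀ {k l m} (A : SetPartition k) (B : SetPartition l) (C : SetPartition m) → Dec (k ≡ l) → Dec (l ≡ m) →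
           ((⟨ k , A ⟩ ⊙ ⟨ l , B ⟩) ⊙ ⟨ m , C ⟩) 𝔾.≈ᴹ (⟨ k , A ⟩ ⊙ (⟨ l , B ⟩ ⊙ ⟨ m , C ⟩))
      go {k} {l} {m} A B C (yes ≡.refl) (yes ≡.refl) = begin
        ((⟨ k , A ⟩) ⊙ ⟨ k , B ⟩) ⊙ ⟨ k , C ⟩  ≈⟨ ⊙-congʳ [ K.1# , k , C ] (⊙-same A B) ⟩
        (⟨ k , A ∨Π B ⟩) ⊙ ⟨ k , C ⟩           ≈⟨ ⊙-same (A ∨Π B) C ⟩
        [ K.1# , k , (A ∨Π B) ∨Π C ]         ≈⟨ basis-cong (∨Π-assoc A B C) ⟩
        [ K.1# , k , A ∨Π (B ∨Π C) ]         ≈⟨ ⊙-same A (B ∨Π C) ⟨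
        (⟨ k , A ⟩) ⊙ ⟨ k , B ∨Π C ⟩           ≈⟨ ⊙-congˡ [ K.1# , k , A ] (⊙-same B C) ⟨
        (⟨ k , A ⟩) ⊙ ((⟨ k , B ⟩) ⊙ ⟨ k , C ⟩)  ∎
      go {k} {l} {m} A B C (yes ≡.refl) (no l≢m) = begin
        ((⟨ k , A ⟩) ⊙ ⟨ k , B ⟩) ⊙ ⟨ m , C ⟩  ≈⟨ ⊙-congʳ [ K.1# , m , C ] (⊙-same A B) ⟩
        (⟨ k , A ∨Π B ⟩) ⊙ ⟨ m , C ⟩           ≈⟨ ⊙-different l≢m (A ∨Π B) C ⟩
        []                                   ≈⟨ ⊙-zeroʳ [ K.1# , k , A ] ⟨
        (⟨ k , A ⟩) ⊙ []                       ≈⟨ ⊙-congˡ [ K.1# , k , A ] (⊙-different l≢m B C) ⟨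
        (⟨ k , A ⟩) ⊙ ((⟨ k , B ⟩) ⊙ ⟨ m , C ⟩)  ∎
      go {k} {l} {m} A B C (no k≢l) (yes ≡.refl) = begin
        ((⟨ k , A ⟩) ⊙ ⟨ l , B ⟩) ⊙ ⟨ l , C ⟩  ≈⟨ ⊙-congʳ [ K.1# , l , C ] (⊙-different k≢l A B) ⟩
        [] ⊙ (⟨ l , C ⟩)                       ≈⟨ ⊙-zeroˡ [ K.1# , l , C ] ⟩
        []                                   ≈⟨ ⊙-different k≢l A (B ∨Π C) ⟨
        (⟨ k , A ⟩) ⊙ ⟨ l , B ∨Π C ⟩           ≈⟨ ⊙-congˡ [ K.1# , k , A ] (⊙-same B C) ⟨
        (⟨ k , A ⟩) ⊙ ((⟨ l , B ⟩) ⊙ ⟨ l , C ⟩)  ∎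
      go {k} {l} {m} A B C (no k≢l) (no l≢m) = begin
        ((⟨ k , A ⟩) ⊙ ⟨ l , B ⟩) ⊙ ⟨ m , C ⟩  ≈⟨ ⊙-congʳ [ K.1# , m , C ] (⊙-different k≢l A B) ⟩
        [] ⊙ (⟨ m , C ⟩)                       ≈⟨ ⊙-zeroˡ [ K.1# , m , C ] ⟩
        []                                   ≈⟨ ⊙-zeroʳ [ K.1# , k , A ] ⟨
        (⟨ k , A ⟩) ⊙ []                       ≈⟨ ⊙-congˡ [ K.1# , k , A ] (⊙-different l≢m B C) ⟨
        (⟨ k , A ⟩) ⊙ ((⟨ l , B ⟩) ⊙ ⟨ m , C ⟩)  ∎

  -- The summand of Δ(V_A) of bidegree (k , l).
  cutting : SetPartition n → Cut k l n → 𝔾².Carrierᴹ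
  cutting {k = k} {l} A d = ⟨ k , A ↾ˡ d ⟩ ⊗ₑ ⟨ l , A ↾ʳ d ⟩ when splits? A d

  cutting-if : ∀ k l → Dec (k +ℕ l ≡ n) → SetPartition n → 𝔾².Carrierᴹ
  cutting-if k l (yes eq) A = cutting A (cut {k} {l} eq)
  cutting-if k l (no _)   A = []

  abstract
    -- Zero unless k + l = n.  Not carrying a proof of k + l = n lets σ-assoc reindex iterated coproducts.
    component : Basis → ℕ → ℕ → 𝔾².Carrierᴹ
    component (n , A) k l = cutting-if k l (k +ℕ l ℕ.≟ n) A

    component-cut : (A : SetPartition n) (d : Cut k l n) → component (n , A) k l 𝔾².≈ᴹ cutting A d
    component-cut {n} {k} {l} A (cut eq) = go (k +ℕ l ℕ.≟ n)
      where
      go : ∀ d → cutting-if k l d A 𝔾².≈ᴹ cutting A (cut {k} {l} eq)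
      go (yes eq′) with ≡.refl ← ℕ.≡-irrelevant eq eq′ = S².refl
      go (no ¬eq) = ⊥-elim (¬eq eq)

  module _ {A : SetPartition n} (d : Cut k l n) where

    component-splits : Splits A d → component (n , A) k l 𝔾².≈ᴹ (⟨ k , A ↾ˡ d ⟩ ⊗ₑ ⟨ l , A ↾ʳ d ⟩)
    component-splits s = S².trans (component-cut A d) (when-yes (splits? A d) s)

    component-¬splits : ¬ Splits A d → component (n , A) k l 𝔾².≈ᴹ []
    component-¬splits ¬s = S².trans (component-cut A d) (when-no (splits? A d) ¬s)

  abstract
    component-cong : ∀ {a b} → a ≈ᵍ b → ∀ k l → component a k l 𝔾².≈ᴹ component b k l
    component-cong (same {n} {A} {B} A≈B) k l = go (k +ℕ l ℕ.≟ n)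
      where
      go : ∀ d → cutting-if k l d A 𝔾².≈ᴹ cutting-if k l d B
      go (yes eq) = When².when-⇔ (splits? A d) (splits? B d)
        (splits-≤ B A d (≈Π⇒≤Π B A (≈Π-sym A B A≈B))) (splits-≤ A B d (≈Π⇒≤Π A B A≈B))
        λ _ → S².rel (cong (basis-cong (pullback-cong (inˡ d) A B A≈B)) (basis-cong (pullback-cong (inʳ d) A B A≈B)))
        where
        d : Cut k l n
        d = cut eq
      go (no _)   = S².refl

  private
    δ : Basis → 𝔾².Carrierᴹ
    δ a@(n , _) = Conv².σ n (component a)

    δ-cong : ∀ {a b} → a ≈ᵍ b → δ a 𝔾².≈ᴹ δ b
    δ-cong a≈b@(same {n} _) = Conv².σ-cong n λ k l _ → component-cong a≈b k l

  abstract
    Δ : 𝔾.Carrierᴹ → 𝔾².Carrierᴹ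
    Δ = Free-rec {B = Π-graded} 𝔾² δ

    Δ-linear : IsLinear 𝔾 𝔾² Δ
    Δ-linear = Free-rec-linear 𝔾² δ-cong

    Δ-basis : ∀ a → Δ ⟨ a ⟩ 𝔾².≈ᴹ Conv².σ (proj₁ a) (component a)
    Δ-basis = Free-rec-⟨⟩ {B = Π-graded} 𝔾² δ

    Δ[_,_] : ℕ → ℕ → 𝔾.Carrierᴹ → 𝔾².Carrierᴹ
    Δ[ k , l ] = Free-rec {B = Π-graded} 𝔾² (λ a → component a k l)

    Δ[,]-linear : ∀ k l → IsLinear 𝔾 𝔾² Δ[ k , l ]
    Δ[,]-linear k l = Free-rec-linear 𝔾² λ a≈b → component-cong a≈b k l

    Δ[,]-basis : ∀ k l a → Δ[ k , l ] ⟨ a ⟩ 𝔾².≈ᴹ component a k l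
    Δ[,]-basis k l = Free-rec-⟨⟩ {B = Π-graded} 𝔾² (λ a → component a k l)

  private
    ε₀ : Basis → K.Carrier
    ε₀ (zero  , _) = K.1#
    ε₀ (suc _ , _) = K.0#

    ε₀-cong : ∀ {a b} → a ≈ᵍ b → ε₀ a K.≈ ε₀ b
    ε₀-cong (same {zero} _)  = K.refl
    ε₀-cong (same {suc _} _) = K.refl

  abstract
    ε : 𝔾.Carrierᴹ → K.Carrier
    ε = Free-rec {B = Π-graded} 𝕜¹ ε₀

    ε-linear : IsLinear 𝔾 𝕜¹ ε
    ε-linear = Free-rec-linear 𝕜¹ ε₀-cong

    ε-basis : ∀ a → ε ⟨ a ⟩ K.≈ ε₀ a
    ε-basis = Free-rec-⟨⟩ {B = Π-graded} 𝕜¹ ε₀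

  private
    *ₗ-bilinear : IsBilinear 𝕜¹ 𝔾 𝔾 𝔾._*ₗ_
    *ₗ-bilinear = record
      { homoˡ = λ x → mkLinear 𝕜¹ 𝔾 (𝔾.*ₗ-congʳ {x}) (λ k l → 𝔾.*ₗ-distribʳ x k l) (λ k l → 𝔾.*ₗ-assoc k l x)
      ; homoʳ = λ k → *ₗ-linear {V = 𝔾} {𝔾} k (mkLinear 𝔾 𝔾 (λ p → p) (λ _ _ → S.refl) (λ _ _ → S.refl))
      }

    leftly rightly : 𝔾.Carrierᴹ → 𝔾.Carrierᴹ → 𝔾.Carrierᴹ
    leftly  x y = ε x 𝔾.*ₗ y
    rightly x y = ε y 𝔾.*ₗ x

    leftly-bilinear : IsBilinear 𝔾 𝔾 𝔾 leftly
    leftly-bilinear = record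
      { homoˡ = λ y → ∘-linear {U = 𝔾} {𝕜¹} {𝔾} (IsBilinear.homoˡ *ₗ-bilinear y) ε-linear
      ; homoʳ = λ x → IsBilinear.homoʳ *ₗ-bilinear (ε x)
      }

    rightly-bilinear : IsBilinear 𝔾 𝔾 𝔾 rightly
    rightly-bilinear = record
      { homoˡ = λ y → IsBilinear.homoʳ *ₗ-bilinear (ε y)
      ; homoʳ = λ x → ∘-linear {U = 𝔾} {𝕜¹} {𝔾} (IsBilinear.homoˡ *ₗ-bilinear x) ε-linear
      }

    ε-zero : ∀ {n} → n ≢ 0 → (A : SetPartition n) → ε ⟨ n , A ⟩ K.≈ K.0#
    ε-zero {zero}  0≢0 A = ⊥-elim (0≢0 ≡.refl)
    ε-zero {suc n} _   A = ε-basis (suc n , A)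

    module _ {β : 𝔾.Carrierᴹ → 𝔾.Carrierᴹ → 𝔾.Carrierᴹ} (β-bilinear : IsBilinear 𝔾 𝔾 𝔾 β) where
      private
        β-linear : IsLinear 𝔾² 𝔾 (⊗-rec 𝔾 β)
        β-linear = ⊗-rec-linear 𝔾 β-bilinear

      on-component : (A : SetPartition n) (d : Cut k l n) → Splits A d →
                     ⊗-rec 𝔾 β (component (n , A) k l) 𝔾.≈ᴹ β ⟨ k , A ↾ˡ d ⟩ ⟨ l , A ↾ʳ d ⟩
      on-component A d s = S.trans (⟦⟧-cong β-linear (component-splits d s)) (⊗-rec-⊗ₑ {V = 𝔾} {𝔾} 𝔾 β _ _)

      on-component-zero : (A : SetPartition n) (d : Cut k l n) → (∀ B C → β ⟨ k , B ⟩ ⟨ l , C ⟩ 𝔾.≈ᴹ []) →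
                          ⊗-rec 𝔾 β (component (n , A) k l) 𝔾.≈ᴹ []
      on-component-zero A d β≈0 = go (splits? A d)
        where
        go : Dec (Splits A d) → _
        go (yes s) = S.trans (on-component A d s) (β≈0 _ _)
        go (no ¬s) = S.trans (⟦⟧-cong β-linear (component-¬splits d ¬s)) S.refl

      counit-law : (∀ n (A : SetPartition n) → Conv.σ n (λ k l → ⊗-rec 𝔾 β (component (n , A) k l)) 𝔾.≈ᴹ ⟨ n , A ⟩) →
                   ∀ x → ⊗-rec 𝔾 β (Δ x) 𝔾.≈ᴹ x
      counit-law on-basis = Free-ext {B = Π-graded} 𝔾
        (∘-linear {U = 𝔾} {𝔾²} {𝔾} β-linear Δ-linear)
        (mkLinear 𝔾 𝔾 (λ p → p) (λ _ _ → S.refl) (λ _ _ → S.refl))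
        λ { a@(n , A) → S.trans (⟦⟧-cong β-linear (Δ-basis a))
            (S.trans (σ-linear {V = 𝔾²} {𝔾} β-linear n (component a)) (on-basis n A)) }

  counitˡ : ∀ x → ⊗-rec 𝔾 (λ x₁ x₂ → ε x₁ 𝔾.*ₗ x₂) (Δ x) 𝔾.≈ᴹ x
  counitˡ = counit-law leftly-bilinear λ n A → S.trans
    (Conv.σ-single n 0 n ≡.refl λ k l eq k≢0 → on-component-zero leftly-bilinear A (cut {k} {l} eq) λ B C →
      S.trans (𝔾.*ₗ-congʳ {⟨ l , C ⟩} (ε-zero k≢0 B)) (𝔾.*ₗ-zeroˡ ⟨ l , C ⟩))
    (S.trans (on-component leftly-bilinear A (cut ≡.refl) (splits-vacuousˡ A (cut ≡.refl)))
    (S.trans (𝔾.*ₗ-congʳ {[ _ ]} (ε-basis (0 , A ↾ˡ cut {0} {n} ≡.refl)))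
    (S.trans (𝔾.*ₗ-identityˡ _) (basis-cong (↾ʳ-full A (cut ≡.refl))))))

  counitʳ : ∀ x → ⊗-rec 𝔾 (λ x₁ x₂ → ε x₂ 𝔾.*ₗ x₁) (Δ x) 𝔾.≈ᴹ x
  counitʳ = counit-law rightly-bilinear λ n A → let d = cut {n} {0} (ℕ.+-identityʳ n) in S.trans
    (Conv.σ-single n n 0 (ℕ.+-identityʳ n) λ k l eq k≢n → on-component-zero rightly-bilinear A (cut {k} {l} eq) λ B C →
      S.trans (𝔾.*ₗ-congʳ {⟨ k , B ⟩} (ε-zero (λ { ≡.refl → k≢n (≡.trans (≡.sym (ℕ.+-identityʳ k)) eq) }) C)) (𝔾.*ₗ-zeroˡ ⟨ k , B ⟩))
    (S.trans (on-component rightly-bilinear A d (splits-vacuousʳ A d))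
    (S.trans (𝔾.*ₗ-congʳ {[ _ ]} (ε-basis (0 , A ↾ʳ d)))
    (S.trans (𝔾.*ₗ-identityˡ _) (basis-cong (↾ˡ-full A d)))))

  private
    module ⊗ₑ¹ = IsBilinear (⊗ₑ-bilinear {V = 𝔾} {𝔾})
    module ⊗ₑ² = IsBilinear (⊗ₑ-bilinear {V = 𝔾} {𝔾²})

    reassociate : 𝔾.Carrierᴹ → 𝔾².Carrierᴹ → 𝔾³.Carrierᴹ
    reassociate z = ⊗-rec 𝔾³ (λ x₁ x₂ → x₁ ⊗ₑ (x₂ ⊗ₑ z))

    reassociate-linear : ∀ z → IsLinear 𝔾² 𝔾³ (reassociate z)
    reassociate-linear z = ⊗-rec-linear 𝔾³ record
      { homoˡ = λ x₂ → ⊗ₑ².homoˡ (x₂ ⊗ₑ z)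
      ; homoʳ = λ x₁ → ∘-linear {U = 𝔾} {𝔾²} {𝔾³} (⊗ₑ².homoʳ x₁) (⊗ₑ¹.homoˡ z)
      }

    module _ {D : 𝔾.Carrierᴹ → 𝔾².Carrierᴹ} (D-linear : IsLinear 𝔾 𝔾² D) where

      [D⊗id]-bilinear : IsBilinear 𝔾 𝔾 𝔾³ (λ x z → reassociate z (D x))
      [D⊗id]-bilinear = record
        { homoˡ = λ z → ∘-linear {U = 𝔾} {𝔾²} {𝔾³} (reassociate-linear z) D-linear
        ; homoʳ = λ x → ⊗-rec-linearʳ {V = 𝔾} {𝔾³}
            (λ x₁ x₂ → ∘-linear {U = 𝔾} {𝔾²} {𝔾³} (⊗ₑ².homoʳ x₁) (⊗ₑ¹.homoʳ x₂)) (D x)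
        }

      [id⊗D]-bilinear : IsBilinear 𝔾 𝔾 𝔾³ (λ x y → x ⊗ₑ D y)
      [id⊗D]-bilinear = record
        { homoˡ = λ y → ⊗ₑ².homoˡ (D y)
        ; homoʳ = λ x → ∘-linear {U = 𝔾} {𝔾²} {𝔾³} (⊗ₑ².homoʳ x) D-linear
        }

    [_⊗id] [id⊗_] : (𝔾.Carrierᴹ → 𝔾².Carrierᴹ) → 𝔾².Carrierᴹ → 𝔾³.Carrierᴹ
    [ D ⊗id] = ⊗-rec 𝔾³ λ x z → ⊗-rec 𝔾³ (λ x₁ x₂ → x₁ ⊗ₑ (x₂ ⊗ₑ z)) (D x)
    [id⊗ D ] = ⊗-rec 𝔾³ λ x y → x ⊗ₑ D y

    module _ {D : 𝔾.Carrierᴹ → 𝔾².Carrierᴹ} (D-linear : IsLinear 𝔾 𝔾² D) where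

      [D⊗id]-linear : IsLinear 𝔾² 𝔾³ [ D ⊗id]
      [D⊗id]-linear = ⊗-rec-linear 𝔾³ ([D⊗id]-bilinear D-linear)

      [id⊗D]-linear : IsLinear 𝔾² 𝔾³ [id⊗ D ]
      [id⊗D]-linear = ⊗-rec-linear 𝔾³ ([id⊗D]-bilinear D-linear)

      [D⊗id]-basis : ∀ {a b t} → D ⟨ a ⟩ 𝔾².≈ᴹ t → [ D ⊗id] (⟨ a ⟩ ⊗ₑ ⟨ b ⟩) 𝔾³.≈ᴹ reassociate ⟨ b ⟩ t
      [D⊗id]-basis {a} {b} Da≈t = S³.trans (⊗-rec-⊗ₑ {V = 𝔾} {𝔾} 𝔾³ (λ x z → reassociate z (D x)) ⟨ a ⟩ ⟨ b ⟩)
                                           (⟦⟧-cong (reassociate-linear ⟨ b ⟩) Da≈t)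

      [id⊗D]-basis : ∀ {a b t} → D ⟨ b ⟩ 𝔾².≈ᴹ t → [id⊗ D ] (⟨ a ⟩ ⊗ₑ ⟨ b ⟩) 𝔾³.≈ᴹ (⟨ a ⟩ ⊗ₑ t)
      [id⊗D]-basis {a} {b} Db≈t = S³.trans (⊗-rec-⊗ₑ {V = 𝔾} {𝔾} 𝔾³ (λ x y → x ⊗ₑ D y) ⟨ a ⟩ ⟨ b ⟩)
                                           (⟦⟧-cong (⊗ₑ².homoʳ ⟨ a ⟩) Db≈t)

    [Δ⊗id]-component : (A : SetPartition n) (d : Cut k l n) →
      [ Δ ⊗id] (component (n , A) k l) 𝔾³.≈ᴹ Conv³.σ k (λ p q → [ Δ[ p , q ] ⊗id] (component (n , A) k l))
    [Δ⊗id]-component {n} {k} {l} A d = go (splits? A d)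
      where
      a = k , A ↾ˡ d
      b = l , A ↾ʳ d
      go : Dec (Splits A d) → _
      go (yes s) = S³.trans (⟦⟧-cong ([D⊗id]-linear Δ-linear) (component-splits d s))
        (S³.trans ([D⊗id]-basis Δ-linear {a} {b} (Δ-basis a))
        (S³.trans (σ-linear {V = 𝔾²} {𝔾³} (reassociate-linear ⟨ b ⟩) k (component a))
        (Conv³.σ-cong k λ p q _ → S³.sym (S³.trans (⟦⟧-cong ([D⊗id]-linear (Δ[,]-linear p q)) (component-splits d s))
          ([D⊗id]-basis (Δ[,]-linear p q) {a} {b} (Δ[,]-basis p q a))))))
      go (no ¬s) = S³.trans (⟦⟧-cong ([D⊗id]-linear Δ-linear) (component-¬splits d ¬s))
        (S³.sym (Conv³.σ-ε k λ p q _ → ⟦⟧-cong ([D⊗id]-linear (Δ[,]-linear p q)) (component-¬splits d ¬s)))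

    [id⊗Δ]-component : (A : SetPartition n) (d : Cut k l n) →
      [id⊗ Δ ] (component (n , A) k l) 𝔾³.≈ᴹ Conv³.σ l (λ p q → [id⊗ Δ[ p , q ] ] (component (n , A) k l))
    [id⊗Δ]-component {n} {k} {l} A d = go (splits? A d)
      where
      a = k , A ↾ˡ d
      b = l , A ↾ʳ d
      go : Dec (Splits A d) → _
      go (yes s) = S³.trans (⟦⟧-cong ([id⊗D]-linear Δ-linear) (component-splits d s))
        (S³.trans ([id⊗D]-basis Δ-linear {a} {b} (Δ-basis b))
        (S³.trans (σ-linear {V = 𝔾²} {𝔾³} (⊗ₑ².homoʳ ⟨ a ⟩) l (component b))
        (Conv³.σ-cong l λ p q _ → S³.sym (S³.trans (⟦⟧-cong ([id⊗D]-linear (Δ[,]-linear p q)) (component-splits d s))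
          ([id⊗D]-basis (Δ[,]-linear p q) {a} {b} (Δ[,]-basis p q b))))))
      go (no ¬s) = S³.trans (⟦⟧-cong ([id⊗D]-linear Δ-linear) (component-¬splits d ¬s))
        (S³.sym (Conv³.σ-ε l λ p q _ → ⟦⟧-cong ([id⊗D]-linear (Δ[,]-linear p q)) (component-¬splits d ¬s)))

    component-coassoc : ∀ {p q m} (A : SetPartition n) (c : Cut k l n) (c′ : Cut p q k) (d : Cut p m n) (d′ : Cut q l m) →
      [ Δ[ p , q ] ⊗id] (component (n , A) k l) 𝔾³.≈ᴹ [id⊗ Δ[ q , l ] ] (component (n , A) p m)
    component-coassoc {n} {k} {l} {p} {q} {m} A c c′ d d′ = go (splits? A c) (splits? (A ↾ˡ c) c′)
      where
      LHS = [ Δ[ p , q ] ⊗id] (component (n , A) k l)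
      RHS = [id⊗ Δ[ q , l ] ] (component (n , A) p m)

      left-split : Splits A c → LHS 𝔾³.≈ᴹ reassociate ⟨ l , A ↾ʳ c ⟩ (component (k , A ↾ˡ c) p q)
      left-split s = S³.trans (⟦⟧-cong ([D⊗id]-linear (Δ[,]-linear p q)) (component-splits c s))
        ([D⊗id]-basis (Δ[,]-linear p q) {k , A ↾ˡ c} {l , A ↾ʳ c} (Δ[,]-basis p q (k , A ↾ˡ c)))

      right-split : Splits A d → RHS 𝔾³.≈ᴹ (⟨ p , A ↾ˡ d ⟩ ⊗ₑ component (m , A ↾ʳ d) q l)
      right-split s = S³.trans (⟦⟧-cong ([id⊗D]-linear (Δ[,]-linear q l)) (component-splits d s))
        ([id⊗D]-basis (Δ[,]-linear q l) {p , A ↾ˡ d} {m , A ↾ʳ d} (Δ[,]-basis q l (m , A ↾ʳ d)))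

      right-zero : ¬ (Splits A d × Splits (A ↾ʳ d) d′) → RHS 𝔾³.≈ᴹ []
      right-zero ¬ss = by (splits? A d)
        where
        by : Dec (Splits A d) → RHS 𝔾³.≈ᴹ []
        by (no ¬s) = ⟦⟧-cong ([id⊗D]-linear (Δ[,]-linear q l)) (component-¬splits d ¬s)
        by (yes s) = S³.trans (right-split s) (S³.trans
          (⟦⟧-cong (⊗ₑ².homoʳ ⟨ p , A ↾ˡ d ⟩) (component-¬splits d′ λ s′ → ¬ss (s , s′)))
          (0ᴹ-homo (⊗ₑ².homoʳ ⟨ p , A ↾ˡ d ⟩)))

      go : Dec (Splits A c) → Dec (Splits (A ↾ˡ c) c′) → LHS 𝔾³.≈ᴹ RHS
      go (no ¬s) _ = S³.trans (⟦⟧-cong ([D⊗id]-linear (Δ[,]-linear p q)) (component-¬splits c ¬s))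
        (S³.sym (right-zero λ (s , s′) → ¬s (proj₁ (splits-coassoc⁻ c c′ d d′ A s s′))))
      go (yes s) (no ¬s′) = S³.trans (left-split s) (S³.trans
        (⟦⟧-cong (reassociate-linear ⟨ l , A ↾ʳ c ⟩) (component-¬splits c′ ¬s′))
        (S³.sym (right-zero λ (s , s′) → ¬s′ (proj₂ (splits-coassoc⁻ c c′ d d′ A s s′)))))
      go (yes s) (yes s′) = let t , t′ = splits-coassoc⁺ c c′ d d′ A s s′ in
        S³.trans (left-split s) (S³.trans
        (⟦⟧-cong (reassociate-linear ⟨ l , A ↾ʳ c ⟩) (component-splits c′ s′))
        (S³.trans (S³.rel (cong (basis-cong (↾-coassocˡ c c′ d d′ A))
                                (S².rel (cong (basis-cong (↾-coassocᵐ c c′ d d′ A)) (basis-cong (↾-coassocʳ c c′ d d′ A))))))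
        (S³.sym (S³.trans (right-split t) (⟦⟧-cong (⊗ₑ².homoʳ ⟨ p , A ↾ˡ d ⟩) (component-splits d′ t′))))))

  private
    [Δ⊗id]Δ-basis : ∀ n (A : SetPartition n) → [ Δ ⊗id] (Δ ⟨ n , A ⟩) 𝔾³.≈ᴹ
      Conv³.σ n (λ k l → Conv³.σ k (λ p q → [ Δ[ p , q ] ⊗id] (component (n , A) (p +ℕ q) l)))
    [Δ⊗id]Δ-basis n A = S³.trans (⟦⟧-cong ([D⊗id]-linear Δ-linear) (Δ-basis (n , A)))
      (S³.trans (σ-linear {V = 𝔾²} {𝔾³} ([D⊗id]-linear Δ-linear) n (component (n , A)))
      (Conv³.σ-cong n {f = λ k l → [ Δ ⊗id] (component (n , A) k l)} λ k l eq →
        S³.trans ([Δ⊗id]-component A (cut {k} {l} eq)) (degree k l)))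
      where
      degree : ∀ k l → Conv³.σ k (λ p q → [ Δ[ p , q ] ⊗id] (component (n , A) k l)) 𝔾³.≈ᴹ
                       Conv³.σ k (λ p q → [ Δ[ p , q ] ⊗id] (component (n , A) (p +ℕ q) l))
      degree k l = Conv³.σ-cong k {f = λ p q → [ Δ[ p , q ] ⊗id] (component (n , A) k l)} λ p q p+q≡k →
        S³.reflexive (≡.cong (λ k → [ Δ[ p , q ] ⊗id] (component (n , A) k l)) (≡.sym p+q≡k))

    [id⊗Δ]Δ-basis : ∀ n (A : SetPartition n) → [id⊗ Δ ] (Δ ⟨ n , A ⟩) 𝔾³.≈ᴹ
      Conv³.σ n (λ p m → Conv³.σ m (λ q l → [id⊗ Δ[ q , l ] ] (component (n , A) p m)))
    [id⊗Δ]Δ-basis n A = S³.trans (⟦⟧-cong ([id⊗D]-linear Δ-linear) (Δ-basis (n , A)))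
      (S³.trans (σ-linear {V = 𝔾²} {𝔾³} ([id⊗D]-linear Δ-linear) n (component (n , A)))
      (Conv³.σ-cong n {f = λ p m → [id⊗ Δ ] (component (n , A) p m)} λ p m eq →
        [id⊗Δ]-component A (cut {p} {m} eq)))

    Δ-coassoc-basis : ∀ n (A : SetPartition n) → [ Δ ⊗id] (Δ ⟨ n , A ⟩) 𝔾³.≈ᴹ [id⊗ Δ ] (Δ ⟨ n , A ⟩)
    Δ-coassoc-basis n A = S³.trans ([Δ⊗id]Δ-basis n A) (S³.trans
      (Conv³.σ-assoc n λ p q l → [ Δ[ p , q ] ⊗id] (component (n , A) (p +ℕ q) l))
      (S³.trans (Conv³.σ-cong n λ p m → inner p m) (S³.sym ([id⊗Δ]Δ-basis n A))))
      where
      inner : ∀ p m → p +ℕ m ≡ n →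
        Conv³.σ m (λ q l → [ Δ[ p , q ] ⊗id] (component (n , A) (p +ℕ q) l)) 𝔾³.≈ᴹ
        Conv³.σ m (λ q l → [id⊗ Δ[ q , l ] ] (component (n , A) p m))
      inner p m eq = Conv³.σ-cong m {f = λ q l → [ Δ[ p , q ] ⊗id] (component (n , A) (p +ℕ q) l)} λ q l eq′ →
        component-coassoc A
          (cut {p +ℕ q} {l} (≡.trans (ℕ.+-assoc p q l) (≡.trans (≡.cong (p +ℕ_) eq′) eq)))
          (cut {p} {q} ≡.refl) (cut {p} {m} eq) (cut {q} {l} eq′)

  Δ-coassoc : ∀ x → [ Δ ⊗id] (Δ x) 𝔾³.≈ᴹ [id⊗ Δ ] (Δ x)
  Δ-coassoc = Free-ext {B = Π-graded} 𝔾³ {f = λ x → [ Δ ⊗id] (Δ x)} {g = λ x → [id⊗ Δ ] (Δ x)}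
    (∘-linear {U = 𝔾} {𝔾²} {𝔾³} ([D⊗id]-linear Δ-linear) Δ-linear)
    (∘-linear {U = 𝔾} {𝔾²} {𝔾³} ([id⊗D]-linear Δ-linear) Δ-linear)
    λ (n , A) → Δ-coassoc-basis n A

  _⊙²_ : 𝔾².Carrierᴹ → 𝔾².Carrierᴹ → 𝔾².Carrierᴹ
  s ⊙² t = ⊗-rec 𝔾² (λ x₁ x₂ → ⊗-rec 𝔾² (λ y₁ y₂ → (x₁ ⊙ y₁) ⊗ₑ (x₂ ⊙ y₂)) t) s

  private
    ⊙²-tensor : 𝔾.Carrierᴹ → 𝔾.Carrierᴹ → 𝔾².Carrierᴹ → 𝔾².Carrierᴹ
    ⊙²-tensor x₁ x₂ = ⊗-rec 𝔾² (λ y₁ y₂ → (x₁ ⊙ y₁) ⊗ₑ (x₂ ⊙ y₂))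

    ⊙²-tensor-linear : ∀ x₁ x₂ → IsLinear 𝔾² 𝔾² (⊙²-tensor x₁ x₂)
    ⊙²-tensor-linear x₁ x₂ = ⊗-rec-linear 𝔾² record
      { homoˡ = λ y₂ → ∘-linear {U = 𝔾} {𝔾} {𝔾²} (⊗ₑ¹.homoˡ (x₂ ⊙ y₂)) (⊙-linearʳ x₁)
      ; homoʳ = λ y₁ → ∘-linear {U = 𝔾} {𝔾} {𝔾²} (⊗ₑ¹.homoʳ (x₁ ⊙ y₁)) (⊙-linearʳ x₂)
      }

    ⊙²-linearʳ : ∀ s → IsLinear 𝔾² 𝔾² (s ⊙²_)
    ⊙²-linearʳ = ⊗-rec-linearʳ {V = 𝔾²} {𝔾²} ⊙²-tensor-linear

    ⊙²-linearˡ : ∀ t → IsLinear 𝔾² 𝔾² (_⊙² t)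
    ⊙²-linearˡ t = ⊗-rec-linear 𝔾² {β = λ x₁ x₂ → ⊙²-tensor x₁ x₂ t} record
      { homoˡ = λ x₂ → ⊗-rec-linearʳ {V = 𝔾} {𝔾²} {g = λ y₁ y₂ x₁ → (x₁ ⊙ y₁) ⊗ₑ (x₂ ⊙ y₂)}
          (λ y₁ y₂ → ∘-linear {U = 𝔾} {𝔾} {𝔾²} (⊗ₑ¹.homoˡ (x₂ ⊙ y₂)) (⊙-linearˡ y₁)) t
      ; homoʳ = λ x₁ → ⊗-rec-linearʳ {V = 𝔾} {𝔾²} {g = λ y₁ y₂ x₂ → (x₁ ⊙ y₁) ⊗ₑ (x₂ ⊙ y₂)}
          (λ y₁ y₂ → ∘-linear {U = 𝔾} {𝔾} {𝔾²} (⊗ₑ¹.homoʳ (x₁ ⊙ y₁)) (⊙-linearˡ y₂)) t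
      }

    ⊙²-⊗ₑ : ∀ x₁ x₂ y₁ y₂ → ((x₁ ⊗ₑ x₂) ⊙² (y₁ ⊗ₑ y₂)) 𝔾².≈ᴹ ((x₁ ⊙ y₁) ⊗ₑ (x₂ ⊙ y₂))
    ⊙²-⊗ₑ x₁ x₂ y₁ y₂ = S².refl

    ⊙²-cong : ∀ {s s′ t t′} → s 𝔾².≈ᴹ s′ → t 𝔾².≈ᴹ t′ → (s ⊙² t) 𝔾².≈ᴹ (s′ ⊙² t′)
    ⊙²-cong {s} {s′} {t} {t′} p q = S².trans (⟦⟧-cong (⊙²-linearˡ t) p) (⟦⟧-cong (⊙²-linearʳ s′) q)

    ⊙²-zeroʳ : ∀ s {t} → t 𝔾².≈ᴹ [] → (s ⊙² t) 𝔾².≈ᴹ []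
    ⊙²-zeroʳ s t≈0 = S².trans (⟦⟧-cong (⊙²-linearʳ s) t≈0) (0ᴹ-homo (⊙²-linearʳ s))

    ⊙²-zeroˡ : ∀ t {s} → s 𝔾².≈ᴹ [] → (s ⊙² t) 𝔾².≈ᴹ []
    ⊙²-zeroˡ t s≈0 = ⟦⟧-cong (⊙²-linearˡ t) s≈0

    component-⊙²-different : ∀ {k l k′ l′ m n} (A : SetPartition m) (B : SetPartition n) →
      (d : Cut k l m) (d′ : Cut k′ l′ n) → ¬ (k ≡ k′ × l ≡ l′) →
      (component (m , A) k l ⊙² component (n , B) k′ l′) 𝔾².≈ᴹ []
    component-⊙²-different {k} {l} {k′} {l′} A B d d′ ≢ = go (splits? A d) (splits? B d′)
      where
      vanish : Dec (k ≡ k′) → ((⟨ k , A ↾ˡ d ⟩ ⊙ ⟨ k′ , B ↾ˡ d′ ⟩) ⊗ₑ (⟨ l , A ↾ʳ d ⟩ ⊙ ⟨ l′ , B ↾ʳ d′ ⟩)) 𝔾².≈ᴹ []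
      vanish (no k≢k′)  = S².trans (S².rel (cong (⊙-different k≢k′ (A ↾ˡ d) (B ↾ˡ d′)) 𝔾.≈ᴹ-refl)) (S².rel (zeroˡ′ _))
      vanish (yes k≡k′) = S².trans
        (S².rel (cong 𝔾.≈ᴹ-refl (⊙-different (λ l≡l′ → ≢ (k≡k′ , l≡l′)) (A ↾ʳ d) (B ↾ʳ d′)))) (zeroʳ′ 𝔾 𝔾 _)

      go : Dec (Splits A d) → Dec (Splits B d′) → _
      go (no ¬s) _        = ⊙²-zeroˡ (component (_ , B) k′ l′) (component-¬splits d ¬s)
      go (yes _) (no ¬s)  = ⊙²-zeroʳ (component (_ , A) k l) (component-¬splits d′ ¬s)
      go (yes s) (yes s′) = S².trans (⊙²-cong (component-splits d s) (component-splits d′ s′))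
        (S².trans (⊙²-⊗ₑ _ _ _ _) (vanish (k ℕ.≟ k′)))

    component-⊙²-same : (A B : SetPartition n) (d : Cut k l n) →
      (component (n , A) k l ⊙² component (n , B) k l) 𝔾².≈ᴹ component (n , A ∨Π B) k l
    component-⊙²-same {n} {k} {l} A B d = go (splits? A d) (splits? B d)
      where
      go : Dec (Splits A d) → Dec (Splits B d) → _
      go (no ¬s) _        = S².trans (⊙²-zeroˡ (component (n , B) k l) (component-¬splits d ¬s))
        (S².sym (component-¬splits d λ s → ¬s (proj₁ (splits-∨⁻ A B d s))))
      go (yes _) (no ¬s)  = S².trans (⊙²-zeroʳ (component (n , A) k l) (component-¬splits d ¬s))
        (S².sym (component-¬splits d λ s → ¬s (proj₂ (splits-∨⁻ A B d s))))
      go (yes s) (yes s′) = S².trans (⊙²-cong (component-splits d s) (component-splits d s′))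
        (S².trans (⊙²-⊗ₑ _ _ _ _)
        (S².trans (S².rel (cong (S.trans (⊙-same (A ↾ˡ d) (B ↾ˡ d)) (S.sym (basis-cong (↾ˡ-∨ A B d s∨))))
                                (S.trans (⊙-same (A ↾ʳ d) (B ↾ʳ d)) (S.sym (basis-cong (↾ʳ-∨ A B d s∨))))))
        (S².sym (component-splits d s∨))))
        where s∨ = splits-∨ A B d s s′

    Δ-⊙²-basis : ∀ a b → (Δ ⟨ a ⟩ ⊙² Δ ⟨ b ⟩) 𝔾².≈ᴹ
      Conv².σ (proj₁ a) (λ k l → Conv².σ (proj₁ b) (λ k′ l′ → component a k l ⊙² component b k′ l′))
    Δ-⊙²-basis a@(m , _) b@(n , _) = S².trans (⊙²-cong (Δ-basis a) (Δ-basis b))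
      (S².trans (σ-linear {V = 𝔾²} {𝔾²} (⊙²-linearˡ (Conv².σ n (component b))) m (component a))
      (Conv².σ-cong m {f = λ k l → component a k l ⊙² Conv².σ n (component b)} λ k l _ →
        σ-linear {V = 𝔾²} {𝔾²} (⊙²-linearʳ (component a k l)) n (component b)))

    Δ-⊙-basis : ∀ a b → Δ (⟨ a ⟩ ⊙ ⟨ b ⟩) 𝔾².≈ᴹ (Δ ⟨ a ⟩ ⊙² Δ ⟨ b ⟩)
    Δ-⊙-basis (m , A) (n , B) = S².trans (go A B (m ℕ.≟ n)) (S².sym (Δ-⊙²-basis (m , A) (n , B)))
      where
      go : ∀ {m n} (A : SetPartition m) (B : SetPartition n) → Dec (m ≡ n) → Δ (⟨ m , A ⟩ ⊙ ⟨ n , B ⟩) 𝔾².≈ᴹ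
        Conv².σ m (λ k l → Conv².σ n (λ k′ l′ → component (m , A) k l ⊙² component (n , B) k′ l′))
      go {n} A B (yes ≡.refl) = S².trans (⟦⟧-cong Δ-linear (⊙-same A B)) (S².trans (Δ-basis (n , A ∨Π B))
        (Conv².σ-cong n {f = component (n , A ∨Π B)} λ k l eq → S².sym (S².trans
          (Conv².σ-single n {f = λ k′ l′ → component (n , A) k l ⊙² component (n , B) k′ l′} k l eq λ k′ l′ eq′ k′≢k →
            component-⊙²-different A B (cut {k} {l} eq) (cut {k′} {l′} eq′) λ (k≡k′ , _) → k′≢k (≡.sym k≡k′))
          (component-⊙²-same A B (cut {k} {l} eq)))))
      go {m} {n} A B (no m≢n) = S².trans (⟦⟧-cong Δ-linear (⊙-different m≢n A B)) (S².trans (0ᴹ-homo Δ-linear)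
        (S².sym (Conv².σ-ε m λ k l eq → Conv².σ-ε n λ k′ l′ eq′ →
          component-⊙²-different A B (cut {k} {l} eq) (cut {k′} {l′} eq′) λ (k≡k′ , l≡l′) →
            m≢n (≡.trans (≡.sym eq) (≡.trans (≡.cong₂ _+ℕ_ k≡k′ l≡l′) eq′)))))

    ε-⊙-basis : ∀ a b → ε (⟨ a ⟩ ⊙ ⟨ b ⟩) K.≈ ε ⟨ a ⟩ K.* ε ⟨ b ⟩
    ε-⊙-basis (m , A) (n , B) = go A B (m ℕ.≟ n)
      where
      go : ∀ {m n} (A : SetPartition m) (B : SetPartition n) → Dec (m ≡ n) →
           ε (⟨ m , A ⟩ ⊙ ⟨ n , B ⟩) K.≈ ε ⟨ m , A ⟩ K.* ε ⟨ n , B ⟩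
      go {zero} A B (yes ≡.refl) = K.trans (⟦⟧-cong ε-linear (⊙-same A B)) (K.trans (ε-basis (0 , A ∨Π B))
        (K.sym (K.trans (K.*-cong (ε-basis (0 , A)) (ε-basis (0 , B))) (K.*-identityʳ K.1#))))
      go {suc n} A B (yes ≡.refl) = K.trans (⟦⟧-cong ε-linear (⊙-same A B)) (K.trans (ε-basis (suc n , A ∨Π B))
        (K.sym (K.trans (K.*-congʳ (ε-basis (suc n , A))) (K.zeroˡ _))))
      go {zero} {zero} A B (no m≢n) = ⊥-elim (m≢n ≡.refl)
      go {suc m} {n} A B (no m≢n) = K.trans (⟦⟧-cong ε-linear (⊙-different m≢n A B)) (K.trans (0ᴹ-homo ε-linear)
        (K.sym (K.trans (K.*-congʳ (ε-basis (suc m , A))) (K.zeroˡ _))))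
      go {zero} {suc n} A B (no m≢n) = K.trans (⟦⟧-cong ε-linear (⊙-different m≢n A B)) (K.trans (0ᴹ-homo ε-linear)
        (K.sym (K.trans (K.*-congˡ (ε-basis (suc n , B))) (K.zeroʳ _))))

  Δ-⊙ : ∀ x y → Δ (x ⊙ y) 𝔾².≈ᴹ (Δ x ⊙² Δ y)
  Δ-⊙ x y = Free-ext {B = Π-graded} 𝔾² {f = λ x → Δ (x ⊙ y)} {g = λ x → Δ x ⊙² Δ y}
    (∘-linear {U = 𝔾} {𝔾} {𝔾²} Δ-linear (⊙-linearˡ y))
    (∘-linear {U = 𝔾} {𝔾²} {𝔾²} (⊙²-linearˡ (Δ y)) Δ-linear)
    (λ a → Free-ext {B = Π-graded} 𝔾² {f = λ y → Δ (⟨ a ⟩ ⊙ y)} {g = λ y → Δ ⟨ a ⟩ ⊙² Δ y}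
      (∘-linear {U = 𝔾} {𝔾} {𝔾²} Δ-linear (⊙-linearʳ ⟨ a ⟩))
      (∘-linear {U = 𝔾} {𝔾²} {𝔾²} (⊙²-linearʳ (Δ ⟨ a ⟩)) Δ-linear)
      (Δ-⊙-basis a) y) x

  ε-⊙ : ∀ x y → ε (x ⊙ y) K.≈ ε x K.* ε y
  ε-⊙ x y = Free-ext {B = Π-graded} 𝕜¹ {f = λ x → ε (x ⊙ y)} {g = λ x → ε x K.* ε y}
    (∘-linear {U = 𝔾} {𝔾} {𝕜¹} ε-linear (⊙-linearˡ y))
    (∘-linear {U = 𝔾} {𝕜¹} {𝕜¹} (*-linearʳ (ε y)) ε-linear)
    (λ a → Free-ext {B = Π-graded} 𝕜¹ {f = λ y → ε (⟨ a ⟩ ⊙ y)} {g = λ y → ε ⟨ a ⟩ K.* ε y}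
      (∘-linear {U = 𝔾} {𝔾} {𝕜¹} ε-linear (⊙-linearʳ ⟨ a ⟩))
      (*ₗ-linear {V = 𝔾} {𝕜¹} (ε ⟨ a ⟩) ε-linear)
      (ε-⊙-basis a) y) x
    where
    *-linearʳ : ∀ k → IsLinear 𝕜¹ 𝕜¹ (K._* k)
    *-linearʳ k = mkLinear 𝕜¹ 𝕜¹ K.*-congʳ (λ x y → K.distribʳ k x y) (λ x y → K.*-assoc x y k)

  isBialgebra : IsBialgebra 𝔾 _⊙_ Δ
  isBialgebra = record
    { ⊙-bilinear = ⊙-bilinear
    ; ⊙-assoc    = ⊙-assoc
    ; Δ-linear   = Δ-linear
    ; Δ-coassoc  = Δ-coassoc
    ; ε          = ε
    ; ε-linear   = ε-linear
    ; counitˡ    = counitˡ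
    ; counitʳ    = counitʳ
    ; Δ-⊙        = Δ-⊙
    ; ε-⊙        = ε-⊙
    }

-- Classes of modules

module Classes {c ℓ} (K : Field c ℓ) where
  private
    module K = Field K
  open LinearAlgebra K.commutativeRing
  open Grothendieck K
  open Linear K.commutativeRing
  open Splitting K.commutativeRing
  open MonoidModules K.commutativeRing
  open TensorModules K.commutativeRing
  open Parametrised K.commutativeRing
  open Bialgebra K
  open IsLeftModuleHomomorphism
  private module Σᴷ = ListSum K.+-commutativeMonoid

  χ : SetPartition n → SetPartition n → K.Carrier
  χ A C = K.1# Σᴷ.when A ≤Π? C

  module _ {n : ℕ} (A : SetPartition n) where
    private
      module R = Ring (𝕜Π n)
      module F = LeftModule (G₀ n)
      module Σᴿ = ListSum R.+-commutativeMonoid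
      open FormalSum (FreeRelation (Monoid.setoid (Π-monoid n))) using (rel; _≋_; reflexive; ++-cong)
      open Möbius K.ring
      open MonoidAlgebra (Π-monoid n) using (scalars)
      L = partitions n
      B₀ = Monoid.setoid (Π-monoid n)

      χ-cong : ∀ {C D} → C ≈Π D → χ A C K.≈ χ A D
      χ-cong {C} {D} C≈D = Σᴷ.when-⇔ (A ≤Π? C) (A ≤Π? D)
        (λ A≤C → ≤Π-trans A C D A≤C (≈Π⇒≤Π C D C≈D))
        (λ A≤D → ≤Π-trans A D C A≤D (≈Π⇒≤Π D C (≈Π-sym C D C≈D))) λ _ → K.refl

      χ̂ : R.Carrier → K.Carrier
      χ̂ = Free-rec {B = B₀} 𝕜¹ (χ A)

      χ̂-linear : IsLinear (G₀ n) 𝕜¹ χ̂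
      χ̂-linear = Free-rec-linear {B = B₀} 𝕜¹ (λ {C} {D} → χ-cong {C} {D})

      scalars-* : ∀ k x → (scalars k R.* x) ≋ (k F.*ₗ x)
      scalars-* k []            = R.refl
      scalars-* k ((l , C) ∷ x) =
        ++-cong {[ _ ]} {[ _ ]} (rel (cong K.refl (Monoid.identityˡ (Π-monoid n) C))) (scalars-* k x)

      χ̂-∑ : (f : SetPartition n → R.Carrier) → ∀ Bs → χ̂ (Σᴿ.∑ Bs f) K.≈ Σᴷ.∑ Bs (χ̂ ∘ f)
      χ̂-∑ f []       = K.refl
      χ̂-∑ f (B ∷ Bs) = K.trans (+ᴹ-homo χ̂-linear (f B) (Σᴿ.∑ Bs f)) (K.+-congˡ (χ̂-∑ f Bs))

      χ̂-e : χ̂ (e A) K.≈ K.1#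
      χ̂-e = K.trans (⟦⟧-cong χ̂-linear (e-∑ K A)) (K.trans (χ̂-∑ _ L)
        (K.trans (Σᴷ.∑-cong L λ B → term B (B ≤Π? A)) (Σᴷ.∑-partitions-single (λ _ → K.1#) (λ _ _ _ → K.refl) A)))
        where
        term : ∀ B (d : Dec (B ≤Π A)) → χ̂ ([ μ B A , B ] Σᴿ.when d) K.≈ (K.1# Σᴷ.when B ≈Π? A)
        term B (no B≰A)  = K.sym (Σᴷ.when-no (B ≈Π? A) λ B≈A → B≰A (≈Π⇒≤Π B A B≈A))
        term B (yes B≤A) = K.trans (K.+-identityʳ _) (by (A ≤Π? B))
          where
          by : (d : Dec (A ≤Π B)) → μ B A K.* (K.1# Σᴷ.when d) K.≈ (K.1# Σᴷ.when B ≈Π? A)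
          by (yes A≤B) = K.trans (K.*-identityʳ _) (K.trans (μ-≈ K.ring B A (≤Π-antisym B A B≤A A≤B))
            (K.sym (Σᴷ.when-yes (B ≈Π? A) (≤Π-antisym B A B≤A A≤B))))
          by (no A≰B)  = K.trans (K.zeroʳ _)
            (K.sym (Σᴷ.when-no (B ≈Π? A) λ B≈A → A≰B (≈Π⇒≤Π A B (≈Π-sym B A B≈A))))

      eigen : ∀ C → (⟨ C ⟩ R.* e A) ≋ (scalars (χ A C) R.* e A)
      eigen C = R.trans (basis-*-e K C A) (by (A ≤Π? C))
        where
        by : (d : Dec (A ≤Π C)) → (e A Σᴿ.when d) ≋ (scalars (K.1# Σᴷ.when d) R.* e A)
        by (yes _) = R.sym (R.*-identityˡ (e A))
        by (no _)  = R.sym (R.trans (R.*-congʳ {e A} (rel (zero (𝟏 n)))) (R.zeroˡ (e A)))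

      *-e : ∀ y → (y R.* e A) ≋ (scalars (χ̂ y) R.* e A)
      *-e []            = R.trans (R.zeroˡ (e A))
        (R.sym (R.trans (R.*-congʳ {e A} (rel (zero (𝟏 n)))) (R.zeroˡ (e A))))
      *-e ((k , C) ∷ y) = begin
        ([ k , C ] R.+ y) R.* e A                    ≈⟨ R.distribʳ (e A) [ k , C ] y ⟩
        [ k , C ] R.* e A R.+ y R.* e A              ≈⟨ R.+-cong {[ k , C ] R.* e A} monomial (*-e y) ⟩
        scalars (k K.* χ A C) R.* e A R.+ scalars (χ̂ y) R.* e A
          ≈⟨ R.distribʳ (e A) (scalars (k K.* χ A C)) (scalars (χ̂ y)) ⟨
        (scalars (k K.* χ A C) R.+ scalars (χ̂ y)) R.* e A
          ≈⟨ R.*-congʳ {e A} (rel (add (k K.* χ A C) (χ̂ y) (𝟏 n))) ⟨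
        scalars (k K.* χ A C K.+ χ̂ y) R.* e A        ∎
        where
        open SetoidReasoning R.setoid
        monomial : ([ k , C ] R.* e A) ≋ (scalars (k K.* χ A C) R.* e A)
        monomial = begin
          [ k , C ] R.* e A
            ≈⟨ R.*-congʳ {e A} (rel (cong (K.*-identityʳ k) (Monoid.identityˡ (Π-monoid n) C))) ⟨
          (scalars k R.* [ K.1# , C ]) R.* e A            ≈⟨ R.*-assoc (scalars k) [ K.1# , C ] (e A) ⟩
          scalars k R.* ([ K.1# , C ] R.* e A)            ≈⟨ R.*-congˡ {scalars k} (eigen C) ⟩
          scalars k R.* (scalars (χ A C) R.* e A)         ≈⟨ R.*-assoc (scalars k) (scalars (χ A C)) (e A) ⟨
          (scalars k R.* scalars (χ A C)) R.* e A
            ≈⟨ R.*-congʳ {e A} (rel (cong K.refl (Monoid.identityˡ (Π-monoid n) (𝟏 n)))) ⟩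
          scalars (k K.* χ A C) R.* e A                   ∎

      χ̂-scalars : ∀ k x → χ̂ (scalars k R.* x) K.≈ k K.* χ̂ x
      χ̂-scalars k x = K.trans (⟦⟧-cong χ̂-linear (scalars-* k x)) (*ₗ-homo χ̂-linear k x)

    simple-line : IsLine {P = Π-monoid n} V⟨ A ⟩ (χ A)
    simple-line = record
      { v        = e A , R.1# , R.sym (R.*-identityˡ (e A))
      ; φ        = χ̂ ∘ proj₁
      ; φ-linear = mkLinear (MonoidAlgebra.underlying (Π-monoid n) V⟨ A ⟩) 𝕜¹
          (λ p → ⟦⟧-cong χ̂-linear p) (λ (x , _) (y , _) → +ᴹ-homo χ̂-linear x y) (λ k (x , _) → χ̂-scalars k x)
      ; φ-v      = χ̂-e
      ; spans    = λ (x , y , x≋ye) → R.trans x≋ye (R.trans (*-e y) (R.*-congʳ {e A} (rel (cong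
          (K.sym (K.trans (⟦⟧-cong χ̂-linear (R.trans x≋ye (*-e y))) (K.trans (χ̂-scalars (χ̂ y) (e A))
            (K.trans (K.*-congˡ χ̂-e) (K.*-identityʳ _))))) (≈Π-refl (𝟏 n))))))
      ; eigen    = eigen
      }

  χ-∨ : (A B C : SetPartition n) → χ A C K.* χ B C K.≈ χ (A ∨Π B) C
  χ-∨ A B C = by (A ≤Π? C) (B ≤Π? C)
    where
    by : (d : Dec (A ≤Π C)) (d′ : Dec (B ≤Π C)) → (K.1# Σᴷ.when d) K.* (K.1# Σᴷ.when d′) K.≈ χ (A ∨Π B) C
    by (yes A≤C) (yes B≤C) = K.trans (K.*-identityʳ K.1#) (K.sym (Σᴷ.when-yes ((A ∨Π B) ≤Π? C) (∨Π-least A B C A≤C B≤C)))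
    by (yes _)   (no B≰C)  = K.trans (K.zeroʳ _)
      (K.sym (Σᴷ.when-no ((A ∨Π B) ≤Π? C) λ A∨B≤C → B≰C (proj₂ (∨Π-≤⁻ A B C A∨B≤C))))
    by (no A≰C)  _         = K.trans (K.zeroˡ _)
      (K.sym (Σᴷ.when-no ((A ∨Π B) ≤Π? C) λ A∨B≤C → A≰C (proj₁ (∨Π-≤⁻ A B C A∨B≤C))))

  module _ (A : SetPartition n) (d : Cut k l n) where
    private
      ρ : SetPartition k × SetPartition l → SetPartition n
      ρ = ρ-basis (Cut.sum≡ d)

    χ-ρ : Splits A d → ∀ C D → χ A (ρ (C , D)) K.≈ χ (A ↾ˡ d) C K.* χ (A ↾ʳ d) D
    χ-ρ s C D = by ((A ↾ˡ d) ≤Π? C) ((A ↾ʳ d) ≤Π? D)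
      where
      by : (p : Dec ((A ↾ˡ d) ≤Π C)) (q : Dec ((A ↾ʳ d) ≤Π D)) →
           χ A (ρ (C , D)) K.≈ (K.1# Σᴷ.when p) K.* (K.1# Σᴷ.when q)
      by (yes A≤C) (yes A≤D) = K.trans (Σᴷ.when-yes (A ≤Π? ρ (C , D)) (≤-∣⁺ {C = C} {D} d s A≤C A≤D)) (K.sym (K.*-identityʳ K.1#))
      by (yes _)   (no A≰D)  = K.trans (Σᴷ.when-no (A ≤Π? ρ (C , D)) λ A≤ → A≰D (proj₂ (proj₂ (≤-∣⁻ {C = C} {D} d A≤))))
        (K.sym (K.zeroʳ _))
      by (no A≰C)  _         = K.trans (Σᴷ.when-no (A ≤Π? ρ (C , D)) λ A≤ → A≰C (proj₁ (proj₂ (≤-∣⁻ {C = C} {D} d A≤))))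
        (K.sym (K.zeroˡ _))

    χ-ρ-𝟏 : Splits A d → χ A (ρ (𝟏 k , 𝟏 l)) K.≈ K.1#
    χ-ρ-𝟏 s = Σᴷ.when-yes (A ≤Π? ρ (𝟏 k , 𝟏 l))
      (≤-∣⁺ {C = 𝟏 k} {𝟏 l} d s (≤Π-maximum (A ↾ˡ d)) (≤Π-maximum (A ↾ʳ d)))

    χ-ρ-𝟏-¬splits : ¬ Splits A d → χ A (ρ (𝟏 k , 𝟏 l)) K.≈ K.0#
    χ-ρ-𝟏-¬splits ¬s = Σᴷ.when-no (A ≤Π? ρ (𝟏 k , 𝟏 l)) λ A≤ → ¬s (proj₁ (≤-∣⁻ {C = 𝟏 k} {𝟏 l} d A≤))

  private
    zeroModule : (R : Ring c (c ⊔ ℓ)) → Mod R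
    zeroModule R = leftIdeal R (Ring.0# R)

    zeroModule-zero : ∀ R u → LeftModule._≈ᴹ_ (zeroModule R) u (LeftModule.0ᴹ (zeroModule R))
    zeroModule-zero R (x , y , x≈y*0) = Ring.trans R x≈y*0 (Ring.zeroʳ R y)

  module _ {R : Ring c (c ⊔ ℓ)} {I : Set} (S : I → Mod R)
           {g ℓg} (G : VectorSpace g ℓg) (s : I → LeftModule.Carrierᴹ G) where
    private module G = LeftModule G

    class-iso : ∀ {V W x} → ShortExact (zeroModule R) V W → HasClass S G s W x → HasClass S G s V x
    class-iso se W-class = resp (G.+ᴹ-identityˡ _) (exact se (zero (zeroModule-zero R)) W-class)

    -- If Φ describes the exact functor F on the classes of simple modules, then it does so on all classes.
    module _ {R′ : Ring c (c ⊔ ℓ)} {I′ : Set} (S′ : I′ → Mod R′)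
             {g′ ℓg′} (G′ : VectorSpace g′ ℓg′) (s′ : I′ → LeftModule.Carrierᴹ G′)
             {h ℓh} (H : VectorSpace h ℓh)
             {Φ : G.Carrierᴹ → LeftModule.Carrierᴹ H} (Φ-linear : IsLinear G H Φ)
             {Ψ : LeftModule.Carrierᴹ G′ → LeftModule.Carrierᴹ H} (Ψ-linear : IsLinear G′ H Ψ)
             (F : Mod R → Mod R′)
             (F-zero : ∀ V → (∀ v → LeftModule._≈ᴹ_ V v (LeftModule.0ᴹ V)) →
                       ∀ v → LeftModule._≈ᴹ_ (F V) v (LeftModule.0ᴹ (F V)))
             (F-exact : ∀ {U V W w} → HasClass S G s W w → ShortExact U V W → ShortExact (F U) (F V) (F W)) where
      private
        module G′ = LeftModule G′
        module H = LeftModule H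

      class-functor : (∀ i → ∃ λ z → HasClass S′ G′ s′ (F (S i)) z × Φ (s i) H.≈ᴹ Ψ z) →
                      ∀ {V x} → HasClass S G s V x → ∃ λ z → HasClass S′ G′ s′ (F V) z × Φ x H.≈ᴹ Ψ z
      class-functor base (simple i)         = base i
      class-functor base (zero {V} V≈0)     =
        G′.0ᴹ , zero (F-zero V V≈0) , H.≈ᴹ-trans (0ᴹ-homo Φ-linear) (H.≈ᴹ-sym (0ᴹ-homo Ψ-linear))
      class-functor base (exact se U-class W-class) =
        let y , U-class′ , Φ≈y = class-functor base U-class
            z , W-class′ , Φ≈z = class-functor base W-class
        in y G′.+ᴹ z , exact (F-exact W-class se) U-class′ W-class′ ,
           H.≈ᴹ-trans (+ᴹ-homo Φ-linear _ _) (H.≈ᴹ-trans (H.+ᴹ-cong Φ≈y Φ≈z) (H.≈ᴹ-sym (+ᴹ-homo Ψ-linear _ _)))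
      class-functor base (resp x≈y V-class) =
        let z , V-class′ , Φ≈z = class-functor base V-class
        in z , V-class′ , H.≈ᴹ-trans (H.≈ᴹ-sym (⟦⟧-cong Φ-linear x≈y)) Φ≈z

  ι-linear : ∀ n → IsLinear (G₀ n) G₀Π (ι n)
  ι-linear n = mkLinear (G₀ n) G₀Π ι-cong (λ x y → reflexive (List.map-++ _ x y)) scale
    where
    open FormalSum (FreeRelation Π-graded)
    module S = FormalSum (FreeRelation (Monoid.setoid (Π-monoid n)))

    ι-cong : ∀ {x y} → x S.≋ y → ι n x ≋ ι n y
    ι-cong (S.rel (cong k≈l A≈B)) = rel (cong k≈l (same A≈B))
    ι-cong (S.rel (add k l A))    = rel (add k l (n , A))
    ι-cong (S.rel (zero A))       = rel (zero (n , A))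
    ι-cong S.refl                 = refl
    ι-cong (S.sym p)              = sym (ι-cong p)
    ι-cong (S.trans p q)          = trans (ι-cong p) (ι-cong q)
    ι-cong (S.++-cong {xs} {xs′} {ys} {ys′} p q) = trans (reflexive (List.map-++ _ xs ys))
      (trans (++-cong (ι-cong p) (ι-cong q)) (reflexive (≡.sym (List.map-++ _ xs′ ys′))))
    ι-cong (S.++-comm xs ys)      = trans (reflexive (List.map-++ _ xs ys))
      (trans (++-comm (ι n xs) (ι n ys)) (reflexive (≡.sym (List.map-++ _ ys xs))))

    scale : ∀ k x → ι n (LeftModule._*ₗ_ (G₀ n) k x) ≋ LeftModule._*ₗ_ G₀Π k (ι n x)
    scale k []      = refl
    scale k (_ ∷ x) = ++-cong {[ _ ]} {[ _ ]} refl (scale k x)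

  ι²-linear : ∀ k l → IsLinear (G₀ k ⊗ G₀ l) (G₀Π ⊗ G₀Π) (ι² k l)
  ι²-linear k l = mkLinear (G₀ k ⊗ G₀ l) (G₀Π ⊗ G₀Π) ι²-cong (λ x y → reflexive (List.map-++ _ x y)) scale
    where
    open FormalSum (TensorRelation G₀Π G₀Π)
    module S = FormalSum (TensorRelation (G₀ k) (G₀ l))
    module 𝔾 = LeftModule G₀Π

    ι²-cong : ∀ {x y} → x S.≋ y → ι² k l x ≋ ι² k l y
    ι²-cong (S.rel (cong x≈x′ y≈y′)) = rel (cong (⟦⟧-cong (ι-linear k) x≈x′) (⟦⟧-cong (ι-linear l) y≈y′))
    ι²-cong (S.rel (addˡ x x′ y))    = trans (rel (cong (+ᴹ-homo (ι-linear k) x x′) 𝔾.≈ᴹ-refl)) (rel (addˡ _ _ _))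
    ι²-cong (S.rel (addʳ x y y′))    = trans (rel (cong 𝔾.≈ᴹ-refl (+ᴹ-homo (ι-linear l) y y′))) (rel (addʳ _ _ _))
    ι²-cong (S.rel (scalar r x y))   = trans (rel (cong (*ₗ-homo (ι-linear k) r x) 𝔾.≈ᴹ-refl))
      (trans (rel (scalar r _ _)) (rel (cong 𝔾.≈ᴹ-refl (𝔾.≈ᴹ-sym (*ₗ-homo (ι-linear l) r y)))))
    ι²-cong (S.rel (zeroˡ′ y))       = rel (zeroˡ′ _)
    ι²-cong S.refl                   = refl
    ι²-cong (S.sym p)                = sym (ι²-cong p)
    ι²-cong (S.trans p q)            = trans (ι²-cong p) (ι²-cong q)
    ι²-cong (S.++-cong {xs} {xs′} {ys} {ys′} p q) = trans (reflexive (List.map-++ _ xs ys))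
      (trans (++-cong (ι²-cong p) (ι²-cong q)) (reflexive (≡.sym (List.map-++ _ xs′ ys′))))
    ι²-cong (S.++-comm xs ys)        = trans (reflexive (List.map-++ _ xs ys))
      (trans (++-comm (ι² k l xs) (ι² k l ys)) (reflexive (≡.sym (List.map-++ _ ys xs))))

    scale : ∀ r x → ι² k l (LeftModule._*ₗ_ (G₀ k ⊗ G₀ l) r x) ≋ LeftModule._*ₗ_ (G₀Π ⊗ G₀Π) r (ι² k l x)
    scale r []            = refl
    scale r ((x , y) ∷ t) = ++-cong {[ _ ]} {[ _ ]} (rel (cong (*ₗ-homo (ι-linear k) r x) 𝔾.≈ᴹ-refl)) (scale r t)

  module _ {P : Monoid 0ℓ 0ℓ} {I : Set} (S : I → Mod (algebra P)) {χ : I → Monoid.Carrier P → K.Carrier}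
           (S-line : ∀ i → IsLine {P = P} (S i) (χ i))
           (G : VectorSpace c (c ⊔ ℓ)) (s : I → LeftModule.Carrierᴹ G) where
    private
      R = algebra P
      module G = LeftModule G

      Class : Mod R → G.Carrierᴹ → Set (lsuc (c ⊔ ℓ))
      Class = HasClass {R = R} S G s

      infixr 7 _⊠_
      _⊠_ : Mod R → Mod R → Mod R
      V ⊠ W = diagonalTensor P V W

      id-homo = Identity.isMonoidHomomorphism (Monoid.rawMonoid P) (Monoid.refl P)

    class-dualBasis : ∀ {V x} → Class V x → DualBasis (MonoidAlgebra.underlying P V)
    class-dualBasis (simple i)                             = IsLine.dualBasis (S-line i)
    class-dualBasis (zero V≈0)                             = record { elements = [] ; expand = V≈0 }
    class-dualBasis (exact {U} {V} {W} se U-class W-class) =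
      extension-dualBasis (underlying-exact {U = U} {V} {W} se) (class-dualBasis W-class) (class-dualBasis U-class)
    class-dualBasis (resp _ V-class)                       = class-dualBasis V-class

    line-class : ∀ {V ψ} → IsLine {P = P} V ψ → ∀ i → (∀ p → ψ p K.≈ χ i p) → Class V (s i)
    line-class {V} V-line i ψ≈χ = class-iso S G s {V} {S i}
      (line-exact {P = P} {U = zeroModule R} {V} {S i} (zeroModule-zero R) V-line (S-line i) ψ≈χ) (simple i)

    ⊠-zero : ∀ X V → (∀ v → LeftModule._≈ᴹ_ V v (LeftModule.0ᴹ V)) →
             ∀ t → LeftModule._≈ᴹ_ (V ⊠ X) t (LeftModule.0ᴹ (V ⊠ X))
    ⊠-zero X V V≈0 = go
      where
      open FormalSum (TensorRelation (MonoidAlgebra.underlying P V) (MonoidAlgebra.underlying P X))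
      go : ∀ t → t ≋ []
      go []            = refl
      go ((v , x) ∷ t) = ++-cong {[ _ ]} {[]}
        (trans (rel (cong (V≈0 v) (LeftModule.≈ᴹ-refl X))) (rel (zeroˡ′ x))) (go t)

    swap-exact : ∀ V W → ShortExact (zeroModule R) (V ⊠ W) (W ⊠ V)
    swap-exact V W = iso⇒exact {U = zeroModule R} {V ⊠ W} {W ⊠ V} (zeroModule-zero R) (swap-linear V W)
      (λ {s} {t} p → ≡.subst₂ (LeftModule._≈ᴹ_ (V ⊠ W)) (swap-involutive V W s) (swap-involutive V W t)
                       (⟦⟧-cong (swap-linear W V) p))
      (λ t → swap W V t , LeftModule.≈ᴹ-reflexive (W ⊠ V) (swap-involutive W V t))

    module _ (_∨_ : I → I → I) (χ-∨ : ∀ i j p → χ i p K.* χ j p K.≈ χ (i ∨ j) p)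
             (H : VectorSpace c (c ⊔ ℓ)) {ι : G.Carrierᴹ → LeftModule.Carrierᴹ H} (ι-linear : IsLinear G H ι)
             {_⊙_ : LeftModule.Carrierᴹ H → LeftModule.Carrierᴹ H → LeftModule.Carrierᴹ H}
             (⊙-bilinear : IsBilinear H H H _⊙_)
             (⊙-simple : ∀ i j → LeftModule._≈ᴹ_ H (ι (s i) ⊙ ι (s j)) (ι (s (i ∨ j)))) where
      private
        module H = LeftModule H
        open IsBilinear ⊙-bilinear

        simple-⊠-simple : ∀ i j → Class (S i ⊠ S j) (s (i ∨ j))
        simple-⊠-simple i j = line-class {S i ⊠ S j}
          (tensor-line {M = P} {P} {P} id-homo id-homo (S-line i) (S-line j)) (i ∨ j) (χ-∨ i j)

        swap-class : ∀ V W {z} → Class (W ⊠ V) z → Class (V ⊠ W) z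
        swap-class V W = class-iso S G s {V ⊠ W} {W ⊠ V} (swap-exact V W)

        -⊠-class : ∀ X {Φ : G.Carrierᴹ → H.Carrierᴹ} → IsLinear G H Φ →
          (∀ i → ∃ λ z → Class (S i ⊠ X) z × Φ (s i) H.≈ᴹ ι z) →
          ∀ {V x} → Class V x → ∃ λ z → Class (V ⊠ X) z × Φ x H.≈ᴹ ι z
        -⊠-class X {Φ} Φ-linear = class-functor {R = R} S G s {R} S G s H {Φ} Φ-linear {ι} ι-linear (_⊠ X)
          (⊠-zero X) (λ {U} {V} {W} W-class → ⊗-exact {P = P} {X = X} {U} {V} {W} (class-dualBasis W-class))

        class-⊠-simple : ∀ i {W y} → Class W y → ∃ λ z → Class (W ⊠ S i) z × (ι (s i) ⊙ ι y) H.≈ᴹ ι z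
        class-⊠-simple i = -⊠-class (S i) {λ y → ι (s i) ⊙ ι y}
          (∘-linear {U = G} {H} {H} (homoʳ (ι (s i))) ι-linear)
          (λ j → s (i ∨ j) , swap-class (S j) (S i) (simple-⊠-simple i j) , ⊙-simple i j)

        simple-⊠-class : ∀ i {W y} → Class W y → ∃ λ z → Class (S i ⊠ W) z × (ι (s i) ⊙ ι y) H.≈ᴹ ι z
        simple-⊠-class i {W} W-class =
          let z , class , eq = class-⊠-simple i W-class in z , swap-class (S i) W class , eq

      ⊠-class : ∀ {V W x y} → Class V x → Class W y → ∃ λ z → Class (V ⊠ W) z × (ι x ⊙ ι y) H.≈ᴹ ι z
      ⊠-class {W = W} {y = y} V-class W-class = -⊠-class W {λ x → ι x ⊙ ι y}
        (∘-linear {U = G} {H} {H} (homoˡ (ι y)) ι-linear) (λ i → simple-⊠-class i W-class) V-class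

  isTensorProductOfClasses : IsTensorProductOfClasses _⊙_
  isTensorProductOfClasses = record
    { same-degree      = λ {n} → ⊠-class {P = Π-monoid n} V⟨_⟩ simple-line (G₀ n) ⟨_⟩
                                   _∨Π_ χ-∨ G₀Π (ι-linear n) ⊙-bilinear ⊙-same
    ; different-degree = ⊙-different
    }

  module _ {P Q : Monoid 0ℓ 0ℓ} {f : Monoid.Carrier P → Monoid.Carrier Q}
           (f-homo : IsMagmaHomomorphism (Monoid.rawMagma P) (Monoid.rawMagma Q) f)
           {I : Set} (S : I → Mod (algebra Q)) {χ : I → Monoid.Carrier Q → K.Carrier}
           (S-line : ∀ i → IsLine {P = Q} (S i) (χ i)) (G : VectorSpace c (c ⊔ ℓ)) (s : I → LeftModule.Carrierᴹ G)
           {J : Set} (T : J → Mod (algebra P)) {ψ : J → Monoid.Carrier P → K.Carrier}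
           (T-line : ∀ j → IsLine {P = P} (T j) (ψ j)) (G′ : VectorSpace c (c ⊔ ℓ)) (t : J → LeftModule.Carrierᴹ G′)
           (H : VectorSpace c (c ⊔ ℓ)) {Φ : LeftModule.Carrierᴹ G → LeftModule.Carrierᴹ H} (Φ-linear : IsLinear G H Φ)
           {Ψ : LeftModule.Carrierᴹ G′ → LeftModule.Carrierᴹ H} (Ψ-linear : IsLinear G′ H Ψ) where
    private
      module P = Monoid P
      module H = LeftModule H

      Resᶠ : Mod (algebra Q) → Mod (algebra P)
      Resᶠ = Res {R = algebra P} {S = algebra Q} (linearExtension-homo {M = P} {N = Q} f-homo)

    Res-class :
      (∀ i → (∃ λ j → χ i (f P.ε) K.≈ K.1# × (∀ p → χ i (f p) K.≈ ψ j p) × Φ (s i) H.≈ᴹ Ψ (t j)) ⊎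
             (χ i (f P.ε) K.≈ K.0# × Φ (s i) H.≈ᴹ H.0ᴹ)) →
      ∀ {V x} → HasClass {R = algebra Q} S G s V x →
      ∃ λ z → HasClass {R = algebra P} T G′ t (Resᶠ V) z × Φ x H.≈ᴹ Ψ z
    Res-class restriction = class-functor {R = algebra Q} S G s {algebra P} T G′ t H {Φ} Φ-linear {Ψ} Ψ-linear Resᶠ
      (λ V V≈0 (v , _) → V≈0 v)
      (λ {U} {V} {W} _ → Res-exact (linearExtension-homo {M = P} {N = Q} f-homo) {U} {V} {W})
      (λ i → on-simple i (restriction i))
      where
      on-simple : ∀ i → _ → ∃ λ z → HasClass {R = algebra P} T G′ t (Resᶠ (S i)) z × Φ (s i) H.≈ᴹ Ψ z
      on-simple i (inj₁ (j , χ≈1 , χ≈ψ , Φ≈Ψ)) = t j , line-class {P = P} T T-line G′ t {Resᶠ (S i)}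
        (Res-line {P = P} {Q} f-homo {V = S i} (S-line i) χ≈1) j χ≈ψ , Φ≈Ψ
      on-simple i (inj₂ (χ≈0 , Φ≈0)) = LeftModule.0ᴹ G′ ,
        zero (Res-zero {P = P} {Q} f-homo {V = S i} (S-line i) χ≈0) ,
        H.≈ᴹ-trans Φ≈0 (H.≈ᴹ-sym (0ᴹ-homo Ψ-linear))

  externalTensor-line : (M N : Monoid 0ℓ 0ℓ) {V : Mod (algebra M)} {W : Mod (algebra N)}
    {χ : Monoid.Carrier M → K.Carrier} {ψ : Monoid.Carrier N → K.Carrier} → IsLine {P = M} V χ → IsLine {P = N} W ψ →
    IsLine {P = M ×-monoid N} (externalTensor M N V W) (λ (p , q) → χ p K.* ψ q)
  externalTensor-line M N = tensor-line {M = M} {N} {M ×-monoid N}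
    (Proj.Proj₁.isMonoidHomomorphism (Monoid.refl M)) (Proj.Proj₂.isMonoidHomomorphism (Monoid.refl N))
    where module Proj = DirectProduct.Monoid (Monoid.rawMonoid M) (Monoid.rawMonoid N)

  private
    𝔾² = G₀Π ⊗ G₀Π
    module 𝔾² = LeftModule 𝔾²
    module Conv² = Convolution 𝔾².+ᴹ-commutativeMonoid

    Δ[,]-ι-linear : ∀ k l n → IsLinear (G₀ n) 𝔾² (λ x → Δ[ k , l ] (ι n x))
    Δ[,]-ι-linear k l n = ∘-linear {U = G₀ n} {G₀Π} {𝔾²} (Δ[,]-linear k l) (ι-linear n)

  private
    S² : ∀ k l → SetPartition k × SetPartition l → Mod (Π-monoid k ⊗ᴬ Π-monoid l)
    S² k l (B , C) = externalTensor (Π-monoid k) (Π-monoid l) V⟨ B ⟩ V⟨ C ⟩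

    χ² : ∀ k l → SetPartition k × SetPartition l → SetPartition k × SetPartition l → K.Carrier
    χ² k l (B , C) (D , E) = χ B D K.* χ C E

    s² : ∀ k l → SetPartition k × SetPartition l → LeftModule.Carrierᴹ (G₀ k ⊗ G₀ l)
    s² k l (B , C) = ⟨ B ⟩ ⊗ₑ ⟨ C ⟩

    S²-line : ∀ k l i → IsLine {P = Π-monoid k ×-monoid Π-monoid l} (S² k l i) (χ² k l i)
    S²-line k l (B , C) = externalTensor-line (Π-monoid k) (Π-monoid l) {V⟨ B ⟩} {V⟨ C ⟩} (simple-line B) (simple-line C)

    S²-restriction : (d : Cut k l n) (A : SetPartition n) →
      (∃ λ i → χ A (ρ-basis (Cut.sum≡ d) (𝟏 k , 𝟏 l)) K.≈ K.1# × (∀ p → χ A (ρ-basis (Cut.sum≡ d) p) K.≈ χ² k l i p) ×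
               Δ[ k , l ] (ι n ⟨ A ⟩) 𝔾².≈ᴹ ι² k l (s² k l i)) ⊎
      (χ A (ρ-basis (Cut.sum≡ d) (𝟏 k , 𝟏 l)) K.≈ K.0# × Δ[ k , l ] (ι n ⟨ A ⟩) 𝔾².≈ᴹ 𝔾².0ᴹ)
    S²-restriction {k} {l} {n} d A = go (splits? A d)
      where
      go : Dec (Splits A d) → _
      go (yes s) = inj₁ ((A ↾ˡ d , A ↾ʳ d) , χ-ρ-𝟏 A d s , (λ (C , D) → χ-ρ A d s C D) ,
        𝔾².≈ᴹ-trans (Δ[,]-basis k l (n , A)) (component-splits d s))
      go (no ¬s) = inj₂ (χ-ρ-𝟏-¬splits A d ¬s , 𝔾².≈ᴹ-trans (Δ[,]-basis k l (n , A)) (component-¬splits d ¬s))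

  Resρ-class : (d : Cut k l n) → ∀ {V x} → ClassOf n V x →
    ∃ λ z → ClassOf² k l (Resρ k l n (Cut.sum≡ d) V) z × Δ[ k , l ] (ι n x) 𝔾².≈ᴹ ι² k l z
  Resρ-class {k} {l} {n} d = Res-class {P = Π-monoid k ×-monoid Π-monoid l} {Π-monoid n} {ρ-basis (Cut.sum≡ d)}
    (ρ-basis-homo {k} {l} {n} (Cut.sum≡ d)) V⟨_⟩ {χ} simple-line (G₀ n) ⟨_⟩
    (S² k l) {χ² k l} (S²-line k l) (G₀ k ⊗ G₀ l) (s² k l)
    𝔾² {λ x → Δ[ k , l ] (ι n x)} (Δ[,]-ι-linear k l n) {ι² k l} (ι²-linear k l) (S²-restriction d)

  Δ-ι : ∀ n x → Δ (ι n x) 𝔾².≈ᴹ Conv².σ n (λ k l → Δ[ k , l ] (ι n x))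
  Δ-ι n = Free-ext {B = Monoid.setoid (Π-monoid n)} 𝔾²
    {f = λ x → Δ (ι n x)} {g = λ x → Conv².σ n (λ k l → Δ[ k , l ] (ι n x))}
    (∘-linear {U = G₀ n} {G₀Π} {𝔾²} Δ-linear (ι-linear n))
    (σ-linearʳ {V = G₀ n} {𝔾²} (λ k l → Δ[,]-ι-linear k l n) n)
    λ A → 𝔾².≈ᴹ-trans (Δ-basis (n , A)) (𝔾².≈ᴹ-sym (Conv².σ-cong n λ k l _ → Δ[,]-basis k l (n , A)))

  isSumOfRestrictions : IsSumOfRestrictions Δ
  isSumOfRestrictions = record { restrict = λ {n} {V} {x} V-class →
      let res = λ i → Resρ-class (cutAt n i) {V} {x} V-class in
      (λ i → proj₁ (res i)) , (λ i → proj₁ (proj₂ (res i))) ,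
      𝔾².≈ᴹ-trans (Δ-ι n x) (𝔾².≈ᴹ-trans (Conv².σ-sum n λ k l → Δ[ k , l ] (ι n x))
        (CommutativeMonoidSum.sum-cong-≋ 𝔾².+ᴹ-commutativeMonoid {suc n} λ i → proj₂ (proj₂ (res i)))) }
    where
    cutAt : ∀ n (i : Fin (suc n)) → Cut (toℕ i) (n ∸ toℕ i) n
    cutAt n i = cut (ℕ.m+[n∸m]≡n (Fin.toℕ≤pred[n] i))

proposition2p4 : ∀ {c ℓ} (K : Field c ℓ) → CharacteristicZero K →
    let open LinearAlgebra (Field.commutativeRing K)
        open Grothendieck K
    in ∃ λ (_⊙_ : LeftModule.Carrierᴹ G₀Π → LeftModule.Carrierᴹ G₀Π → LeftModule.Carrierᴹ G₀Π) →
       ∃ λ (Δ : LeftModule.Carrierᴹ G₀Π → LeftModule.Carrierᴹ (G₀Π ⊗ G₀Π)) →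
         IsTensorProductOfClasses _⊙_ × IsSumOfRestrictions Δ × IsBialgebra G₀Π _⊙_ Δ
proposition2p4 K _ = _⊙_ , Δ , isTensorProductOfClasses , isSumOfRestrictions , isBialgebra
  where
  open Bialgebra K
  open Classes K
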